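{- Let $\mathfrak{b}(n)$ be defined by $\sum_{n\ge 0}\mathfrak{b}(n)q^n=\beta(q)$, where $$\beta(q)=\sum_{n\ge 0}\frac{q^{n(n+1)}(-q^2;q^2)_n}{(q;q^2)_{n+1}^2}.$$ Then for all integers $\alpha\ge 1$ and $n\ge 0$, $$\mathfrak{b}\left(2\cdot 3^{2\alpha-1}n+\frac{3^{2\alpha}-1}{2}\right)\equiv 0 \pmod{3^{2\alpha}}.$$
   Context: For a formal variable $q$, $(a;q)_n=\prod_{k=0}^{n-1}(1-aq^k)$ and $(a;q)_\infty=\prod_{k\ge0}(1-aq^k)$. The function $\beta(q)$ is the second order mock theta function above, viewed as a power series in $q$. -}

module Defs where

open import Data.Nat as ℕ using (ℕ; zero; suc; _∸_)
open import Data.Nat.Divisibility using (_∣?_)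
open import Data.Integer as ℤ using (ℤ; +_)
open import Data.Bool using (if_then_else_)
open import Relation.Nullary using (does)

-- Formal power series in q with integer coefficients, as coefficient sequences.
Series : Set
Series = ℕ → ℤ

sumTo : ℕ → (ℕ → ℤ) → ℤ
sumTo zero    f = f zero
sumTo (suc n) f = sumTo n f ℤ.+ f (suc n)

oneS : Series
oneS zero    = + 1
oneS (suc _) = + 0

mono : ℕ → Series
mono d n = if does (n ℕ.≟ d) then + 1 else + 0

_⊕_ : Series → Series → Series
(f ⊕ g) n = f n ℤ.+ g n

_⊛_ : Series → Series → Series
(f ⊛ g) n = sumTo n (λ k → f k ℤ.* g (n ∸ k))

prodS : ℕ → (ℕ → Series) → Series
prodS zero    s = oneS
prodS (suc n) s = prodS n s ⊛ s n

-- 1/(1 - q^d) = Σ_{m ≥ 0} q^{d m}   (used for d ≥ 1)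
geom : ℕ → Series
geom d n = if does (d ∣? n) then + 1 else + 0

negQ2Poch : ℕ → Series
negQ2Poch n = prodS n (λ k → oneS ⊕ mono (2 ℕ.* k ℕ.+ 2))

invQPochSq : ℕ → Series
invQPochSq n = prodS (suc n) (λ k → geom (2 ℕ.* k ℕ.+ 1) ⊛ geom (2 ℕ.* k ℕ.+ 1))

βterm : ℕ → Series
βterm n = mono (n ℕ.* suc n) ⊛ (negQ2Poch n ⊛ invQPochSq n)

-- 𝔟(N) = coefficient of q^N in β(q).  The n-th summand is O(q^{n(n+1)}),
-- so only n ≤ N contribute to the coefficient of q^N.
𝔟 : ℕ → ℤ
𝔟 N = sumTo N (λ n → βterm n N)

{-# OPTIONS --safe #-}
module Submission where

-- The q-series Σ q^{n(n+1)} (-q²;q²)_n / (q;q²)²_{n+1} is expanded by partial fractions of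
-- 1/(q;q²)²_{N+1}; summing over n first (a limiting case of the q-Gauss sum, done by telescoping)
-- gives β(q) = C(q²) Σ_k (-1)^k q^{2k(k+1)} (1+q^{2k+1})/(1-q^{2k+1}) with C = (-q;q)_∞/(q;q)_∞.
-- The Lambert factors have even part of the same shape, so Σ 𝔟(2n) qⁿ = F := ψ(q)²/φ(-q).
--
-- Put p = φ(-q⁹)/φ(-q) and σ = φ(-q³)⁴/φ(-q)⁴.  The 3-dissections of φ and ψ, together with the norm
-- from q to q³, give σ = p - 3p² + 3p³ and p³ = σ(q³)(3p² - 3p + 1).  Hence the operators
-- g ↦ U₃ g and g ↦ U₃(F g) (coefficients of q^{3n}, resp. q^{3n+2}) map polynomials in σ to polynomials
-- in σ (times F(q³) for the second), with coefficients whose 3-adic valuations are controlled by the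
-- weights of the monomials.  On suitable lattices the first preserves integrality and the second gains 9.

open import Defs
open import Level using (0ℓ)
open import Data.Nat using (ℕ; zero; suc; _≤_; _<_; _^_; _*_; _+_; _∸_; _/_; _%_; z≤n; s≤s; s≤s⁻¹; NonZero; _≡ᵇ_; _≤ᵇ_; _≟_; _≤?_; _<?_; ∣_-_∣)
import Data.Nat.Properties as ℕₚ
import Data.Nat.DivMod as DM
open import Data.Nat.Divisibility using (_∣?_; ∣m+n∣m⇒∣n; ∣m∣n⇒∣m+n; ∣-refl; ∣⇒≤; m∣m*n) renaming (_∣_ to _∣ₙ_)
open import Data.Nat.Tactic.RingSolver using (solve-∀)
open import Data.Integer as ℤ using (ℤ; +_)
open import Data.Integer.Divisibility using (_∣_)
import Data.Integer.Properties as ℤₚ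
import Data.Integer.Solver as ℤSolver
open import Data.Bool using (if_then_else_; true; false) renaming (T to IsTrue)
open import Data.Maybe using (Maybe; just; nothing)
open import Data.Product using (Σ; _×_; _,_)
open import Data.Sum using (_⊎_; inj₁; inj₂)
open import Function using (_∘_; mk⇔)
open import Relation.Nullary using (yes; no; Dec)
open import Relation.Nullary.Decidable using (dec-true; dec-false; does-⇔)
open import Relation.Binary.PropositionalEquality as ≡ using (_≡_; _≢_)
open import Algebra.Bundles using (CommutativeRing)
open import Algebra.Structures using (IsCommutativeRing)
import Algebra.Solver.Ring as RingSolver
open import Algebra.Solver.Ring.AlmostCommutativeRing using (fromCommutativeRing; _-Raw-AlmostCommutative⟶_)
import Relation.Binary.Reasoning.Setoid as SetoidReasoning

-- The first factor 9 arises as 1 + 4 + 4: p = σ(q³)(1 + X + X²) with X = q ξ(q³), and in the class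
-- 2 modulo 3 of ψ² p the three summands acquire these multiplicities because A ξ = 2ψ(q³), where
-- A(q³) is the class-0 part of ψ. The factor F(q³) left over passes through the next U₃ as F, so
-- the two operators can alternate forever. The obstacle is that U₃ raises the degree in σ up to
-- threefold, so a common power of 3 alone is not a stable condition: higher powers of σ must carry
-- further powers of 3. Giving p weight 1, σ weight 3 on the image side and the integer 3 weight -2
-- makes the extreme terms of both relations between p and σ balance, which settles all large
-- exponents by one inequality. For some of the smallest exponents the inequality is too weak by one
-- factor 3, and there the image is expanded explicitly. Everything stays inside integer power
-- series: the norm is a cubic form in the three components modulo 3, and a limit is agreement of
-- the M-th approximant below q^M.

infix 4 _≈_
-- A record rather than a bare function type, so that both series can be inferred from a proof.
record _≈_ (f g : Series) : Set where
  constructor mk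
  field at : ∀ n → f n ≡ g n
open _≈_ public

-- Ring laws of the Cauchy product

tail : Series → Series
tail f n = f (suc n)

sumTo-cong : ∀ n {f g : ℕ → ℤ} → (∀ k → k ≤ n → f k ≡ g k) → sumTo n f ≡ sumTo n g
sumTo-cong zero    e = e 0 z≤n
sumTo-cong (suc n) e = ≡.cong₂ ℤ._+_ (sumTo-cong n (λ k k≤n → e k (ℕₚ.m≤n⇒m≤1+n k≤n))) (e (suc n) ℕₚ.≤-refl)

sumTo-+ : ∀ n (f g : ℕ → ℤ) → sumTo n (λ k → f k ℤ.+ g k) ≡ sumTo n f ℤ.+ sumTo n g
sumTo-+ zero    f g = ≡.refl
sumTo-+ (suc n) f g rewrite sumTo-+ n f g =
  solve 4 (λ a b c d → (a :+ b) :+ (c :+ d) := (a :+ c) :+ (b :+ d)) ≡.refl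
    (sumTo n f) (sumTo n g) (f (suc n)) (g (suc n))
  where open ℤSolver.+-*-Solver

sumTo-head : ∀ n (f : ℕ → ℤ) → sumTo (suc n) f ≡ f 0 ℤ.+ sumTo n (tail f)
sumTo-head zero    f = ≡.refl
sumTo-head (suc n) f rewrite sumTo-head n f = ℤₚ.+-assoc (f 0) (sumTo n (tail f)) (f (suc (suc n)))

sumTo-0 : ∀ n {f : ℕ → ℤ} → (∀ k → k ≤ n → f k ≡ + 0) → sumTo n f ≡ + 0
sumTo-0 zero    e = e 0 z≤n
sumTo-0 (suc n) e = ≡.cong₂ ℤ._+_ (sumTo-0 n (λ k k≤n → e k (ℕₚ.m≤n⇒m≤1+n k≤n))) (e (suc n) ℕₚ.≤-refl)

⊛-head : ∀ f g n → (f ⊛ g) (suc n) ≡ f 0 ℤ.* g (suc n) ℤ.+ (tail f ⊛ g) n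
⊛-head f g n = sumTo-head n (λ k → f k ℤ.* g (suc n ∸ k))

⊛-last : ∀ f g n → (f ⊛ g) (suc n) ≡ (f ⊛ tail g) n ℤ.+ f (suc n) ℤ.* g 0
⊛-last f g n = ≡.cong₂ ℤ._+_
  (sumTo-cong n (λ k k≤n → ≡.cong (λ m → f k ℤ.* g m) (ℕₚ.+-∸-assoc 1 k≤n)))
  (≡.cong (λ m → f (suc n) ℤ.* g m) (ℕₚ.n∸n≡0 n))

⊛-cong-≤ : ∀ n {f f′ g g′ : Series} → (∀ k → k ≤ n → f k ≡ f′ k) → (∀ k → k ≤ n → g k ≡ g′ k) →
           (f ⊛ g) n ≡ (f′ ⊛ g′) n
⊛-cong-≤ n e e′ = sumTo-cong n (λ k k≤n → ≡.cong₂ ℤ._*_ (e k k≤n) (e′ (n ∸ k) (ℕₚ.m∸n≤m n k)))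

⊛-congˡ : ∀ n {f f′ : Series} g → (∀ k → f k ≡ f′ k) → (f ⊛ g) n ≡ (f′ ⊛ g) n
⊛-congˡ n {f} g e = ⊛-cong-≤ n {g = g} (λ k _ → e k) (λ _ _ → ≡.refl)

⊛-distribʳ : ∀ f g h n → ((f ⊕ g) ⊛ h) n ≡ (f ⊛ h) n ℤ.+ (g ⊛ h) n
⊛-distribʳ f g h n = ≡.trans
  (sumTo-cong n (λ k _ → ℤₚ.*-distribʳ-+ (h (n ∸ k)) (f k) (g k)))
  (sumTo-+ n _ _)

⊛-scale : ∀ c f g n → ((λ k → c ℤ.* f k) ⊛ g) n ≡ c ℤ.* (f ⊛ g) n
⊛-scale c f g zero    = ℤₚ.*-assoc c (f 0) (g 0)
⊛-scale c f g (suc n) = begin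
  ((λ k → c ℤ.* f k) ⊛ g) (suc n)                            ≡⟨ ⊛-head (λ k → c ℤ.* f k) g n ⟩
  c ℤ.* f 0 ℤ.* g (suc n) ℤ.+ ((λ k → c ℤ.* f (suc k)) ⊛ g) n ≡⟨ ≡.cong₂ ℤ._+_ (ℤₚ.*-assoc c _ _) (⊛-scale c (tail f) g n) ⟩
  c ℤ.* (f 0 ℤ.* g (suc n)) ℤ.+ c ℤ.* (tail f ⊛ g) n          ≡⟨ ℤₚ.*-distribˡ-+ c _ _ ⟨
  c ℤ.* (f 0 ℤ.* g (suc n) ℤ.+ (tail f ⊛ g) n)                ≡⟨ ≡.cong (c ℤ.*_) (⊛-head f g n) ⟨
  c ℤ.* (f ⊛ g) (suc n)                                       ∎
  where open ≡.≡-Reasoning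

-- Peeling the first coefficient off `f` in `f ⊛ g` is peeling the last one off in `g ⊛ f`, so the
-- induction trades `⊛-head` for `⊛-last`.
⊛-comm : ∀ n f g → (f ⊛ g) n ≡ (g ⊛ f) n
⊛-comm zero    f g = ℤₚ.*-comm (f 0) (g 0)
⊛-comm (suc n) f g = begin
  (f ⊛ g) (suc n)                         ≡⟨ ⊛-head f g n ⟩
  f 0 ℤ.* g (suc n) ℤ.+ (tail f ⊛ g) n    ≡⟨ ≡.cong₂ ℤ._+_ (ℤₚ.*-comm (f 0) _) (⊛-comm n (tail f) g) ⟩
  g (suc n) ℤ.* f 0 ℤ.+ (g ⊛ tail f) n    ≡⟨ ℤₚ.+-comm (g (suc n) ℤ.* f 0) _ ⟩
  (g ⊛ tail f) n ℤ.+ g (suc n) ℤ.* f 0    ≡⟨ ⊛-last g f n ⟨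
  (g ⊛ f) (suc n)                         ∎
  where open ≡.≡-Reasoning

-- The tail of `f ⊛ g` is `f 0` times `tail g` plus `tail f ⊛ g`; induction along this recursion
-- replaces the reindexing of a double sum.
⊛-assoc : ∀ n f g h → ((f ⊛ g) ⊛ h) n ≡ (f ⊛ (g ⊛ h)) n
⊛-assoc zero    f g h = ℤₚ.*-assoc (f 0) (g 0) (h 0)
⊛-assoc (suc n) f g h = begin
  ((f ⊛ g) ⊛ h) (suc n)
    ≡⟨ ⊛-head (f ⊛ g) h n ⟩
  f 0 ℤ.* g 0 ℤ.* h (suc n) ℤ.+ (tail (f ⊛ g) ⊛ h) n
    ≡⟨ ≡.cong₂ ℤ._+_ (ℤₚ.*-assoc (f 0) _ _) (⊛-congˡ n h (⊛-head f g)) ⟩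
  f 0 ℤ.* (g 0 ℤ.* h (suc n)) ℤ.+ (((λ k → f 0 ℤ.* tail g k) ⊕ (tail f ⊛ g)) ⊛ h) n
    ≡⟨ ≡.cong (ℤ._+_ (f 0 ℤ.* (g 0 ℤ.* h (suc n)))) (⊛-distribʳ (λ k → f 0 ℤ.* tail g k) (tail f ⊛ g) h n) ⟩
  f 0 ℤ.* (g 0 ℤ.* h (suc n)) ℤ.+ (((λ k → f 0 ℤ.* tail g k) ⊛ h) n ℤ.+ ((tail f ⊛ g) ⊛ h) n)
    ≡⟨ ≡.cong (ℤ._+_ (f 0 ℤ.* (g 0 ℤ.* h (suc n)))) (≡.cong₂ ℤ._+_ (⊛-scale (f 0) (tail g) h n) (⊛-assoc n (tail f) g h)) ⟩
  f 0 ℤ.* (g 0 ℤ.* h (suc n)) ℤ.+ (f 0 ℤ.* (tail g ⊛ h) n ℤ.+ (tail f ⊛ (g ⊛ h)) n)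
    ≡⟨ ℤₚ.+-assoc (f 0 ℤ.* (g 0 ℤ.* h (suc n))) _ _ ⟨
  f 0 ℤ.* (g 0 ℤ.* h (suc n)) ℤ.+ f 0 ℤ.* (tail g ⊛ h) n ℤ.+ (tail f ⊛ (g ⊛ h)) n
    ≡⟨ ≡.cong (ℤ._+ (tail f ⊛ (g ⊛ h)) n) (ℤₚ.*-distribˡ-+ (f 0) _ _) ⟨
  f 0 ℤ.* (g 0 ℤ.* h (suc n) ℤ.+ (tail g ⊛ h) n) ℤ.+ (tail f ⊛ (g ⊛ h)) n
    ≡⟨ ≡.cong (λ z → f 0 ℤ.* z ℤ.+ (tail f ⊛ (g ⊛ h)) n) (⊛-head g h n) ⟨
  f 0 ℤ.* (g ⊛ h) (suc n) ℤ.+ (tail f ⊛ (g ⊛ h)) n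
    ≡⟨ ⊛-head f (g ⊛ h) n ⟨
  (f ⊛ (g ⊛ h)) (suc n) ∎
  where open ≡.≡-Reasoning

infixl 6 _∔_ _⊟_
infixl 7 _·_
infix  8 ⊝_
infix  9 q^_

-- Opaque, so that conversion checking never unfolds convolutions.
opaque
  _∔_ : Series → Series → Series
  _∔_ = _⊕_

  _·_ : Series → Series → Series
  _·_ = _⊛_

  ⊝_ : Series → Series
  (⊝ f) n = ℤ.- f n

  κ : ℤ → Series
  κ c zero    = c
  κ c (suc _) = + 0

  q^_ : ℕ → Series
  q^_ = mono

_⊟_ : Series → Series → Series
f ⊟ g = f ∔ ⊝ g

𝟘 𝟙 : Series
𝟘 = κ (+ 0)
𝟙 = κ (+ 1)

≈-refl : ∀ {f} → f ≈ f
≈-refl = mk λ _ → ≡.refl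

≈-sym : ∀ {f g} → f ≈ g → g ≈ f
≈-sym e = mk λ n → ≡.sym (at e n)

≈-trans : ∀ {f g h} → f ≈ g → g ≈ h → f ≈ h
≈-trans e e′ = mk λ n → ≡.trans (at e n) (at e′ n)

≡⇒≈ : ∀ {f g} → f ≡ g → f ≈ g
≡⇒≈ ≡.refl = ≈-refl

opaque
  unfolding _∔_

  at-∔ : ∀ f g n → (f ∔ g) n ≡ f n ℤ.+ g n
  at-∔ f g n = ≡.refl

  at-⊝ : ∀ f n → (⊝ f) n ≡ ℤ.- f n
  at-⊝ f n = ≡.refl

  at-· : ∀ f g n → (f · g) n ≡ sumTo n (λ k → f k ℤ.* g (n ∸ k))
  at-· f g n = ≡.refl

  at-𝟘 : ∀ n → 𝟘 n ≡ + 0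
  at-𝟘 zero    = ≡.refl
  at-𝟘 (suc n) = ≡.refl

  at-κ-0 : ∀ c → κ c 0 ≡ c
  at-κ-0 c = ≡.refl

  at-κ-suc : ∀ c n → κ c (suc n) ≡ + 0
  at-κ-suc c n = ≡.refl

  oneS≈𝟙 : oneS ≈ 𝟙
  oneS≈𝟙 = mk λ { zero → ≡.refl ; (suc n) → ≡.refl }

  ⊕≈∔ : ∀ {f g f′ g′} → f ≈ f′ → g ≈ g′ → (f ⊕ g) ≈ (f′ ∔ g′)
  ⊕≈∔ e e′ = mk λ n → ≡.cong₂ ℤ._+_ (at e n) (at e′ n)

  ⊛≈· : ∀ {f g f′ g′} → f ≈ f′ → g ≈ g′ → (f ⊛ g) ≈ (f′ · g′)
  ⊛≈· e e′ = mk λ n → ⊛-cong-≤ n (λ k _ → at e k) (λ k _ → at e′ k)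

  mono≈q^ : ∀ d → mono d ≈ q^ d
  mono≈q^ d = ≈-refl

  κ-* : ∀ c f n → (κ c · f) n ≡ c ℤ.* f n
  κ-* c f zero    = ≡.refl
  κ-* c f (suc n) = ≡.trans (⊛-head (κ c) f n)
    (≡.trans (≡.cong (ℤ._+_ (c ℤ.* f (suc n))) (sumTo-0 n (λ _ _ → ≡.refl))) (ℤₚ.+-identityʳ _))

  private
    isCommutativeRing : IsCommutativeRing _≈_ _∔_ _·_ ⊝_ 𝟘 𝟙
    isCommutativeRing = record
      { isRing = record
        { +-isAbelianGroup = record
          { isGroup = record
            { isMonoid = record
              { isSemigroup = record
                { isMagma = record
                  { isEquivalence = record { refl = ≈-refl ; sym = ≈-sym ; trans = ≈-trans }
                  ; ∙-cong = λ e e′ → mk λ n → ≡.cong₂ ℤ._+_ (at e n) (at e′ n) }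
                ; assoc = λ f g h → mk λ n → ℤₚ.+-assoc (f n) (g n) (h n) }
              ; identity = (λ f → mk λ n → ≡.trans (≡.cong (ℤ._+ f n) (at-𝟘 n)) (ℤₚ.+-identityˡ (f n)))
                         , (λ f → mk λ n → ≡.trans (≡.cong (ℤ._+_ (f n)) (at-𝟘 n)) (ℤₚ.+-identityʳ (f n))) }
            ; inverse = (λ f → mk λ n → ≡.trans (ℤₚ.+-inverseˡ (f n)) (≡.sym (at-𝟘 n)))
                      , (λ f → mk λ n → ≡.trans (ℤₚ.+-inverseʳ (f n)) (≡.sym (at-𝟘 n)))
            ; ⁻¹-cong = λ e → mk λ n → ≡.cong ℤ.-_ (at e n) }
          ; comm = λ f g → mk λ n → ℤₚ.+-comm (f n) (g n) }
        ; *-cong = λ e e′ → mk λ n → ⊛-cong-≤ n (λ k _ → at e k) (λ k _ → at e′ k)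
        ; *-assoc = λ f g h → mk λ n → ⊛-assoc n f g h
        ; *-identity = (λ f → mk λ n → ≡.trans (κ-* (+ 1) f n) (ℤₚ.*-identityˡ (f n)))
                     , (λ f → mk λ n → ≡.trans (⊛-comm n f 𝟙) (≡.trans (κ-* (+ 1) f n) (ℤₚ.*-identityˡ (f n))))
        ; distrib = (λ f g h → mk λ n → ≡.trans (⊛-comm n f (g ⊕ h)) (≡.trans (⊛-distribʳ g h f n)
                                 (≡.cong₂ ℤ._+_ (⊛-comm n g f) (⊛-comm n h f))))
                  , (λ f g h → mk λ n → ⊛-distribʳ g h f n) }
      ; *-comm = λ f g → mk λ n → ⊛-comm n f g }

  κ-+ : ∀ a b → κ (a ℤ.+ b) ≈ κ a ∔ κ b
  κ-+ a b = mk λ { zero → ≡.refl ; (suc n) → ≡.refl }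

  κ-*-homo : ∀ a b → κ (a ℤ.* b) ≈ κ a · κ b
  κ-*-homo a b = mk λ n → ≡.sym (≡.trans (κ-* a (κ b) n) (lem n))
    where lem : ∀ n → a ℤ.* κ b n ≡ κ (a ℤ.* b) n
          lem zero = ≡.refl
          lem (suc n) = ℤₚ.*-zeroʳ a

  κ-neg : ∀ a → κ (ℤ.- a) ≈ ⊝ κ a
  κ-neg a = mk λ { zero → ≡.refl ; (suc n) → ≡.refl }

seriesRing : CommutativeRing 0ℓ 0ℓ
seriesRing = record
  { Carrier = Series ; _≈_ = _≈_ ; _+_ = _∔_ ; _*_ = _·_ ; -_ = ⊝_ ; 0# = 𝟘 ; 1# = 𝟙
  ; isCommutativeRing = isCommutativeRing }

open CommutativeRing seriesRing public using () renaming
  ( +-cong to ∔-cong; +-congˡ to ∔-congˡ; +-congʳ to ∔-congʳ; *-cong to ·-cong; *-congˡ to ·-congˡ; *-congʳ to ·-congʳ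
  ; +-assoc to ∔-assoc; +-comm to ∔-comm; *-assoc to ·-assoc; *-comm to ·-comm; -‿cong to ⊝-cong
  ; *-identityˡ to ·-identityˡ; *-identityʳ to ·-identityʳ; +-identityˡ to ∔-identityˡ; +-identityʳ to ∔-identityʳ
  ; zeroˡ to ·-zeroˡ; zeroʳ to ·-zeroʳ; distribˡ to ·-distribˡ; distribʳ to ·-distribʳ; setoid to ≈-setoid )

module ≈-Reasoning = SetoidReasoning ≈-setoid

private
  -- Integer constants enter the solver through `κ`, so polynomial identities with numerals such as
  -- 3 or 729 are normalised in ℤ.
  κ-morphism : ℤ.+-*-rawRing -Raw-AlmostCommutative⟶ fromCommutativeRing seriesRing
  κ-morphism = record
    { ⟦_⟧ = κ ; +-homo = κ-+ ; *-homo = κ-*-homo ; -‿homo = κ-neg ; 0-homo = ≈-refl ; 1-homo = ≈-refl }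

  κ≟ : ∀ a b → Maybe (κ a ≈ κ b)
  κ≟ a b with a ℤ.≟ b
  ... | yes ≡.refl = just ≈-refl
  ... | no _       = nothing

module Ring = RingSolver ℤ.+-*-rawRing (fromCommutativeRing seriesRing) κ-morphism κ≟
open Ring public using (solve; _:=_; _:+_; _:*_; _:-_; :-_; con) renaming (_:^_ to _:**_)

-- Agreement of series below q^K

infix 4 _≈[_]_
record _≈[_]_ (f : Series) (K : ℕ) (g : Series) : Set where
  constructor mk[]
  field at< : ∀ n → n < K → f n ≡ g n
open _≈[_]_ public

variable
  f g h f′ g′ : Series
  K L : ℕ

O : ℕ → Series → Set
O K f = f ≈[ K ] 𝟘

≈⇒≈[] : f ≈ g → f ≈[ K ] g
≈⇒≈[] e = mk[] λ n _ → at e n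

≈[]⇒≈ : (∀ K → f ≈[ K ] g) → f ≈ g
≈[]⇒≈ e = mk λ n → at< (e (suc n)) n ℕₚ.≤-refl

refl[] : f ≈[ K ] f
refl[] = mk[] λ _ _ → ≡.refl

sym[] : f ≈[ K ] g → g ≈[ K ] f
sym[] e = mk[] λ n l → ≡.sym (at< e n l)

trans[] : f ≈[ K ] g → g ≈[ K ] h → f ≈[ K ] h
trans[] e e′ = mk[] λ n l → ≡.trans (at< e n l) (at< e′ n l)

weaken : K ≤ L → f ≈[ L ] g → f ≈[ K ] g
weaken K≤L e = mk[] λ n l → at< e n (ℕₚ.≤-trans l K≤L)

∔-cong[] : f ≈[ K ] f′ → g ≈[ K ] g′ → f ∔ g ≈[ K ] f′ ∔ g′
∔-cong[] {f} {K} {f′} {g} {g′} e e′ = mk[] λ n l →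
  ≡.trans (at-∔ f g n) (≡.trans (≡.cong₂ ℤ._+_ (at< e n l) (at< e′ n l)) (≡.sym (at-∔ f′ g′ n)))

-- In the coefficient n < a + K each product pairs index k with n - k: either k < a and the first
-- factor vanishes, or n - k < K and the second factors agree. Orders therefore add to precision,
-- which later makes the outer terms of theta sums harmless.
·-order : ∀ a → O a f → g ≈[ K ] h → f · g ≈[ a + K ] f · h
·-order {f} {g} {K} {h} a Of e = mk[] λ n l →
  ≡.trans (at-· f g n) (≡.trans (sumTo-cong n (term n l)) (≡.sym (at-· f h n)))
  where
  term : ∀ n → n < a + K → ∀ k → k ≤ n → f k ℤ.* g (n ∸ k) ≡ f k ℤ.* h (n ∸ k)
  term n l k k≤n with k <? a
  ... | yes k<a rewrite at< Of k k<a | at-𝟘 k = ≡.refl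
  ... | no  k≮a = ≡.cong (f k ℤ.*_) (at< e (n ∸ k) (ℕₚ.+-cancelˡ-< k (n ∸ k) K
          (≡.subst (_< k + K) (≡.sym (ℕₚ.m+[n∸m]≡n k≤n)) (ℕₚ.≤-trans l (ℕₚ.+-monoˡ-≤ K (ℕₚ.≮⇒≥ k≮a))))))

O-0 : O 0 f
O-0 = mk[] λ _ ()

·-congˡ[] : g ≈[ K ] g′ → f · g ≈[ K ] f · g′
·-congˡ[] e = ·-order 0 O-0 e

·-congʳ[] : f ≈[ K ] f′ → f · g ≈[ K ] f′ · g
·-congʳ[] {f} {K} {f′} {g} e = trans[] (≈⇒≈[] (·-comm f g)) (trans[] (·-congˡ[] e) (≈⇒≈[] (·-comm g f′)))

·-cong[] : f ≈[ K ] f′ → g ≈[ K ] g′ → f · g ≈[ K ] f′ · g′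
·-cong[] e e′ = trans[] (·-congʳ[] e) (·-congˡ[] e′)

O-·ˡ : ∀ a → O a f → O a (f · g)
O-·ˡ {f} {g} a e = trans[] (·-congʳ[] e) (≈⇒≈[] (·-zeroˡ g))

O-·ʳ : ∀ a → O a g → O a (f · g)
O-·ʳ {g} {f} a e = trans[] (·-congˡ[] e) (≈⇒≈[] (·-zeroʳ f))

absorb : ∀ a → O a f → g ≈[ K ] 𝟙 → f · g ≈[ a + K ] f
absorb {f} a Of e = trans[] (·-order a Of e) (≈⇒≈[] (·-identityʳ f))

≈[]𝟙-· : f ≈[ K ] 𝟙 → g ≈[ K ] 𝟙 → f · g ≈[ K ] 𝟙
≈[]𝟙-· e e′ = trans[] (·-cong[] e e′) (≈⇒≈[] (·-identityˡ 𝟙))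

≈[]𝟙-∔ : O K f → 𝟙 ∔ f ≈[ K ] 𝟙
≈[]𝟙-∔ o = trans[] (∔-cong[] refl[] o) (≈⇒≈[] (∔-identityʳ 𝟙))

-- Powers of q

private
  if-true : ∀ {b} {x y : ℤ} → b ≡ true → (if b then x else y) ≡ x
  if-true ≡.refl = ≡.refl
  if-false : ∀ {b} {x y : ℤ} → b ≡ false → (if b then x else y) ≡ y
  if-false ≡.refl = ≡.refl

opaque
  unfolding q^_

  at-q^-≡ : ∀ d → (q^ d) d ≡ + 1
  at-q^-≡ d = if-true (dec-true (d ≟ d) ≡.refl)

  at-q^-≢ : ∀ d {n} → n ≢ d → (q^ d) n ≡ + 0
  at-q^-≢ d {n} n≢d = if-false (dec-false (n ≟ d) n≢d)

  q^·-at : ∀ d f n → (q^ d · f) (d + n) ≡ f n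
  q^·-at zero    f zero    = ℤₚ.*-identityˡ (f 0)
  q^·-at zero    f (suc n) = ≡.trans (⊛-head (mono 0) f n)
    (≡.trans (≡.cong₂ ℤ._+_ (ℤₚ.*-identityˡ (f (suc n))) (sumTo-0 n (λ _ _ → ≡.refl))) (ℤₚ.+-identityʳ _))
  q^·-at (suc d) f n = ≡.trans (⊛-head (mono (suc d)) f (d + n))
    (≡.trans (ℤₚ.+-identityˡ _) (q^·-at d f n))

q^≡ : ∀ {a b} → a ≡ b → q^ a ≈ q^ b
q^≡ ≡.refl = ≈-refl

O-q^ : ∀ d → O d (q^ d)
O-q^ d = mk[] λ n n<d → ≡.trans (at-q^-≢ d (ℕₚ.<⇒≢ n<d)) (≡.sym (at-𝟘 n))

q^·-at-< : ∀ d f {n} → n < d → (q^ d · f) n ≡ + 0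
q^·-at-< d f {n} n<d = ≡.trans (at< (O-·ˡ d (O-q^ d)) n n<d) (at-𝟘 n)

q^0 : q^ 0 ≈ 𝟙
q^0 = mk λ { zero → ≡.trans (at-q^-≡ 0) (≡.sym (at-κ-0 _))
           ; (suc n) → ≡.trans (at-q^-≢ 0 (λ ())) (≡.sym (at-κ-suc _ n)) }

q^·-ext : ∀ d f {g} → (∀ n → n < d → g n ≡ + 0) → (∀ n → g (d + n) ≡ f n) → q^ d · f ≈ g
q^·-ext d f {g} lo hi = mk λ n → go n (n <? d)
  where
  go : ∀ n → Dec (n < d) → (q^ d · f) n ≡ g n
  go n (yes n<d) = ≡.trans (q^·-at-< d f n<d) (≡.sym (lo n n<d))
  go n (no n≮d)  = ≡.subst (λ m → (q^ d · f) m ≡ g m) (ℕₚ.m+[n∸m]≡n (ℕₚ.≮⇒≥ n≮d))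
                     (≡.trans (q^·-at d f (n ∸ d)) (≡.sym (hi (n ∸ d))))

q^-+ : ∀ a b → q^ (a + b) ≈ q^ a · q^ b
q^-+ a b = ≈-sym (q^·-ext a (q^ b) (λ n n<a → at-q^-≢ (a + b) (ℕₚ.<⇒≢ (ℕₚ.≤-trans n<a (ℕₚ.m≤m+n a b)))) hi)
  where
  hi : ∀ n → (q^ (a + b)) (a + n) ≡ (q^ b) n
  hi n with n ≟ b
  ... | yes ≡.refl = ≡.trans (at-q^-≡ (a + n)) (≡.sym (at-q^-≡ n))
  ... | no  n≢b    = ≡.trans (at-q^-≢ (a + b) (n≢b ∘ ℕₚ.+-cancelˡ-≡ a n b)) (≡.sym (at-q^-≢ b n≢b))

q^-cancel : ∀ d → q^ d · f ≈[ d + K ] q^ d · g → f ≈[ K ] g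
q^-cancel {f} {K} {g} d e = mk[] λ n l → ≡.trans (≡.sym (q^·-at d f n))
  (≡.trans (at< e (d + n) (ℕₚ.+-monoʳ-< d l)) (q^·-at d g n))

-- The coefficients of `geom d` have period d, so subtracting the shift by d leaves only the first
-- block, which is 1.
geom-inverse : ∀ d → .{{NonZero d}} → geom d · (𝟙 ⊟ q^ d) ≈ 𝟙
geom-inverse d@(suc _) = begin
  geom d · (𝟙 ⊟ q^ d)          ≈⟨ solve 2 (λ x y → x :* (con (+ 1) :- y) := x :- y :* x) ≈-refl (geom d) (q^ d) ⟩
  geom d ⊟ q^ d · geom d       ≈⟨ mk (λ n → ≡.trans (at-∔ (geom d) (⊝ (q^ d · geom d)) n) (≡.trans (≡.cong (ℤ._+_ (geom d n)) (at-⊝ (q^ d · geom d) n)) (coeff n))) ⟩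
  𝟙                            ∎
  where
  open ≈-Reasoning
  coeff-< : ∀ n → n < d → geom d n ≡ 𝟙 n
  coeff-< zero    _ = ≡.sym (at-κ-0 (+ 1))
  coeff-< (suc n) l = ≡.trans (if-false (dec-false (d ∣? suc n) (λ d∣n → ℕₚ.<⇒≱ l (∣⇒≤ d∣n)))) (≡.sym (at-κ-suc (+ 1) n))
  periodic : ∀ n → geom d (d + n) ≡ geom d n
  periodic n = ≡.cong (λ b → if b then + 1 else + 0)
    (does-⇔ (mk⇔ (λ d∣d+n → ∣m+n∣m⇒∣n d∣d+n ∣-refl) (∣m∣n⇒∣m+n ∣-refl)) (d ∣? (d + n)) (d ∣? n))
  coeff : ∀ n → geom d n ℤ.+ ℤ.- (q^ d · geom d) n ≡ 𝟙 n
  coeff n with n <? d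
  ... | yes n<d rewrite q^·-at-< d (geom d) n<d = ≡.trans (ℤₚ.+-identityʳ _) (coeff-< n n<d)
  ... | no n≮d = ≡.subst (λ m → geom d m ℤ.+ ℤ.- (q^ d · geom d) m ≡ 𝟙 m) (ℕₚ.m+[n∸m]≡n (ℕₚ.≮⇒≥ n≮d))
      (≡.trans (≡.cong₂ ℤ._+_ (periodic (n ∸ d)) (≡.cong ℤ.-_ (q^·-at d (geom d) (n ∸ d))))
        (≡.trans (ℤₚ.+-inverseʳ (geom d (n ∸ d))) (≡.sym (at-κ-suc (+ 1) _))))

inverse-unique : f · g ≈ 𝟙 → f · h ≈ 𝟙 → g ≈ h
inverse-unique {f} {g} {h} e e′ = begin
  g           ≈⟨ ·-identityʳ g ⟨
  g · 𝟙       ≈⟨ ·-congˡ e′ ⟨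
  g · (f · h) ≈⟨ solve 3 (λ g f h → g :* (f :* h) := f :* g :* h) ≈-refl g f h ⟩
  f · g · h   ≈⟨ ·-congʳ e ⟩
  𝟙 · h       ≈⟨ ·-identityˡ h ⟩
  h           ∎
  where open ≈-Reasoning

unit-cancelˡ : ∀ u {v} → u · v ≈ 𝟙 → u · f ≈ u · g → f ≈ g
unit-cancelˡ {f} {g} u {v} uv e = begin
  f           ≈⟨ ·-identityˡ f ⟨
  𝟙 · f       ≈⟨ ·-congʳ uv ⟨
  u · v · f   ≈⟨ solve 3 (λ u v f → u :* v :* f := v :* (u :* f)) ≈-refl u v f ⟩
  v · (u · f) ≈⟨ ·-congˡ e ⟩
  v · (u · g) ≈⟨ solve 3 (λ u v f → v :* (u :* f) := u :* v :* f) ≈-refl u v g ⟩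
  u · v · g   ≈⟨ ·-congʳ uv ⟩
  𝟙 · g       ≈⟨ ·-identityˡ g ⟩
  g           ∎
  where open ≈-Reasoning

geom-≈𝟙 : ∀ d → .{{NonZero d}} → geom d ≈[ d ] 𝟙
geom-≈𝟙 d = trans[] (≈⇒≈[] (≈-sym (·-identityʳ (geom d))))
  (trans[] (·-congˡ[] (sym[] (≈[]𝟙-∔ (trans[] (⊝-O (O-q^ d)) refl[])))) (≈⇒≈[] (geom-inverse d)))
  where
  ⊝-O : O K f → O K (⊝ f)
  ⊝-O {K} {f} o = mk[] λ n l → ≡.trans (at-⊝ f n) (≡.trans (≡.cong ℤ.-_ (≡.trans (at< o n l) (at-𝟘 n))) (≡.sym (at-𝟘 n)))

-- Finite and infinite sums and products

∑ ∏ : ℕ → (ℕ → Series) → Series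
∑ zero    t = 𝟘
∑ (suc n) t = ∑ n t ∔ t n
∏ zero    t = 𝟙
∏ (suc n) t = ∏ n t · t n

variable
  s t : ℕ → Series

∑-cong : ∀ n → (∀ k → k < n → s k ≈ t k) → ∑ n s ≈ ∑ n t
∑-cong zero    e = ≈-refl
∑-cong (suc n) e = ∔-cong (∑-cong n (λ k k<n → e k (ℕₚ.m<n⇒m<1+n k<n))) (e n ℕₚ.≤-refl)

∑-cong[] : ∀ n → (∀ k → k < n → s k ≈[ K ] t k) → ∑ n s ≈[ K ] ∑ n t
∑-cong[] zero    e = refl[]
∑-cong[] (suc n) e = ∔-cong[] (∑-cong[] n (λ k k<n → e k (ℕₚ.m<n⇒m<1+n k<n))) (e n ℕₚ.≤-refl)

∑-∔ : ∀ n s t → ∑ n (λ k → s k ∔ t k) ≈ ∑ n s ∔ ∑ n t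
∑-∔ zero    s t = ≈-sym (∔-identityˡ 𝟘)
∑-∔ (suc n) s t = ≈-trans (∔-congʳ (∑-∔ n s t))
  (solve 4 (λ a b c d → (a :+ b) :+ (c :+ d) := (a :+ c) :+ (b :+ d)) ≈-refl (∑ n s) (∑ n t) (s n) (t n))

∑-·ˡ : ∀ n f t → ∑ n (λ k → f · t k) ≈ f · ∑ n t
∑-·ˡ zero    f t = ≈-sym (·-zeroʳ f)
∑-·ˡ (suc n) f t = ≈-trans (∔-congʳ (∑-·ˡ n f t)) (≈-sym (·-distribˡ f (∑ n t) (t n)))

∑-head : ∀ n t → ∑ (suc n) t ≈ t 0 ∔ ∑ n (λ k → t (suc k))
∑-head zero    t = ∔-comm 𝟘 (t 0)
∑-head (suc n) t = ≈-trans (∔-congʳ (∑-head n t)) (∔-assoc (t 0) _ (t (suc n)))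

∑-swap : ∀ n m (t : ℕ → ℕ → Series) → ∑ n (λ i → ∑ m (t i)) ≈ ∑ m (λ j → ∑ n (λ i → t i j))
∑-swap zero    m t = ≈-sym (∑-𝟘 m)
  where ∑-𝟘 : ∀ m → ∑ m (λ _ → 𝟘) ≈ 𝟘
        ∑-𝟘 zero = ≈-refl
        ∑-𝟘 (suc m) = ≈-trans (∔-identityʳ _) (∑-𝟘 m)
∑-swap (suc n) m t = ≈-trans (∔-congʳ (∑-swap n m t)) (≈-sym (∑-∔ m (λ j → ∑ n (λ i → t i j)) (t n)))

∑-extend : ∀ n d → (∀ k → n ≤ k → t k ≈ 𝟘) → ∑ (d + n) t ≈ ∑ n t
∑-extend n zero    e = ≈-refl
∑-extend {t} n (suc d) e = ≈-trans (∔-cong (∑-extend n d e) (e (d + n) (ℕₚ.m≤n+m n d))) (∔-identityʳ (∑ n t))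

telescope : ∀ n → (∀ k → k < n → s (suc k) ≈ s k ∔ t k) → s n ≈ s 0 ∔ ∑ n t
telescope {s} zero    e = ≈-sym (∔-identityʳ (s 0))
telescope {s} {t} (suc n) e = ≈-trans (e n ℕₚ.≤-refl)
  (≈-trans (∔-congʳ (telescope n (λ k k<n → e k (ℕₚ.m<n⇒m<1+n k<n)))) (∔-assoc (s 0) (∑ n t) (t n)))

∏-cong : ∀ n → (∀ k → s k ≈ t k) → ∏ n s ≈ ∏ n t
∏-cong zero    e = ≈-refl
∏-cong (suc n) e = ·-cong (∏-cong n e) (e n)

∏-· : ∀ n s t → ∏ n (λ k → s k · t k) ≈ ∏ n s · ∏ n t
∏-· zero    s t = ≈-sym (·-identityˡ 𝟙)
∏-· (suc n) s t = ≈-trans (·-congʳ (∏-· n s t))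
  (solve 4 (λ a b c d → (a :* b) :* (c :* d) := (a :* c) :* (b :* d)) ≈-refl (∏ n s) (∏ n t) (s n) (t n))

∏-𝟙 : ∀ n → (∀ k → t k ≈ 𝟙) → ∏ n t ≈ 𝟙
∏-𝟙 zero    e = ≈-refl
∏-𝟙 (suc n) e = ≈-trans (·-cong (∏-𝟙 n e) (e n)) (·-identityˡ 𝟙)

infix 4 _⟶_
_⟶_ : (ℕ → Series) → Series → Set
t ⟶ f = ∀ M → t M ≈[ M ] f

-- The bridge from finite identities to infinite ones: approximants that merge at rate M have the
-- same limit.
⟶-unique : (∀ M → s M ≈[ M ] t M) → s ⟶ f → t ⟶ g → f ≈ g
⟶-unique e s⟶f t⟶g = ≈[]⇒≈ λ M → trans[] (sym[] (s⟶f M)) (trans[] (e M) (t⟶g M))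

opaque
  lim : (ℕ → Series) → Series
  -- Approximant n + 1 is the first whose coefficient n is guaranteed to be final.
  lim t n = t (suc n) n

  at-lim : ∀ t n → lim t n ≡ t (suc n) n
  at-lim t n = ≡.refl

lim-⟶ : (∀ M → t M ≈[ M ] t (suc M)) → t ⟶ lim t
lim-⟶ {t} cauchy M = mk[] λ n n<M → ≡.trans (≡.cong (λ m → t m n) (≡.sym (ℕₚ.m∸n+n≡m n<M)))
  (≡.trans (≡.sym (steps n (M ∸ suc n))) (≡.sym (at-lim t n)))
  where
  steps : ∀ n d → t (suc n) n ≡ t (d + suc n) n
  steps n zero    = ≡.refl
  steps n (suc d) = ≡.trans (steps n d) (at< (cauchy (d + suc n)) n (ℕₚ.m≤n+m (suc n) d))

lim-cong : (∀ M → s M ≈ t M) → lim s ≈ lim t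
lim-cong {s} {t} e = mk λ n → ≡.trans (at-lim s n) (≡.trans (at (e (suc n)) n) (≡.sym (at-lim t n)))

Σ∞ ∏∞ : (ℕ → Series) → Series
Σ∞ t = lim (λ M → ∑ M t)
∏∞ t = lim (λ M → ∏ M t)

-- The order k is demanded of the k-th term so that the M-th partial sum or product is already
-- correct below q^M, the rate built into `_⟶_`.
Summable Multipliable : (ℕ → Series) → Set
Summable t     = ∀ k → O k (t k)
Multipliable t = ∀ k → t k ≈[ k ] 𝟙

Σ∞-⟶ : Summable t → (λ M → ∑ M t) ⟶ Σ∞ t
Σ∞-⟶ {t} o = lim-⟶ λ M → sym[] (trans[] (∔-cong[] refl[] (o M)) (≈⇒≈[] (∔-identityʳ (∑ M t))))

∏∞-⟶ : Multipliable t → (λ M → ∏ M t) ⟶ ∏∞ t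
∏∞-⟶ {t} o = lim-⟶ λ M → sym[] (trans[] (·-congˡ[] (o M)) (≈⇒≈[] (·-identityʳ (∏ M t))))

Σ∞-cong : (∀ k → s k ≈ t k) → Σ∞ s ≈ Σ∞ t
Σ∞-cong e = lim-cong λ M → ∑-cong M (λ k _ → e k)

∏∞-cong : (∀ k → s k ≈ t k) → ∏∞ s ≈ ∏∞ t
∏∞-cong e = lim-cong λ M → ∏-cong M e

Σ∞-∔ : ∀ s t → Summable s → Summable t → Σ∞ (λ k → s k ∔ t k) ≈ Σ∞ s ∔ Σ∞ t
Σ∞-∔ s t os ot = ≈[]⇒≈ λ M → trans[] (sym[] (Σ∞-⟶ (λ k → trans[] (∔-cong[] (os k) (ot k)) (≈⇒≈[] (∔-identityˡ 𝟘))) M))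
  (trans[] (≈⇒≈[] (∑-∔ M s t)) (∔-cong[] (Σ∞-⟶ os M) (Σ∞-⟶ ot M)))

Σ∞-·ˡ : ∀ f t → Summable t → Σ∞ (λ k → f · t k) ≈ f · Σ∞ t
Σ∞-·ˡ f t o = ≈[]⇒≈ λ M → trans[] (sym[] (Σ∞-⟶ (λ k → O-·ʳ k (o k)) M))
  (trans[] (≈⇒≈[] (∑-·ˡ M f t)) (·-congˡ[] (Σ∞-⟶ o M)))

∏∞-· : ∀ s t → Multipliable s → Multipliable t → ∏∞ (λ k → s k · t k) ≈ ∏∞ s · ∏∞ t
∏∞-· s t os ot = ≈[]⇒≈ λ M → trans[] (sym[] (∏∞-⟶ (λ k → ≈[]𝟙-· (os k) (ot k)) M))
  (trans[] (≈⇒≈[] (∏-· M s t)) (·-cong[] (∏∞-⟶ os M) (∏∞-⟶ ot M)))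

∏∞-𝟙 : (∀ k → t k ≈ 𝟙) → ∏∞ t ≈ 𝟙
∏∞-𝟙 e = ⟶-unique (λ M → ≈⇒≈[] (∏-𝟙 M e)) (∏∞-⟶ (λ k → ≈⇒≈[] (e k))) (λ _ → refl[])

private
  M≤M*d : ∀ M d → M ≤ M * suc d
  M≤M*d M d = ℕₚ.m≤m*n M (suc d)

Summable-stride : ∀ d r → Summable t → Summable (λ k → t (r + k * suc d))
Summable-stride d r o k = weaken (ℕₚ.≤-trans (M≤M*d k d) (ℕₚ.m≤n+m (k * suc d) r)) (o (r + k * suc d))

Multipliable-stride : ∀ d r → Multipliable t → Multipliable (λ k → t (r + k * suc d))
Multipliable-stride d r o k = weaken (ℕₚ.≤-trans (M≤M*d k d) (ℕₚ.m≤n+m (k * suc d) r)) (o (r + k * suc d))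

Σ∞-split₂ : ∀ t → Summable t → Σ∞ t ≈ Σ∞ (λ k → t (k * 2)) ∔ Σ∞ (λ k → t (1 + k * 2))
Σ∞-split₂ t o = ≈-trans
  (⟶-unique (λ M → ≈⇒≈[] (group M)) (λ M → weaken (M≤M*d M 1) (Σ∞-⟶ o (M * 2)))
    (Σ∞-⟶ λ k → trans[] (∔-cong[] (Summable-stride 1 0 o k) (Summable-stride 1 1 o k)) (≈⇒≈[] (∔-identityˡ 𝟘))))
  (Σ∞-∔ _ _ (Summable-stride 1 0 o) (Summable-stride 1 1 o))
  where
  group : ∀ M → ∑ (M * 2) t ≈ ∑ M (λ k → t (k * 2) ∔ t (1 + k * 2))
  group zero    = ≈-refl
  group (suc M) = ≈-trans (∔-assoc _ _ _) (∔-congʳ (group M))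

Σ∞-split₃ : ∀ t → Summable t → Σ∞ t ≈ Σ∞ (λ k → t (k * 3)) ∔ (Σ∞ (λ k → t (1 + k * 3)) ∔ Σ∞ (λ k → t (2 + k * 3)))
Σ∞-split₃ t o = ≈-trans
  (⟶-unique (λ M → ≈⇒≈[] (group M)) (λ M → weaken (M≤M*d M 2) (Σ∞-⟶ o (M * 3)))
    (Σ∞-⟶ λ k → trans[] (∔-cong[] (Summable-stride 2 0 o k) (s12 k)) (≈⇒≈[] (∔-identityˡ 𝟘))))
  (≈-trans (Σ∞-∔ _ _ (Summable-stride 2 0 o) s12) (∔-congˡ (Σ∞-∔ _ _ (Summable-stride 2 1 o) (Summable-stride 2 2 o))))
  where
  s12 : Summable (λ k → t (1 + k * 3) ∔ t (2 + k * 3))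
  s12 k = trans[] (∔-cong[] (Summable-stride 2 1 o k) (Summable-stride 2 2 o k)) (≈⇒≈[] (∔-identityˡ 𝟘))
  group : ∀ M → ∑ (M * 3) t ≈ ∑ M (λ k → t (k * 3) ∔ (t (1 + k * 3) ∔ t (2 + k * 3)))
  group zero    = ≈-refl
  group (suc M) = ≈-trans (∔-assoc _ _ _) (≈-trans (∔-assoc _ _ _) (∔-congʳ (group M)))

∏∞-split₂ : ∀ t → Multipliable t → ∏∞ t ≈ ∏∞ (λ k → t (k * 2)) · ∏∞ (λ k → t (1 + k * 2))
∏∞-split₂ t o = ≈-trans
  (⟶-unique (λ M → ≈⇒≈[] (group M)) (λ M → weaken (M≤M*d M 1) (∏∞-⟶ o (M * 2)))
    (∏∞-⟶ λ k → ≈[]𝟙-· (Multipliable-stride 1 0 o k) (Multipliable-stride 1 1 o k)))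
  (∏∞-· _ _ (Multipliable-stride 1 0 o) (Multipliable-stride 1 1 o))
  where
  group : ∀ M → ∏ (M * 2) t ≈ ∏ M (λ k → t (k * 2) · t (1 + k * 2))
  group zero    = ≈-refl
  group (suc M) = ≈-trans (·-assoc _ _ _) (·-congʳ (group M))

∏∞-split₃ : ∀ t → Multipliable t → ∏∞ t ≈ ∏∞ (λ k → t (k * 3)) · (∏∞ (λ k → t (1 + k * 3)) · ∏∞ (λ k → t (2 + k * 3)))
∏∞-split₃ t o = ≈-trans
  (⟶-unique (λ M → ≈⇒≈[] (group M)) (λ M → weaken (M≤M*d M 2) (∏∞-⟶ o (M * 3)))
    (∏∞-⟶ λ k → ≈[]𝟙-· (Multipliable-stride 2 0 o k) (m12 k)))
  (≈-trans (∏∞-· _ _ (Multipliable-stride 2 0 o) m12) (·-congˡ (∏∞-· _ _ (Multipliable-stride 2 1 o) (Multipliable-stride 2 2 o))))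
  where
  m12 : Multipliable (λ k → t (1 + k * 3) · t (2 + k * 3))
  m12 k = ≈[]𝟙-· (Multipliable-stride 2 1 o k) (Multipliable-stride 2 2 o k)
  group : ∀ M → ∏ (M * 3) t ≈ ∏ M (λ k → t (k * 3) · (t (1 + k * 3) · t (2 + k * 3)))
  group zero    = ≈-refl
  group (suc M) = ≈-trans (·-assoc _ _ _) (≈-trans (·-assoc _ _ _) (·-congʳ (group M)))

-- Dissection: U d r f collects the coefficients of f in the class r modulo d,
-- and dil d f is f(q^d).

residue : ∀ d .{{_ : NonZero d}} r n → r < d → (r + n * d) % d ≡ r
residue d r n r<d = ≡.trans (DM.[m+kn]%n≡m%n r n d) (DM.m<n⇒m%n≡m r<d)

opaque
  U : ℕ → ℕ → Series → Series
  U d r f n = f (r + n * d)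

  dil : (d : ℕ) → .{{NonZero d}} → Series → Series
  dil d f n = if n % d ≡ᵇ 0 then f (n / d) else + 0

  U-cong : ∀ d r → f ≈ g → U d r f ≈ U d r g
  U-cong d r e = mk λ n → at e (r + n * d)

  U-∔ : ∀ d r f g → U d r (f ∔ g) ≈ U d r f ∔ U d r g
  U-∔ d r f g = mk λ n → ≡.trans (at-∔ f g (r + n * d)) (≡.sym (at-∔ (U d r f) (U d r g) n))

  U-⊝ : ∀ d r f → U d r (⊝ f) ≈ ⊝ U d r f
  U-⊝ d r f = mk λ n → ≡.trans (at-⊝ f (r + n * d)) (≡.sym (at-⊝ (U d r f) n))

  U-𝟘 : ∀ d r → U d r 𝟘 ≈ 𝟘
  U-𝟘 d r = mk λ n → ≡.trans (at-𝟘 (r + n * d)) (≡.sym (at-𝟘 n))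

  at-U : ∀ d r f n → U d r f n ≡ f (r + n * d)
  at-U d r f n = ≡.refl

  at-dil : ∀ d .{{_ : NonZero d}} f n → dil d f n ≡ (if n % d ≡ᵇ 0 then f (n / d) else + 0)
  at-dil d f n = ≡.refl

  U-ext : ∀ d .{{_ : NonZero d}} → (∀ r → r < d → U d r f ≈ U d r g) → f ≈ g
  U-ext {f} {g} d e = mk λ n → ≡.subst (λ m → f m ≡ g m) (≡.sym (DM.m≡m%n+[m/n]*n n d))
    (at (e (n % d) (DM.m%n<n n d)) (n / d))

  U-dil : ∀ d .{{_ : NonZero d}} f → U d 0 (dil d f) ≈ f
  U-dil d f = mk coeff
    where
    coeff : ∀ n → dil d f (n * d) ≡ f n
    coeff n = ≡.trans (≡.cong (λ r → if r ≡ᵇ 0 then f (n * d / d) else + 0) (DM.m*n%n≡0 n d))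
      (≡.cong f (DM.m*n/n≡m n d))

  U-dil-suc : ∀ d .{{_ : NonZero d}} r f → suc r < d → U d (suc r) (dil d f) ≈ 𝟘
  U-dil-suc d r f r<d = mk λ n → ≡.trans (coeff n) (≡.sym (at-𝟘 n))
    where
    coeff : ∀ n → dil d f (suc r + n * d) ≡ + 0
    coeff n = ≡.cong (λ j → if j ≡ᵇ 0 then f ((suc r + n * d) / d) else + 0) (residue d (suc r) n r<d)

-- Recognising `dil d f` by its components reduces the homomorphism laws of `dil` to computations
-- with `U`.
dil-⇐U : ∀ d .{{_ : NonZero d}} → U d 0 g ≈ f → (∀ r → suc r < d → U d (suc r) g ≈ 𝟘) → dil d f ≈ g
dil-⇐U {g} {f} d e0 er = U-ext d λ
  { zero    _ → ≈-trans (U-dil d f) (≈-sym e0)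
  ; (suc r) l → ≈-trans (U-dil-suc d r f l) (≈-sym (er r l)) }

private
  sum-sparse : ∀ d r n (a : ℕ → ℤ) → r < suc d → (∀ j i → suc j < suc d → a (suc j + i * suc d) ≡ + 0) →
    sumTo (r + n * suc d) a ≡ sumTo n (λ i → a (i * suc d))
  sum-sparse d (suc r) n a r<d z = ≡.trans
    (≡.cong₂ ℤ._+_ (sum-sparse d r n a (ℕₚ.≤-trans (ℕₚ.n≤1+n (suc r)) r<d) z) (z r n r<d)) (ℤₚ.+-identityʳ _)
  sum-sparse d zero zero    a _ z = ≡.refl
  sum-sparse d zero (suc n) a _ z = ≡.cong (ℤ._+ a (suc n * suc d)) (sum-sparse d d n a ℕₚ.≤-refl z)

-- Only indices divisible by d contribute from the first factor, so the residue r falls entirely on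
-- `g`. This linearity over series in q^d is what lets U₃ be computed from its values on a basis.
U-dil-· : ∀ d .{{_ : NonZero d}} r f g → r < d → U d r (dil d f · g) ≈ f · U d r g
U-dil-· d@(suc d′) r f g r<d = mk λ n → begin
  U d r (dil d f · g) n ≡⟨ at-U d r _ n ⟩
  (dil d f · g) (r + n * d)                                       ≡⟨ at-· (dil d f) g (r + n * d) ⟩
  sumTo (r + n * d) (λ k → dil d f k ℤ.* g (r + n * d ∸ k))       ≡⟨ sum-sparse d′ r n _ r<d (λ j i l →
     ≡.cong (ℤ._* g (r + n * d ∸ (suc j + i * d))) (≡.trans (≡.trans (≡.sym (at-U d (suc j) (dil d f) i)) (at (U-dil-suc d j f l) i)) (at-𝟘 i))) ⟩
  sumTo n (λ i → dil d f (i * d) ℤ.* g (r + n * d ∸ i * d))       ≡⟨ sumTo-cong n (λ i i≤n →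
     ≡.cong₂ (λ x y → x ℤ.* g y) (≡.trans (≡.sym (at-U d 0 (dil d f) i)) (at (U-dil d f) i)) (index i n i≤n)) ⟩
  sumTo n (λ i → f i ℤ.* g (r + (n ∸ i) * d))                     ≡⟨ sumTo-cong n (λ i _ → ≡.cong (f i ℤ.*_) (≡.sym (at-U d r g (n ∸ i)))) ⟩
  sumTo n (λ i → f i ℤ.* U d r g (n ∸ i))                         ≡⟨ at-· f (U d r g) n ⟨
  (f · U d r g) n                                                 ∎
  where
  open ≡.≡-Reasoning
  index : ∀ i n → i ≤ n → r + n * d ∸ i * d ≡ r + (n ∸ i) * d
  index i n i≤n = ≡.trans (ℕₚ.+-∸-assoc r (ℕₚ.*-monoˡ-≤ d i≤n)) (≡.cong (λ z → r + z) (≡.sym (ℕₚ.*-distribʳ-∸ d n i)))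

dil-cong : ∀ d .{{_ : NonZero d}} → f ≈ g → dil d f ≈ dil d g
dil-cong {f} {g} d e = dil-⇐U d (≈-trans (U-dil d g) (≈-sym e)) (λ r l → U-dil-suc d r g l)

dil-cong[] : ∀ d .{{_ : NonZero d}} → f ≈[ K ] g → dil d f ≈[ K ] dil d g
dil-cong[] {f} {K} {g} d e = mk[] λ n l → ≡.trans (at-dil d f n) (≡.trans (coeff n l) (≡.sym (at-dil d g n)))
  where
  coeff : ∀ n → n < K → (if n % d ≡ᵇ 0 then f (n / d) else + 0) ≡ (if n % d ≡ᵇ 0 then g (n / d) else + 0)
  coeff n l with n % d ≡ᵇ 0
  ... | true  = at< e (n / d) (ℕₚ.≤-<-trans (DM.m/n≤m n d) l)
  ... | false = ≡.refl

dil-∔ : ∀ d .{{_ : NonZero d}} f g → dil d (f ∔ g) ≈ dil d f ∔ dil d g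
dil-∔ d f g = dil-⇐U d
  (≈-trans (U-∔ d 0 (dil d f) (dil d g)) (∔-cong (U-dil d f) (U-dil d g)))
  (λ r l → ≈-trans (U-∔ d (suc r) (dil d f) (dil d g))
    (≈-trans (∔-cong (U-dil-suc d r f l) (U-dil-suc d r g l)) (∔-identityˡ 𝟘)))

dil-· : ∀ d .{{_ : NonZero d}} f g → dil d (f · g) ≈ dil d f · dil d g
dil-· d@(suc _) f g = dil-⇐U d
  (≈-trans (U-dil-· d 0 f (dil d g) (s≤s z≤n)) (·-congˡ (U-dil d g)))
  (λ r l → ≈-trans (U-dil-· d (suc r) f (dil d g) l) (≈-trans (·-congˡ (U-dil-suc d r g l)) (·-zeroʳ f)))

dil-κ : ∀ d .{{_ : NonZero d}} c → dil d (κ c) ≈ κ c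
dil-κ d@(suc _) c = dil-⇐U d
  (mk λ { zero → at-U d 0 (κ c) 0 ; (suc n) → ≡.trans (at-U d 0 (κ c) (suc n)) (≡.trans (at-κ-suc c _) (≡.sym (at-κ-suc c n))) })
  (λ r l → mk λ n → ≡.trans (at-U d (suc r) (κ c) n) (≡.trans (at-κ-suc c _) (≡.sym (at-𝟘 n))))

dil-⊝ : ∀ d .{{_ : NonZero d}} f → dil d (⊝ f) ≈ ⊝ dil d f
dil-⊝ d f = dil-⇐U d
  (≈-trans (U-⊝ d 0 (dil d f)) (⊝-cong (U-dil d f)))
  (λ r l → ≈-trans (U-⊝ d (suc r) (dil d f)) (≈-trans (⊝-cong (U-dil-suc d r f l))
    (solve 0 (:- con (+ 0) := con (+ 0)) ≈-refl)))

dil-⊟ : ∀ d .{{_ : NonZero d}} f g → dil d (f ⊟ g) ≈ dil d f ⊟ dil d g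
dil-⊟ d f g = ≈-trans (dil-∔ d f (⊝ g)) (∔-congˡ (dil-⊝ d g))

dil-q^ : ∀ d .{{_ : NonZero d}} n → dil d (q^ n) ≈ q^ (n * d)
dil-q^ d n = dil-⇐U d (mk λ i → ≡.trans (at-U d 0 (q^ (n * d)) i) (coeff i))
  (λ r l → mk λ i → ≡.trans (≡.trans (at-U d (suc r) (q^ (n * d)) i) (at-q^-≢ (n * d) (λ e → ℕₚ.1+n≢0 (≡.trans (≡.sym (residue d (suc r) i l))
     (≡.trans (≡.cong (_% d) e) (DM.m*n%n≡0 n d)))))) (≡.sym (at-𝟘 i)))
  where
  coeff : ∀ i → (q^ (n * d)) (i * d) ≡ (q^ n) i
  coeff i with i ≟ n
  ... | yes ≡.refl = ≡.trans (at-q^-≡ (i * d)) (≡.sym (at-q^-≡ i))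
  ... | no i≢n = ≡.trans (at-q^-≢ (n * d) (i≢n ∘ ℕₚ.*-cancelʳ-≡ i n d)) (≡.sym (at-q^-≢ n i≢n))

dil-∏ : ∀ d .{{_ : NonZero d}} n t → dil d (∏ n t) ≈ ∏ n (λ k → dil d (t k))
dil-∏ d zero    t = dil-κ d (+ 1)
dil-∏ d (suc n) t = ≈-trans (dil-· d (∏ n t) (t n)) (·-congʳ (dil-∏ d n t))

dil-∑ : ∀ d .{{_ : NonZero d}} n t → dil d (∑ n t) ≈ ∑ n (λ k → dil d (t k))
dil-∑ d zero    t = dil-κ d (+ 0)
dil-∑ d (suc n) t = ≈-trans (dil-∔ d (∑ n t) (t n)) (∔-congʳ (dil-∑ d n t))

dil-∏∞ : ∀ d .{{_ : NonZero d}} t → Multipliable t → dil d (∏∞ t) ≈ ∏∞ (λ k → dil d (t k))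
dil-∏∞ d t o = ⟶-unique (λ M → ≈⇒≈[] (dil-∏ d M t)) (λ M → dil-cong[] d (∏∞-⟶ o M))
  (∏∞-⟶ λ k → trans[] (dil-cong[] d (o k)) (≈⇒≈[] (dil-κ d (+ 1))))

dil-Σ∞ : ∀ d .{{_ : NonZero d}} t → Summable t → dil d (Σ∞ t) ≈ Σ∞ (λ k → dil d (t k))
dil-Σ∞ d t o = ⟶-unique (λ M → ≈⇒≈[] (dil-∑ d M t)) (λ M → dil-cong[] d (Σ∞-⟶ o M))
  (Σ∞-⟶ λ k → trans[] (dil-cong[] d (o k)) (≈⇒≈[] (dil-κ d (+ 0))))

U-∑ : ∀ d r n t → U d r (∑ n t) ≈ ∑ n (λ k → U d r (t k))
U-∑ d r zero    t = U-𝟘 d r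
U-∑ d r (suc n) t = ≈-trans (U-∔ d r (∑ n t) (t n)) (∔-congʳ (U-∑ d r n t))

opaque
  unfolding U

  U-q·-zero : ∀ d f → U (suc d) 0 (q^ 1 · f) ≈ q^ 1 · U (suc d) d f
  U-q·-zero d f = ≈-sym (q^·-ext 1 (U (suc d) d f) (λ { zero _ → q^·-at-< 1 f (s≤s z≤n) ; (suc n) (s≤s ()) })
    (λ n → q^·-at 1 f (d + n * suc d)))

  U-q·-suc : ∀ d r f → U d (suc r) (q^ 1 · f) ≈ U d r f
  U-q·-suc d r f = mk λ n → q^·-at 1 f (r + n * d)

-- Infinite products

-- In Pochhammer notation this is (-e q^a; q^m)_∞; the sign e is 1 or -1 throughout.
pr : Series → ℕ → ℕ → Series
pr e a m = ∏∞ (λ k → 𝟙 ∔ e · q^ (a + k * m))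

pr-Multipliable : ∀ e a m → Multipliable (λ k → 𝟙 ∔ e · q^ (a + k * suc m))
pr-Multipliable e a m k = ≈[]𝟙-∔ (O-·ʳ k (weaken (ℕₚ.≤-trans (ℕₚ.m≤m*n k (suc m)) (ℕₚ.m≤n+m (k * suc m) a)) (O-q^ (a + k * suc m))))

pr-split₂ : ∀ e a m → pr e a (suc m) ≈ pr e a (suc m * 2) · pr e (suc m + a) (suc m * 2)
pr-split₂ e a m = ≈-trans (∏∞-split₂ _ (pr-Multipliable e a m)) (·-cong
  (∏∞-cong λ k → ∔-congˡ (·-congˡ (q^≡ (≡.cong (λ z → a + z) (ex k)))))
  (∏∞-cong λ k → ∔-congˡ (·-congˡ (q^≡ (ex₁ k)))))
  where
  ex : ∀ k → k * 2 * suc m ≡ k * (suc m * 2)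
  ex k = lemma k (suc m) where
    lemma : ∀ k m → k * 2 * m ≡ k * (m * 2)
    lemma = solve-∀
  ex₁ : ∀ k → a + (1 + k * 2) * suc m ≡ suc m + a + k * (suc m * 2)
  ex₁ k = lemma a k (suc m) where
    lemma : ∀ a k m → a + (1 + k * 2) * m ≡ m + a + k * (m * 2)
    lemma = solve-∀

pr-split₃ : ∀ e a m → pr e a (suc m) ≈ pr e a (suc m * 3) · (pr e (suc m + a) (suc m * 3) · pr e (suc m * 2 + a) (suc m * 3))
pr-split₃ e a m = ≈-trans (∏∞-split₃ _ (pr-Multipliable e a m)) (·-cong
  (∏∞-cong λ k → ∔-congˡ (·-congˡ (q^≡ (lemma₀ a k (suc m))))) (·-cong
  (∏∞-cong λ k → ∔-congˡ (·-congˡ (q^≡ (lemma₁ a k (suc m)))))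
  (∏∞-cong λ k → ∔-congˡ (·-congˡ (q^≡ (lemma₂ a k (suc m)))))))
  where
  lemma₀ : ∀ a k m → a + k * 3 * m ≡ a + k * (m * 3)
  lemma₀ = solve-∀
  lemma₁ : ∀ a k m → a + (1 + k * 3) * m ≡ m + a + k * (m * 3)
  lemma₁ = solve-∀
  lemma₂ : ∀ a k m → a + (2 + k * 3) * m ≡ m * 2 + a + k * (m * 3)
  lemma₂ = solve-∀

pr-dil : ∀ d .{{_ : NonZero d}} e a m → dil d e ≈ e → dil d (pr e a (suc m)) ≈ pr e (a * d) (suc m * d)
pr-dil d e a m de = ≈-trans (dil-∏∞ d _ (pr-Multipliable e a m)) (∏∞-cong λ k →
  ≈-trans (dil-∔ d 𝟙 _) (∔-cong (dil-κ d (+ 1)) (≈-trans (dil-· d e _) (·-cong de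
    (≈-trans (dil-q^ d (a + k * suc m)) (q^≡ (lemma a k (suc m) d)))))))
  where
  lemma : ∀ a k m d → (a + k * m) * d ≡ a * d + k * (m * d)
  lemma = solve-∀

-𝟙 : Series
-𝟙 = ⊝ 𝟙

pr-± : ∀ a m → pr 𝟙 a (suc m) · pr -𝟙 a (suc m) ≈ pr -𝟙 (a * 2) (suc m * 2)
pr-± a m = ≈-trans (≈-sym (∏∞-· _ _ (pr-Multipliable 𝟙 a m) (pr-Multipliable -𝟙 a m))) (∏∞-cong λ k →
  ≈-trans (solve 1 (λ x → (con (+ 1) :+ con (+ 1) :* x) :* (con (+ 1) :+ (:- con (+ 1)) :* x) := con (+ 1) :+ (:- con (+ 1)) :* (x :* x)) ≈-refl (q^ (a + k * suc m)))
    (∔-congˡ (·-congˡ (≈-trans (≈-sym (q^-+ (a + k * suc m) _)) (q^≡ (lemma a k (suc m)))))))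
  where
  lemma : ∀ a k m → (a + k * m) + (a + k * m) ≡ a * 2 + k * (m * 2)
  lemma = solve-∀

pr⁻¹ : ℕ → ℕ → Series
pr⁻¹ a m = ∏∞ (λ k → geom (a + k * m))

pr⁻¹-Multipliable : ∀ a m → Multipliable (λ k → geom (suc a + k * suc m))
pr⁻¹-Multipliable a m k = weaken (ℕₚ.≤-trans (ℕₚ.m≤m*n k (suc m)) (ℕₚ.m≤n+m (k * suc m) (suc a))) (geom-≈𝟙 (suc a + k * suc m))

-𝟙-term : ∀ x → 𝟙 ∔ -𝟙 · x ≈ 𝟙 ⊟ x
-𝟙-term = solve 1 (λ x → con (+ 1) :+ (:- con (+ 1)) :* x := con (+ 1) :- x) ≈-refl

pr-inverse : ∀ a m → pr -𝟙 (suc a) (suc m) · pr⁻¹ (suc a) (suc m) ≈ 𝟙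
pr-inverse a m = ≈-trans (≈-sym (∏∞-· _ _ (pr-Multipliable -𝟙 (suc a) m) (pr⁻¹-Multipliable a m))) (∏∞-𝟙 λ k →
  ≈-trans (·-comm _ _) (≈-trans (·-congˡ (-𝟙-term (q^ (suc a + k * suc m)))) (geom-inverse (suc a + k * suc m))))

-- With Q = q^m, ip m n is 1/(Q;Q)_n and iq m N k is 1/(Q;Q)_{N-k}, read as 0 when k > N.

ip : ℕ → ℕ → Series
ip m n = ∏ n (λ k → geom (m + k * m))

iq : ℕ → ℕ → ℕ → Series
iq m N       zero    = ip m N
iq m zero    (suc k) = 𝟘
iq m (suc N) (suc k) = iq m N k

ip-step : ∀ m n → .{{NonZero m}} → ip m n ≈ (𝟙 ⊟ q^ (suc n * m)) · ip m (suc n)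
ip-step m@(suc _) n = ≈-sym (begin
  (𝟙 ⊟ q^ d) · (ip m n · geom d)  ≈⟨ solve 3 (λ x y z → x :* (y :* z) := y :* (z :* x)) ≈-refl (𝟙 ⊟ q^ d) (ip m n) (geom d) ⟩
  ip m n · (geom d · (𝟙 ⊟ q^ d))  ≈⟨ ·-congˡ (geom-inverse d) ⟩
  ip m n · 𝟙                      ≈⟨ ·-identityʳ (ip m n) ⟩
  ip m n                          ∎)
  where
  open ≈-Reasoning
  d = m + n * m

iq-step : ∀ m N k → .{{NonZero m}} → iq m N (suc k) ≈ (𝟙 ⊟ q^ ((N ∸ k) * m)) · iq m N k
iq-step m zero    zero    = ≈-sym (≈-trans (·-congʳ (≈-trans (∔-congˡ (⊝-cong q^0)) (solve 0 (con (+ 1) :- con (+ 1) := con (+ 0)) ≈-refl))) (·-zeroˡ (ip m 0)))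
iq-step m zero    (suc k) = ≈-sym (·-zeroʳ (𝟙 ⊟ q^ 0))
iq-step m (suc N) zero    = ip-step m N
iq-step m (suc N) (suc k) = iq-step m N k

iq-> : ∀ m N k → N < k → iq m N k ≈ 𝟘
iq-> m zero    (suc k) _         = ≈-refl
iq-> m (suc N) (suc k) (s≤s N<k) = iq-> m N k N<k

iq-≤ : ∀ m N k → k ≤ N → iq m N k ≈ ip m (N ∸ k)
iq-≤ m N       zero    _         = ≈-refl
iq-≤ m (suc N) (suc k) (s≤s k≤N) = iq-≤ m N k k≤N

ip-⟶ : ∀ m → ip (suc m) ⟶ pr⁻¹ (suc m) (suc m)
ip-⟶ m = ∏∞-⟶ (pr⁻¹-Multipliable m m)

pr-ip : ∀ m n → pr -𝟙 (suc m) (suc m) · ip (suc m) n ≈[ n ] 𝟙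
pr-ip m n = trans[] (·-congˡ[] (ip-⟶ m n)) (≈⇒≈[] (pr-inverse m m))

-- The finite triple product, for base q^m and αβ = q^m:
-- Σ_j x_j / ((Q;Q)_{M+n-j} (Q;Q)_j) = (-α;Q)_M (-β;Q)_n / (Q;Q)_{M+n},
-- where x_{n+k} = Q^{k(k-1)/2} α^k and x_{n-k} = Q^{k(k-1)/2} β^k.

module TripleProduct (m′ : ℕ) (α β : Series) (αβ : α · β ≈ q^ (suc m′)) where

  m : ℕ
  m = suc m′

  seq : Series → ℕ → Series
  seq γ zero    = 𝟙
  seq γ (suc k) = γ · (q^ (k * m) · seq γ k)

  x : ℕ → ℕ → Series
  x zero    k       = seq α k
  x (suc n) zero    = seq β (suc n)
  x (suc n) (suc j) = x n j

  x-zero : ∀ n → x n 0 ≈ seq β n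
  x-zero zero    = ≈-refl
  x-zero (suc n) = ≈-refl

  -- The ratio of consecutive terms is α Q^(i-n) on both sides of the centre, because 1/β = α/Q.
  -- Multiplying by Q^(n+M-i) clears the negative powers.
  x-stepα : ∀ n M i → i ≤ n + M → q^ ((n + M ∸ i) * m) · x n (suc i) ≈ α · q^ (M * m) · x n i
  x-stepα zero M i i≤M = begin
    q^ ((M ∸ i) * m) · (α · (q^ (i * m) · seq α i))
      ≈⟨ solve 4 (λ a b c d → a :* (b :* (c :* d)) := b :* (a :* c) :* d) ≈-refl _ α (q^ (i * m)) _ ⟩
    α · (q^ ((M ∸ i) * m) · q^ (i * m)) · seq α i
      ≈⟨ ·-congʳ (·-congˡ (≈-trans (≈-sym (q^-+ ((M ∸ i) * m) (i * m)))
           (q^≡ (≡.trans (≡.sym (ℕₚ.*-distribʳ-+ m (M ∸ i) i)) (≡.cong (_* m) (ℕₚ.m∸n+n≡m i≤M)))))) ⟩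
    α · q^ (M * m) · seq α i ∎
    where open ≈-Reasoning
  x-stepα (suc n) M zero _ = begin
    q^ (m + (n + M) * m) · x n 0
      ≈⟨ ·-cong (≈-trans (q^≡ (≡.cong (λ z → m + z) (ℕₚ.*-distribʳ-+ m n M))) (≈-trans (q^-+ m _) (·-cong (≈-sym αβ) (q^-+ (n * m) (M * m))))) (x-zero n) ⟩
    α · β · (q^ (n * m) · q^ (M * m)) · seq β n
      ≈⟨ solve 5 (λ a b c d s → a :* b :* (c :* d) :* s := a :* d :* (b :* (c :* s))) ≈-refl α β (q^ (n * m)) (q^ (M * m)) (seq β n) ⟩
    α · q^ (M * m) · (β · (q^ (n * m) · seq β n)) ∎
    where open ≈-Reasoning
  x-stepα (suc n) M (suc i) (s≤s i≤) = x-stepα n M i i≤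

  x-stepβ : ∀ n j → j ≤ n → q^ (j * m) · x (suc n) j ≈ β · q^ (n * m) · x n j
  x-stepβ n zero _ = begin
    q^ 0 · (β · (q^ (n * m) · seq β n)) ≈⟨ ·-cong q^0 (≈-sym (·-assoc β (q^ (n * m)) (seq β n))) ⟩
    𝟙 · (β · q^ (n * m) · seq β n)      ≈⟨ ·-identityˡ _ ⟩
    β · q^ (n * m) · seq β n            ≈⟨ ·-congˡ (x-zero n) ⟨
    β · q^ (n * m) · x n 0              ∎
    where open ≈-Reasoning
  x-stepβ (suc n) (suc j) (s≤s j≤n) = begin
    q^ (m + j * m) · x (suc n) j          ≈⟨ ·-congʳ (q^-+ m (j * m)) ⟩
    q^ m · q^ (j * m) · x (suc n) j       ≈⟨ ·-assoc (q^ m) (q^ (j * m)) (x (suc n) j) ⟩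
    q^ m · (q^ (j * m) · x (suc n) j)     ≈⟨ ·-congˡ (x-stepβ n j j≤n) ⟩
    q^ m · (β · q^ (n * m) · x n j)       ≈⟨ solve 4 (λ a b c d → a :* (b :* c :* d) := b :* (a :* c) :* d) ≈-refl (q^ m) β (q^ (n * m)) (x n j) ⟩
    β · (q^ m · q^ (n * m)) · x n j       ≈⟨ ·-congʳ (·-congˡ (q^-+ m (n * m))) ⟨
    β · q^ (m + n * m) · x n j            ∎
    where open ≈-Reasoning

  -- The Gaussian binomial coefficient divided by (Q;Q)_N. Multiplication by `D N` undoes one step
  -- of the denominator, so the q-Pascal rules take the form below.
  w : ℕ → ℕ → Series
  w N j = iq m N j · ip m j

  D : ℕ → Series
  D N = 𝟙 ⊟ q^ (suc N * m)

  w-zero : ∀ N → D N · w (suc N) 0 ≈ w N 0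
  w-zero N = ≈-trans (≈-sym (·-assoc (D N) (ip m (suc N)) 𝟙)) (·-congʳ (≈-sym (ip-step m N)))

  w-> : ∀ N → w N (suc N) ≈ 𝟘
  w-> N = ≈-trans (·-congʳ (iq-> m N (suc N) ℕₚ.≤-refl)) (·-zeroˡ _)

  module _ (N j : ℕ) (j≤N : j ≤ N) where
    private
      A B u v : Series
      A = q^ ((N ∸ j) * m)
      B = q^ (suc j * m)
      u = iq m N j
      v = ip m (suc j)
      D≈ : D N ≈ 𝟙 ⊟ A · B
      D≈ = ∔-congˡ (⊝-cong (≈-trans (q^≡ (≡.trans (≡.cong (_* m) (≡.trans (≡.cong suc (≡.sym (ℕₚ.m∸n+n≡m j≤N))) (≡.sym (ℕₚ.+-suc (N ∸ j) j)))) (ℕₚ.*-distribʳ-+ m (N ∸ j) (suc j)))) (q^-+ ((N ∸ j) * m) (suc j * m))))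

    -- The two Pascal rules are the two splittings 1 - AB = (1 - A) + A(1 - B) and 1 - AB = B(1 - A)
    -- + (1 - B). The first fits the growth of the α-product, the second that of the β-product.
    pascal₁ : D N · w (suc N) (suc j) ≈ w N (suc j) ∔ A · w N j
    pascal₁ = begin
      D N · (u · v)                                   ≈⟨ ·-congʳ D≈ ⟩
      (𝟙 ⊟ A · B) · (u · v)                           ≈⟨ solve 4 (λ a b u v → (con (+ 1) :- a :* b) :* (u :* v) := (con (+ 1) :- a) :* u :* v :+ a :* (u :* ((con (+ 1) :- b) :* v))) ≈-refl A B u v ⟩
      (𝟙 ⊟ A) · u · v ∔ A · (u · ((𝟙 ⊟ B) · v))       ≈⟨ ∔-cong (·-congʳ (≈-sym (iq-step m N j))) (·-congˡ (·-congˡ (≈-sym (ip-step m j)))) ⟩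
      w N (suc j) ∔ A · w N j                         ∎
      where open ≈-Reasoning

    pascal₂ : D N · w (suc N) (suc j) ≈ B · w N (suc j) ∔ w N j
    pascal₂ = begin
      D N · (u · v)                                   ≈⟨ ·-congʳ D≈ ⟩
      (𝟙 ⊟ A · B) · (u · v)                           ≈⟨ solve 4 (λ a b u v → (con (+ 1) :- a :* b) :* (u :* v) := b :* ((con (+ 1) :- a) :* u :* v) :+ u :* ((con (+ 1) :- b) :* v)) ≈-refl A B u v ⟩
      B · ((𝟙 ⊟ A) · u · v) ∔ u · ((𝟙 ⊟ B) · v)       ≈⟨ ∔-cong (·-congˡ (·-congʳ (≈-sym (iq-step m N j)))) (·-congˡ (≈-sym (ip-step m j))) ⟩
      B · w N (suc j) ∔ w N j                         ∎
      where open ≈-Reasoning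

  S : ℕ → (ℕ → Series) → Series
  S N y = ∑ (suc N) (λ j → w N j · y j)

  S-last : ∀ N y → ∑ (suc (suc N)) (λ j → w N j · y j) ≈ S N y
  S-last N y = ≈-trans (∔-congˡ (≈-trans (·-congʳ (w-> N)) (·-zeroˡ _))) (∔-identityʳ (S N y))

  S-head : ∀ N y → D N · S (suc N) y ≈ w N 0 · y 0 ∔ ∑ (suc N) (λ j → D N · w (suc N) (suc j) · y (suc j))
  S-head N y = begin
    D N · S (suc N) y
      ≈⟨ ·-congˡ (∑-head (suc N) (λ j → w (suc N) j · y j)) ⟩
    D N · (w (suc N) 0 · y 0 ∔ ∑ (suc N) (λ j → w (suc N) (suc j) · y (suc j)))
      ≈⟨ solve 4 (λ d w y s → d :* (w :* y :+ s) := d :* w :* y :+ d :* s) ≈-refl (D N) (w (suc N) 0) (y 0) _ ⟩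
    D N · w (suc N) 0 · y 0 ∔ D N · ∑ (suc N) (λ j → w (suc N) (suc j) · y (suc j))
      ≈⟨ ∔-cong (·-congʳ (w-zero N)) (≈-trans (≈-sym (∑-·ˡ (suc N) (D N) _)) (∑-cong (suc N) (λ j _ → ≈-sym (·-assoc _ _ _)))) ⟩
    w N 0 · y 0 ∔ ∑ (suc N) (λ j → D N · w (suc N) (suc j) · y (suc j)) ∎
    where open ≈-Reasoning

  S-stepα : ∀ N y γ → (∀ j → j ≤ N → q^ ((N ∸ j) * m) · y (suc j) ≈ γ · y j) → D N · S (suc N) y ≈ (𝟙 ∔ γ) · S N y
  S-stepα N y γ e = begin
    D N · S (suc N) y
      ≈⟨ S-head N y ⟩
    w N 0 · y 0 ∔ ∑ (suc N) (λ j → D N · w (suc N) (suc j) · y (suc j))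
      ≈⟨ ∔-congˡ (∑-cong (suc N) (λ { j (s≤s j≤N) → term j j≤N })) ⟩
    w N 0 · y 0 ∔ ∑ (suc N) (λ j → w N (suc j) · y (suc j) ∔ γ · (w N j · y j))
      ≈⟨ ∔-congˡ (∑-∔ (suc N) _ _) ⟩
    w N 0 · y 0 ∔ (∑ (suc N) (λ j → w N (suc j) · y (suc j)) ∔ ∑ (suc N) (λ j → γ · (w N j · y j)))
      ≈⟨ ∔-assoc _ _ _ ⟨
    w N 0 · y 0 ∔ ∑ (suc N) (λ j → w N (suc j) · y (suc j)) ∔ ∑ (suc N) (λ j → γ · (w N j · y j))
      ≈⟨ ∔-cong (≈-trans (≈-sym (∑-head (suc N) (λ j → w N j · y j))) (S-last N y)) (∑-·ˡ (suc N) γ _) ⟩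
    S N y ∔ γ · S N y
      ≈⟨ solve 2 (λ g s → s :+ g :* s := (con (+ 1) :+ g) :* s) ≈-refl γ (S N y) ⟩
    (𝟙 ∔ γ) · S N y ∎
    where
    open ≈-Reasoning
    term : ∀ j → j ≤ N → D N · w (suc N) (suc j) · y (suc j) ≈ w N (suc j) · y (suc j) ∔ γ · (w N j · y j)
    term j j≤N = begin
      D N · w (suc N) (suc j) · y (suc j)                                    ≈⟨ ·-congʳ (pascal₁ N j j≤N) ⟩
      (w N (suc j) ∔ q^ ((N ∸ j) * m) · w N j) · y (suc j)                   ≈⟨ solve 4 (λ a b c d → (a :+ b :* c) :* d := a :* d :+ c :* (b :* d)) ≈-refl (w N (suc j)) (q^ ((N ∸ j) * m)) (w N j) (y (suc j)) ⟩
      w N (suc j) · y (suc j) ∔ w N j · (q^ ((N ∸ j) * m) · y (suc j))       ≈⟨ ∔-congˡ (·-congˡ (e j j≤N)) ⟩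
      w N (suc j) · y (suc j) ∔ w N j · (γ · y j)                            ≈⟨ ∔-congˡ (solve 3 (λ a b c → a :* (b :* c) := b :* (a :* c)) ≈-refl (w N j) γ (y j)) ⟩
      w N (suc j) · y (suc j) ∔ γ · (w N j · y j)                            ∎

  S-stepβ : ∀ N y z γ → (∀ j → y (suc j) ≈ z j) → (∀ j → j ≤ N → q^ (j * m) · y j ≈ γ · z j) → D N · S (suc N) y ≈ (𝟙 ∔ γ) · S N z
  S-stepβ N y z γ yz e = begin
    D N · S (suc N) y
      ≈⟨ S-head N y ⟩
    w N 0 · y 0 ∔ ∑ (suc N) (λ j → D N · w (suc N) (suc j) · y (suc j))
      ≈⟨ ∔-cong (≈-sym (≈-trans (·-congˡ (≈-trans (·-congʳ q^0) (·-identityˡ (y 0)))) ≈-refl)) (∑-cong (suc N) (λ { j (s≤s j≤N) → term j j≤N })) ⟩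
    w N 0 · (q^ 0 · y 0) ∔ ∑ (suc N) (λ j → w N (suc j) · (q^ (suc j * m) · y (suc j)) ∔ w N j · z j)
      ≈⟨ ∔-congˡ (∑-∔ (suc N) _ _) ⟩
    w N 0 · (q^ 0 · y 0) ∔ (∑ (suc N) (λ j → w N (suc j) · (q^ (suc j * m) · y (suc j))) ∔ S N z)
      ≈⟨ ∔-assoc _ _ _ ⟨
    w N 0 · (q^ 0 · y 0) ∔ ∑ (suc N) (λ j → w N (suc j) · (q^ (suc j * m) · y (suc j))) ∔ S N z
      ≈⟨ ∔-congʳ (≈-trans (≈-sym (∑-head (suc N) (λ j → w N j · (q^ (j * m) · y j)))) (S-last N (λ j → q^ (j * m) · y j))) ⟩
    S N (λ j → q^ (j * m) · y j) ∔ S N z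
      ≈⟨ ∔-congʳ (≈-trans (∑-cong (suc N) (λ { j (s≤s j≤N) → ≈-trans (·-congˡ (e j j≤N)) (solve 3 (λ a b c → a :* (b :* c) := b :* (a :* c)) ≈-refl (w N j) γ (z j)) })) (∑-·ˡ (suc N) γ _)) ⟩
    γ · S N z ∔ S N z
      ≈⟨ solve 2 (λ g s → g :* s :+ s := (con (+ 1) :+ g) :* s) ≈-refl γ (S N z) ⟩
    (𝟙 ∔ γ) · S N z ∎
    where
    open ≈-Reasoning
    term : ∀ j → j ≤ N → D N · w (suc N) (suc j) · y (suc j) ≈ w N (suc j) · (q^ (suc j * m) · y (suc j)) ∔ w N j · z j
    term j j≤N = begin
      D N · w (suc N) (suc j) · y (suc j)                                    ≈⟨ ·-congʳ (pascal₂ N j j≤N) ⟩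
      (q^ (suc j * m) · w N (suc j) ∔ w N j) · y (suc j)                     ≈⟨ solve 4 (λ b a c d → (b :* a :+ c) :* d := a :* (b :* d) :+ c :* d) ≈-refl (q^ (suc j * m)) (w N (suc j)) (w N j) (y (suc j)) ⟩
      w N (suc j) · (q^ (suc j * m) · y (suc j)) ∔ w N j · y (suc j)         ≈⟨ ∔-congˡ (·-congˡ (yz j)) ⟩
      w N (suc j) · (q^ (suc j * m) · y (suc j)) ∔ w N j · z j               ∎

  factor : Series → ℕ → Series
  factor γ k = 𝟙 ∔ γ · q^ (k * m)

  cancel-D : ∀ N {f g} → D N · f ≈ g · ip m N → f ≈ g · ip m (suc N)
  cancel-D N {f} {g} e = unit-cancelˡ (D N) (≈-trans (·-comm _ _) (geom-inverse (suc N * m)))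
    (≈-trans e (≈-trans (·-congˡ (ip-step m N)) (solve 3 (λ g d i → g :* (d :* i) := d :* (g :* i)) ≈-refl g (D N) (ip m (suc N)))))

  -- The products grow by one factor at a time: for M = 0 each β-factor moves the centre of the
  -- sequence by one, and afterwards each α-factor lengthens the sum with the centre fixed.
  finite : ∀ M n → S (M + n) (x n) ≈ ∏ M (factor α) · ∏ n (factor β) · ip m (M + n)
  finite zero zero = ≈-trans (∔-identityˡ _) (solve 1 (λ o → o :* o :* o := o :* o :* o) ≈-refl 𝟙)
  finite zero (suc n) = cancel-D n (begin
    D n · S (suc n) (x (suc n))                                    ≈⟨ S-stepβ n (x (suc n)) (x n) (β · q^ (n * m)) (λ _ → ≈-refl) (x-stepβ n) ⟩
    factor β n · S n (x n)                                         ≈⟨ ·-congˡ (finite zero n) ⟩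
    factor β n · (𝟙 · ∏ n (factor β) · ip m n)                     ≈⟨ solve 4 (λ f o p i → f :* (o :* p :* i) := o :* (p :* f) :* i) ≈-refl (factor β n) 𝟙 (∏ n (factor β)) (ip m n) ⟩
    𝟙 · (∏ n (factor β) · factor β n) · ip m n                     ∎)
    where open ≈-Reasoning
  finite (suc M) n = cancel-D (M + n) (begin
    D (M + n) · S (suc (M + n)) (x n)                              ≈⟨ S-stepα (M + n) (x n) (α · q^ (M * m)) step ⟩
    factor α M · S (M + n) (x n)                                   ≈⟨ ·-congˡ (finite M n) ⟩
    factor α M · (∏ M (factor α) · ∏ n (factor β) · ip m (M + n))  ≈⟨ solve 4 (λ f o p i → f :* (o :* p :* i) := o :* f :* p :* i) ≈-refl (factor α M) (∏ M (factor α)) (∏ n (factor β)) (ip m (M + n)) ⟩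
    ∏ M (factor α) · factor α M · ∏ n (factor β) · ip m (M + n)    ∎)
    where
    open ≈-Reasoning
    step : ∀ j → j ≤ M + n → q^ ((M + n ∸ j) * m) · x n (suc j) ≈ α · q^ (M * m) · x n j
    step j l rewrite ℕₚ.+-comm M n = x-stepα n M j l

  module _ (Oα : O 1 α) (Oβ : O 1 β) where

    seq-O : ∀ γ → O 1 γ → Summable (seq γ)
    seq-O γ o zero    = O-0
    seq-O γ o (suc k) = trans[] (·-order 1 o (O-·ʳ k (seq-O γ o k))) (≈⇒≈[] (·-zeroʳ γ))

    x-O : ∀ n j → O ∣ n - j ∣ (x n j)
    x-O zero    zero    = O-0
    x-O zero    (suc j) = seq-O α Oα (suc j)
    x-O (suc n) zero    = seq-O β Oβ (suc n)
    x-O (suc n) (suc j) = x-O n j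

    θ : Series
    θ = Σ∞ (seq α) ∔ Σ∞ (λ k → seq β (suc k))

    ∑-x : ∀ n L → ∑ (n + L) (x n) ≈ ∑ L (seq α) ∔ ∑ n (λ k → seq β (suc k))
    ∑-x zero    L = ≈-sym (∔-identityʳ _)
    ∑-x (suc n) L = ≈-trans (∑-head (n + L) (x (suc n))) (≈-trans (∔-congˡ (∑-x n L))
      (solve 3 (λ a b c → a :+ (b :+ c) := b :+ (c :+ a)) ≈-refl (seq β (suc n)) (∑ L (seq α)) (∑ n (λ k → seq β (suc k)))))

    P : Series
    P = pr -𝟙 m m

    factor-Multipliable : ∀ γ → Multipliable (factor γ)
    factor-Multipliable γ k = ≈[]𝟙-∔ (O-·ʳ k (weaken (ℕₚ.m≤m*n k m) (O-q^ (k * m))))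

    -- (Q;Q)_∞/(Q;Q)_j is 1 only below q^j, which says little for small j; but there x_j has order M
    -- - j, and the two gains add up to M. The factor with N - j is treated symmetrically.
    term : ∀ M j → j ≤ M + M → P · P · (w (M + M) j · x M j) ≈[ M ] x M j
    term M j j≤ = trans[] (≈⇒≈[] (solve 4 (λ p a b x → p :* p :* (a :* b :* x) := x :* (p :* b) :* (p :* a)) ≈-refl P (iq m N j) (ip m j) (x M j)))
      (trans[] (weaken bound₂ (absorb d (O-·ˡ d (x-O M j)) (trans[] (·-congˡ[] (≈⇒≈[] (iq-≤ m N j j≤))) (pr-ip m′ (N ∸ j)))))
               (weaken bound₁ (absorb d (x-O M j) (pr-ip m′ j))))
      where
      N = M + M
      d = ∣ M - j ∣
      bound₁ : M ≤ d + j
      bound₁ = ℕₚ.m≤∣m-n∣+n M j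
      bound₂ : M ≤ d + (N ∸ j)
      bound₂ = ℕₚ.+-cancelˡ-≤ M M _ (begin
        M + M              ≤⟨ ℕₚ.m≤n+m∸n N j ⟩
        j + (N ∸ j)        ≤⟨ ℕₚ.+-monoˡ-≤ (N ∸ j) (ℕₚ.m≤n+∣n-m∣ j M) ⟩
        M + d + (N ∸ j)    ≡⟨ ℕₚ.+-assoc M d (N ∸ j) ⟩
        M + (d + (N ∸ j))  ∎)
        where open ℕₚ.≤-Reasoning

    jacobi : θ ≈ P · ∏∞ (factor α) · ∏∞ (factor β)
    -- Multiplying by (Q;Q)_∞² clears both denominators of every `w`; the product side has only one
    -- denominator, so one `P` survives there.
    jacobi = ⟶-unique {s = λ M → P · P · S (M + M) (x M)} {t = λ M → P · (P · ip m (M + M)) · ∏ M (factor α) · ∏ M (factor β)}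
      (λ M → ≈⇒≈[] (≈-trans (·-congˡ (finite M M)) (solve 4 (λ p a b i → p :* p :* (a :* b :* i) := p :* (p :* i) :* a :* b) ≈-refl P _ _ (ip m (M + M)))))
      lhs
      (λ M → ·-cong[] (·-cong[] (trans[] (·-congˡ[] (weaken (ℕₚ.m≤m+n M M) (pr-ip m′ (M + M)))) (≈⇒≈[] (·-identityʳ P)))
               (∏∞-⟶ (factor-Multipliable α) M)) (∏∞-⟶ (factor-Multipliable β) M))
      where
      lhs : (λ M → P · P · S (M + M) (x M)) ⟶ θ
      lhs M = trans[] (≈⇒≈[] (≈-sym (∑-·ˡ (suc (M + M)) (P · P) _)))
        (trans[] (∑-cong[] (suc (M + M)) (λ { j (s≤s j≤) → term M j j≤ }))
        (trans[] (≈⇒≈[] (≈-trans (≡⇒≈ (≡.cong (λ n → ∑ n (x M)) (≡.sym (ℕₚ.+-suc M M)))) (∑-x M (suc M))))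
        (∔-cong[] (weaken (ℕₚ.n≤1+n M) (Σ∞-⟶ (seq-O α Oα) (suc M))) (Σ∞-⟶ (λ k → weaken (ℕₚ.n≤1+n k) (seq-O β Oβ (suc k))) M))))

-- T n = n(n-1)/2
T : ℕ → ℕ
T zero    = 0
T (suc n) = n + T n

ε : Series → ℕ → Series
ε e zero    = 𝟙
ε e (suc k) = e · ε e k

-- Ramanujan's theta function f(e q^a, e q^b)
Θ₊ Θ₋ : Series → ℕ → ℕ → ℕ → Series
Θ₊ e a b k = ε e k · q^ (T k * (a + b) + k * a)
Θ₋ e a b k = ε e (suc k) · q^ (T (suc k) * (a + b) + suc k * b)

Θ : Series → ℕ → ℕ → Series
Θ e a b = Σ∞ (Θ₊ e a b) ∔ Σ∞ (Θ₋ e a b)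

Θ₊-Summable : ∀ e a b → Summable (Θ₊ e (suc a) b)
Θ₊-Summable e a b k = O-·ʳ k (weaken (ℕₚ.≤-trans (ℕₚ.m≤m*n k (suc a)) (ℕₚ.m≤n+m (k * suc a) _)) (O-q^ (T k * (suc a + b) + k * suc a)))

Θ₋-Summable : ∀ e a b → Summable (Θ₋ e a (suc b))
Θ₋-Summable e a b k = O-·ʳ k (weaken (ℕₚ.≤-trans (ℕₚ.≤-trans (ℕₚ.n≤1+n k) (ℕₚ.m≤m*n (suc k) (suc b))) (ℕₚ.m≤n+m (suc k * suc b) _)) (O-q^ (T (suc k) * (a + suc b) + suc k * suc b)))

module _ (e : Series) (e² : e · e ≈ 𝟙) (a b : ℕ) where
  private
    α β : Series
    α = e · q^ (suc a)
    β = e · q^ (suc b)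
    αβ : α · β ≈ q^ (suc (a + suc b))
    αβ = ≈-trans (solve 3 (λ e x y → e :* x :* (e :* y) := e :* e :* (x :* y)) ≈-refl e (q^ (suc a)) (q^ (suc b)))
      (≈-trans (·-cong e² (≈-sym (q^-+ (suc a) (suc b)))) (·-identityˡ _))
    open TripleProduct (a + suc b) α β αβ

    O-γ : ∀ c → O 1 (e · q^ (suc c))
    O-γ c = O-·ʳ 1 (weaken (s≤s z≤n) (O-q^ (suc c)))

    seq≈ : ∀ c k → seq (e · q^ c) k ≈ ε e k · q^ (T k * m + k * c)
    seq≈ c zero    = ≈-sym (≈-trans (·-congˡ q^0) (·-identityʳ 𝟙))
    seq≈ c (suc k) = begin
      e · q^ c · (q^ (k * m) · seq (e · q^ c) k)                     ≈⟨ ·-congˡ (·-congˡ (seq≈ c k)) ⟩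
      e · q^ c · (q^ (k * m) · (ε e k · q^ (T k * m + k * c)))       ≈⟨ solve 5 (λ e x y s z → e :* x :* (y :* (s :* z)) := e :* s :* (x :* (y :* z))) ≈-refl e (q^ c) (q^ (k * m)) (ε e k) _ ⟩
      e · ε e k · (q^ c · (q^ (k * m) · q^ (T k * m + k * c)))       ≈⟨ ·-congˡ (≈-trans (·-congˡ (≈-sym (q^-+ _ _))) (≈-trans (≈-sym (q^-+ _ _)) (q^≡ (expo c k (T k) m)))) ⟩
      e · ε e k · q^ ((k + T k) * m + suc k * c)                     ∎
      where
      open ≈-Reasoning
      expo : ∀ c k t m → c + (k * m + (t * m + k * c)) ≡ (k + t) * m + suc k * c
      expo = solve-∀

  -- The parameters are e q^a and e q^b with e² = 1, so their product q^(a+b) is a pure power of q,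
  -- as `TripleProduct` requires.
  jacobi-triple-product : let m = suc a + suc b in
    Θ e (suc a) (suc b) ≈ pr -𝟙 m m · pr e (suc a) m · pr e (suc b) m
  jacobi-triple-product = ≈-trans
    (∔-cong (Σ∞-cong (λ k → ≈-sym (seq≈ (suc a) k))) (Σ∞-cong (λ k → ≈-sym (seq≈ (suc b) (suc k)))))
    (≈-trans (jacobi (O-γ a) (O-γ b)) (·-cong (·-congˡ (pr≈ (suc a))) (pr≈ (suc b))))
    where
    pr≈ : ∀ c → ∏∞ (factor (e · q^ c)) ≈ pr e c m
    pr≈ c = ∏∞-cong λ k → ∔-congˡ (≈-trans (·-assoc e (q^ c) (q^ (k * m))) (·-congˡ (≈-sym (q^-+ c (k * m)))))

-- Theta functions and their 3-dissections

𝟙² : 𝟙 · 𝟙 ≈ 𝟙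
𝟙² = ·-identityˡ 𝟙

-𝟙² : -𝟙 · -𝟙 ≈ 𝟙
-𝟙² = solve 0 ((:- con (+ 1)) :* (:- con (+ 1)) := con (+ 1)) ≈-refl

ε-𝟙 : ∀ k → ε 𝟙 k ≈ 𝟙
ε-𝟙 zero    = ≈-refl
ε-𝟙 (suc k) = ≈-trans (·-identityˡ (ε 𝟙 k)) (ε-𝟙 k)

dil-𝟙 : ∀ d .{{_ : NonZero d}} → dil d 𝟙 ≈ 𝟙
dil-𝟙 d = dil-κ d (+ 1)

dil--𝟙 : ∀ d .{{_ : NonZero d}} → dil d -𝟙 ≈ -𝟙
dil--𝟙 d = ≈-trans (dil-⊝ d 𝟙) (⊝-cong (dil-𝟙 d))

dil-ε : ∀ d .{{_ : NonZero d}} k → dil d (ε -𝟙 k) ≈ ε -𝟙 k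
dil-ε d zero    = dil-𝟙 d
dil-ε d (suc k) = ≈-trans (dil-· d -𝟙 (ε -𝟙 k)) (·-cong (dil--𝟙 d) (dil-ε d k))

ε-3 : ∀ k → ε -𝟙 (k * 3) ≈ ε -𝟙 k
ε-3 zero    = ≈-refl
ε-3 (suc k) = ≈-trans (solve 1 (λ x → (:- con (+ 1)) :* ((:- con (+ 1)) :* ((:- con (+ 1)) :* x)) := (:- con (+ 1)) :* x) ≈-refl (ε -𝟙 (k * 3))) (·-congˡ (ε-3 k))

-- Classically φ(-q) = Σ (-1)^n q^(n²), ψ(q), f(q,q²) and f(-q,-q⁵); the sign in φ(-q) is part of
-- the name `φ` here.
φ ψ A Ω : Series
φ = Θ -𝟙 1 1
A = Θ 𝟙 2 1
Ω = Θ -𝟙 5 1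
ψ = Σ∞ (λ k → q^ (T (suc k)))

ψ-Summable : Summable (λ k → q^ (T (suc k)))
ψ-Summable k = weaken (ℕₚ.m≤m+n k (T k)) (O-q^ (T (suc k)))

private
  T-square : ∀ n → T n * 2 + n ≡ n * n
  T-square zero    = ≡.refl
  T-square (suc n) = ≡.trans (lemma n (T n)) (≡.trans (≡.cong (λ z → z + (n + n + 1)) (T-square n)) (lemma′ n))
    where
    lemma : ∀ n t → (n + t) * 2 + suc n ≡ t * 2 + n + (n + n + 1)
    lemma = solve-∀
    lemma′ : ∀ n → n * n + (n + n + 1) ≡ suc n * suc n
    lemma′ = solve-∀

  square : ∀ n → T n * 2 + n * 1 ≡ n * n
  square n = ≡.trans (≡.cong (λ z → T n * 2 + z) (ℕₚ.*-identityʳ n)) (T-square n)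

  exponent₀ : ∀ k → T (k * 3) * 2 + k * 3 * 1 ≡ (T k * 2 + k * 1) * 3 * 3
  exponent₀ k = ≡.trans (square (k * 3)) (≡.trans (lemma k) (≡.cong (λ z → z * 3 * 3) (≡.sym (square k))))
    where
    lemma : ∀ k → k * 3 * (k * 3) ≡ k * k * 3 * 3
    lemma = solve-∀

  exponent₁ : ∀ k → T (1 + k * 3) * 2 + (1 + k * 3) * 1 ≡ 1 + (T k * 6 + k * 5) * 3
  exponent₁ k = ≡.trans (square (1 + k * 3)) (≡.trans (lemma k)
    (≡.trans (≡.cong (λ z → 1 + z * 9 + k * 6) (≡.sym (T-square k))) (lemma′ (T k) k)))
    where
    lemma : ∀ k → (1 + k * 3) * (1 + k * 3) ≡ 1 + k * k * 9 + k * 6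
    lemma = solve-∀
    lemma′ : ∀ t k → 1 + (t * 2 + k) * 9 + k * 6 ≡ 1 + (t * 6 + k * 5) * 3
    lemma′ = solve-∀

  exponent₂ : ∀ k → T (2 + k * 3) * 2 + (2 + k * 3) * 1 ≡ 1 + (T (suc k) * 6 + suc k * 1) * 3
  exponent₂ k = ≡.trans (square (2 + k * 3)) (≡.trans (lemma k)
    (≡.trans (≡.cong (λ z → 4 + z * 9 + k * 12) (≡.sym (T-square k))) (lemma′ (T k) k)))
    where
    lemma : ∀ k → (2 + k * 3) * (2 + k * 3) ≡ 4 + k * k * 9 + k * 12
    lemma = solve-∀
    lemma′ : ∀ t k → 4 + (t * 2 + k) * 9 + k * 12 ≡ 1 + ((k + t) * 6 + suc k * 1) * 3
    lemma′ = solve-∀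

  T-3k : ∀ k → T (1 + k * 3) ≡ (T k * 3 + k * 2) * 3
  T-3k zero    = ≡.refl
  T-3k (suc k) = ≡.trans (≡.cong (λ z → (3 + k * 3) + ((2 + k * 3) + ((1 + k * 3) + z))) (T-3k k)) (lemma k (T k))
    where
    lemma : ∀ k t → (3 + k * 3) + ((2 + k * 3) + ((1 + k * 3) + (t * 3 + k * 2) * 3)) ≡ ((k + t) * 3 + suc k * 2) * 3
    lemma = solve-∀

  T-3k+1 : ∀ k → T (2 + k * 3) ≡ 1 + T (suc k) * 3 * 3
  T-3k+1 k = ≡.trans (≡.cong (λ z → (1 + k * 3) + z) (T-3k k)) (lemma k (T k))
    where
    lemma : ∀ k t → (1 + k * 3) + (t * 3 + k * 2) * 3 ≡ 1 + (k + t) * 3 * 3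
    lemma = solve-∀

  T-3k+2 : ∀ k → T (3 + k * 3) ≡ (T (suc k) * 3 + suc k * 1) * 3
  T-3k+2 k = ≡.trans (≡.cong (λ z → (2 + k * 3) + ((1 + k * 3) + z)) (T-3k k)) (lemma k (T k))
    where
    lemma : ∀ k t → (2 + k * 3) + ((1 + k * 3) + (t * 3 + k * 2) * 3) ≡ ((k + t) * 3 + suc k * 1) * 3
    lemma = solve-∀

  T-2k : ∀ k → T (1 + k * 2) ≡ T k * 4 + k * 3
  T-2k zero    = ≡.refl
  T-2k (suc k) = ≡.trans (≡.cong (λ z → (2 + k * 2) + ((1 + k * 2) + z)) (T-2k k)) (lemma k (T k))
    where
    lemma : ∀ k t → (2 + k * 2) + ((1 + k * 2) + (t * 4 + k * 3)) ≡ (k + t) * 4 + suc k * 3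
    lemma = solve-∀

  T-2k+1 : ∀ k → T (2 + k * 2) ≡ T (suc k) * 4 + suc k * 1
  T-2k+1 k = ≡.trans (≡.cong (λ z → (1 + k * 2) + z) (T-2k k)) (lemma k (T k))
    where
    lemma : ∀ k t → (1 + k * 2) + (t * 4 + k * 3) ≡ (k + t) * 4 + suc k * 1
    lemma = solve-∀

  𝟙-term : ∀ k {a b} → a ≡ b → q^ a ≈ ε 𝟙 k · q^ b
  𝟙-term k {a} {b} e = ≈-trans (q^≡ e) (≈-sym (≈-trans (·-congʳ (ε-𝟙 k)) (·-identityˡ (q^ b))))

  𝟙-term-3 : ∀ k {a b} → a ≡ b * 3 → q^ a ≈ dil 3 (ε 𝟙 k · q^ b)
  𝟙-term-3 k {a} {b} e = ≈-trans (q^≡ e) (≈-trans (≈-sym (dil-q^ 3 b)) (dil-cong 3 (𝟙-term k ≡.refl)))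

ψ≈Θ : ψ ≈ Θ 𝟙 3 1
ψ≈Θ = ≈-trans (Σ∞-split₂ _ ψ-Summable) (∔-cong
  (Σ∞-cong λ k → 𝟙-term k (T-2k k)) (Σ∞-cong λ k → 𝟙-term (suc k) (T-2k+1 k)))

-- The triangular number n(n+1)/2 is divisible by 3 unless n is 1 modulo 3, when it is 1 plus nine
-- times a triangular number. So class 2 is empty and class 1 reproduces ψ(q⁹).
ψ-dissection : ψ ≈ dil 3 A ∔ q^ 1 · dil 3 (dil 3 ψ)
ψ-dissection = begin
  ψ
    ≈⟨ Σ∞-split₃ _ ψ-Summable ⟩
  Σ∞ (λ k → q^ (T (1 + k * 3))) ∔ (Σ∞ (λ k → q^ (T (2 + k * 3))) ∔ Σ∞ (λ k → q^ (T (3 + k * 3))))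
    ≈⟨ ∔-cong (Σ∞-cong λ k → 𝟙-term-3 k (T-3k k)) (∔-cong (Σ∞-cong λ k →
         ≈-trans (q^≡ (T-3k+1 k)) (≈-trans (q^-+ 1 _) (·-congˡ (≈-sym (≈-trans (dil-cong 3 (dil-q^ 3 (T (suc k)))) (dil-q^ 3 _))))))
         (Σ∞-cong λ k → 𝟙-term-3 (suc k) (T-3k+2 k))) ⟩
  Σ∞ (λ k → dil 3 (Θ₊ 𝟙 2 1 k)) ∔ (Σ∞ (λ k → q^ 1 · dil 3 (dil 3 (q^ (T (suc k))))) ∔ Σ∞ (λ k → dil 3 (Θ₋ 𝟙 2 1 k)))
    ≈⟨ ∔-cong (≈-sym (dil-Σ∞ 3 _ (Θ₊-Summable 𝟙 1 1))) (∔-cong dissect₁ (≈-sym (dil-Σ∞ 3 _ (Θ₋-Summable 𝟙 2 0)))) ⟩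
  dil 3 (Σ∞ (Θ₊ 𝟙 2 1)) ∔ (q^ 1 · dil 3 (dil 3 ψ) ∔ dil 3 (Σ∞ (Θ₋ 𝟙 2 1)))
    ≈⟨ solve 3 (λ a b c → a :+ (b :+ c) := (a :+ c) :+ b) ≈-refl _ _ _ ⟩
  dil 3 (Σ∞ (Θ₊ 𝟙 2 1)) ∔ dil 3 (Σ∞ (Θ₋ 𝟙 2 1)) ∔ q^ 1 · dil 3 (dil 3 ψ)
    ≈⟨ ∔-congʳ (dil-∔ 3 _ _) ⟨
  dil 3 A ∔ q^ 1 · dil 3 (dil 3 ψ) ∎
  where
  open ≈-Reasoning
  dil-Summable : ∀ {t} → Summable t → Summable (λ k → dil 3 (t k))
  dil-Summable o k = trans[] (dil-cong[] 3 (o k)) (≈⇒≈[] (dil-κ 3 (+ 0)))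
  dissect₁ : Σ∞ (λ k → q^ 1 · dil 3 (dil 3 (q^ (T (suc k))))) ≈ q^ 1 · dil 3 (dil 3 ψ)
  dissect₁ = ≈-trans (Σ∞-·ˡ (q^ 1) _ (dil-Summable (dil-Summable ψ-Summable)))
    (·-congˡ (≈-sym (≈-trans (dil-cong 3 (dil-Σ∞ 3 _ ψ-Summable)) (dil-Σ∞ 3 _ (dil-Summable ψ-Summable)))))

-- Squares are 0 or 1 modulo 3, so class 2 is empty. The indices n ≡ 1 and n ≡ -1 are exchanged by n
-- ↦ -n and contribute equally, whence the factor 2.
φ-dissection : φ ≈ dil 3 (dil 3 φ) ⊟ κ (+ 2) · (q^ 1 · dil 3 Ω)
φ-dissection = begin
  φ
    ≈⟨ ∔-cong (Σ∞-split₃ _ (Θ₊-Summable -𝟙 0 1)) (Σ∞-split₃ _ (Θ₋-Summable -𝟙 1 0)) ⟩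
  Σ∞ (λ k → Θ₊ -𝟙 1 1 (k * 3)) ∔ (Σ∞ (λ k → Θ₊ -𝟙 1 1 (1 + k * 3)) ∔ Σ∞ (λ k → Θ₊ -𝟙 1 1 (2 + k * 3))) ∔
  (Σ∞ (λ k → Θ₋ -𝟙 1 1 (k * 3)) ∔ (Σ∞ (λ k → Θ₋ -𝟙 1 1 (1 + k * 3)) ∔ Σ∞ (λ k → Θ₋ -𝟙 1 1 (2 + k * 3))))
    -- The negative half of φ is its positive half with the index advanced by one, so `p₁` and `p₂`
    -- apply definitionally to its classes 0 and 1.
    ≈⟨ ∔-cong (∔-cong p₀ (∔-cong p₁ p₂)) (∔-cong p₁ (∔-cong p₂ p₃)) ⟩
  dil 3 (dil 3 φ₊) ∔ (-q · dil 3 Ω₊ ∔ -q · dil 3 Ω₋) ∔ (-q · dil 3 Ω₊ ∔ (-q · dil 3 Ω₋ ∔ dil 3 (dil 3 φ₋)))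
    ≈⟨ solve 5 (λ a b c d q → a :+ ((:- con (+ 1)) :* q :* c :+ (:- con (+ 1)) :* q :* d) :+ ((:- con (+ 1)) :* q :* c :+ ((:- con (+ 1)) :* q :* d :+ b))
         := a :+ b :- con (+ 2) :* (q :* (c :+ d))) ≈-refl (dil 3 (dil 3 φ₊)) (dil 3 (dil 3 φ₋)) (dil 3 Ω₊) (dil 3 Ω₋) (q^ 1) ⟩
  dil 3 (dil 3 φ₊) ∔ dil 3 (dil 3 φ₋) ⊟ κ (+ 2) · (q^ 1 · (dil 3 Ω₊ ∔ dil 3 Ω₋))
    ≈⟨ ∔-cong (≈-trans (≈-sym (dil-∔ 3 _ _)) (dil-cong 3 (≈-sym (dil-∔ 3 _ _)))) (⊝-cong (·-congˡ (·-congˡ (≈-sym (dil-∔ 3 _ _))))) ⟩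
  dil 3 (dil 3 φ) ⊟ κ (+ 2) · (q^ 1 · dil 3 Ω) ∎
  where
  open ≈-Reasoning
  φ₊ φ₋ Ω₊ Ω₋ -q : Series
  φ₊ = Σ∞ (Θ₊ -𝟙 1 1)
  φ₋ = Σ∞ (Θ₋ -𝟙 1 1)
  Ω₊ = Σ∞ (Θ₊ -𝟙 5 1)
  Ω₋ = Σ∞ (Θ₋ -𝟙 5 1)
  -q = -𝟙 · q^ 1
  dil-Summable : ∀ {t} → Summable t → Summable (λ k → dil 3 (t k))
  dil-Summable o k = trans[] (dil-cong[] 3 (o k)) (≈⇒≈[] (dil-κ 3 (+ 0)))
  dil-term : ∀ k n → dil 3 (ε -𝟙 k · q^ n) ≈ ε -𝟙 k · q^ (n * 3)
  dil-term k n = ≈-trans (dil-· 3 (ε -𝟙 k) (q^ n)) (·-cong (dil-ε 3 k) (dil-q^ 3 n))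
  dil²-sum : ∀ t → Summable t → Σ∞ (λ k → dil 3 (dil 3 (t k))) ≈ dil 3 (dil 3 (Σ∞ t))
  dil²-sum t o = ≈-sym (≈-trans (dil-cong 3 (dil-Σ∞ 3 _ o)) (dil-Σ∞ 3 _ (dil-Summable o)))
  -q-sum : ∀ t → Summable t → Σ∞ (λ k → -q · dil 3 (t k)) ≈ -q · dil 3 (Σ∞ t)
  -q-sum t o = ≈-trans (Σ∞-·ˡ -q _ (dil-Summable o)) (·-congˡ (≈-sym (dil-Σ∞ 3 _ o)))
  term₀ : ∀ k n {l} → l ≡ n * 3 * 3 → ε -𝟙 (k * 3) · q^ l ≈ dil 3 (dil 3 (ε -𝟙 k · q^ n))
  term₀ k n e = ≈-trans (·-cong (ε-3 k) (q^≡ e)) (≈-sym (≈-trans (dil-cong 3 (dil-term k n)) (dil-term k (n * 3))))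
  term₁ : ∀ k n {l} → l ≡ 1 + n * 3 → ε -𝟙 (1 + k * 3) · q^ l ≈ -q · dil 3 (ε -𝟙 k · q^ n)
  term₁ k n e = ≈-trans (·-cong (·-congˡ (ε-3 k)) (≈-trans (q^≡ e) (q^-+ 1 (n * 3))))
    (≈-trans (solve 4 (λ a b c d → a :* b :* (c :* d) := a :* c :* (b :* d)) ≈-refl -𝟙 (ε -𝟙 k) (q^ 1) (q^ (n * 3)))
      (·-congˡ (≈-sym (dil-term k n))))
  term₂ : ∀ k n {l} → l ≡ 1 + n * 3 → ε -𝟙 (2 + k * 3) · q^ l ≈ -q · dil 3 (ε -𝟙 (suc k) · q^ n)
  term₂ k n e = ≈-trans (·-cong (·-congˡ (·-congˡ (ε-3 k))) (≈-trans (q^≡ e) (q^-+ 1 (n * 3))))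
    (≈-trans (solve 4 (λ a b c d → a :* b :* (c :* d) := a :* c :* (b :* d)) ≈-refl -𝟙 (ε -𝟙 (suc k)) (q^ 1) (q^ (n * 3)))
      (·-congˡ (≈-sym (dil-term (suc k) n))))
  p₀ : Σ∞ (λ k → Θ₊ -𝟙 1 1 (k * 3)) ≈ dil 3 (dil 3 φ₊)
  p₀ = ≈-trans (Σ∞-cong λ k → term₀ k _ (exponent₀ k)) (dil²-sum _ (Θ₊-Summable -𝟙 0 1))
  p₁ : Σ∞ (λ k → Θ₊ -𝟙 1 1 (1 + k * 3)) ≈ -q · dil 3 Ω₊
  p₁ = ≈-trans (Σ∞-cong λ k → term₁ k _ (exponent₁ k)) (-q-sum _ (Θ₊-Summable -𝟙 4 1))
  p₂ : Σ∞ (λ k → Θ₊ -𝟙 1 1 (2 + k * 3)) ≈ -q · dil 3 Ω₋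
  p₂ = ≈-trans (Σ∞-cong λ k → term₂ k _ (exponent₂ k)) (-q-sum _ (Θ₋-Summable -𝟙 5 0))
  p₃ : Σ∞ (λ k → Θ₋ -𝟙 1 1 (2 + k * 3)) ≈ dil 3 (dil 3 φ₋)
  p₃ = ≈-trans (Σ∞-cong λ k → term₀ (suc k) _ (exponent₀ (suc k))) (dil²-sum _ (Θ₋-Summable -𝟙 1 0))

-- Product formulas

f₁ f₂ E odds C : Series
f₁ = pr -𝟙 1 1
f₂ = pr -𝟙 2 2
E  = pr 𝟙 1 1
odds = pr -𝟙 1 2
C  = E · pr⁻¹ 1 1

f₁≈Of₂ : f₁ ≈ odds · f₂
f₁≈Of₂ = pr-split₂ -𝟙 1 0

Ef₁≈f₂ : E · f₁ ≈ f₂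
Ef₁≈f₂ = pr-± 1 0

f₁-unit : f₁ · pr⁻¹ 1 1 ≈ 𝟙
f₁-unit = pr-inverse 0 0

f₂-unit : f₂ · pr⁻¹ 2 2 ≈ 𝟙
f₂-unit = pr-inverse 1 1

-- Euler's identity between distinct and odd parts: `f₁` is `odds · f₂`, and `E · f₁` is `f₂`, so
-- the unit `f₂` cancels.
EO≈𝟙 : E · odds ≈ 𝟙
EO≈𝟙 = unit-cancelˡ f₂ f₂-unit (begin
  f₂ · (E · odds) ≈⟨ solve 3 (λ f e o → f :* (e :* o) := e :* (o :* f)) ≈-refl f₂ E odds ⟩
  E · (odds · f₂) ≈⟨ ·-congˡ f₁≈Of₂ ⟨
  E · f₁        ≈⟨ Ef₁≈f₂ ⟩
  f₂            ≈⟨ ·-identityʳ f₂ ⟨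
  f₂ · 𝟙        ∎)
  where open ≈-Reasoning

φ-product : φ ≈ f₂ · odds · odds
φ-product = jacobi-triple-product -𝟙 -𝟙² 0 0

-- Gauss's product for φ(-q). It turns every division by φ below into a multiplication by `C`.
φC≈𝟙 : φ · C ≈ 𝟙
φC≈𝟙 = begin
  φ · C                            ≈⟨ ·-congʳ φ-product ⟩
  f₂ · odds · odds · (E · pr⁻¹ 1 1)    ≈⟨ solve 4 (λ f o e i → f :* o :* o :* (e :* i) := e :* o :* (o :* f :* i)) ≈-refl f₂ odds E (pr⁻¹ 1 1) ⟩
  E · odds · (odds · f₂ · pr⁻¹ 1 1)    ≈⟨ ·-cong EO≈𝟙 (≈-trans (·-congʳ (≈-sym f₁≈Of₂)) f₁-unit) ⟩
  𝟙 · 𝟙                            ≈⟨ 𝟙² ⟩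
  𝟙                                ∎
  where open ≈-Reasoning

φf₂≈f₁² : φ · f₂ ≈ f₁ · f₁
φf₂≈f₁² = ≈-trans (·-congʳ φ-product) (≈-trans
  (solve 2 (λ f o → f :* o :* o :* f := o :* f :* (o :* f)) ≈-refl f₂ odds) (≈-sym (·-cong f₁≈Of₂ f₁≈Of₂)))

ψO≈f₂ : ψ · odds ≈ f₂
ψO≈f₂ = begin
  ψ · odds                                               ≈⟨ ·-congʳ (≈-trans ψ≈Θ (jacobi-triple-product 𝟙 𝟙² 2 0)) ⟩
  pr -𝟙 4 4 · pr 𝟙 3 4 · pr 𝟙 1 4 · odds                 ≈⟨ solve 4 (λ a b c o → a :* b :* c :* o := c :* b :* o :* a) ≈-refl _ _ _ _ ⟩
  pr 𝟙 1 4 · pr 𝟙 3 4 · odds · pr -𝟙 4 4                 ≈⟨ ·-congʳ (·-congʳ (pr-split₂ 𝟙 1 1)) ⟨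
  pr 𝟙 1 2 · odds · pr -𝟙 4 4                            ≈⟨ ·-congʳ (pr-± 1 1) ⟩
  pr -𝟙 2 4 · pr -𝟙 4 4                                ≈⟨ pr-split₂ -𝟙 2 1 ⟨
  f₂                                                   ∎
  where open ≈-Reasoning

ψφ≈f₁f₂ : ψ · φ ≈ f₁ · f₂
ψφ≈f₁f₂ = begin
  ψ · φ                  ≈⟨ ·-congˡ φ-product ⟩
  ψ · (f₂ · odds · odds)     ≈⟨ solve 3 (λ p f o → p :* (f :* o :* o) := o :* f :* (p :* o)) ≈-refl ψ f₂ odds ⟩
  odds · f₂ · (ψ · odds)     ≈⟨ ·-cong (≈-sym f₁≈Of₂) ψO≈f₂ ⟩
  f₁ · f₂                ∎
  where open ≈-Reasoning

-- Removing the factors with exponent divisible by 3 from (-q;q)(q;q²) = 1 leaves the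
-- product of the non-theta parts of A and Ω.
AΩ : A · Ω ≈ dil 3 (ψ · φ)
AΩ = begin
  A · Ω
    ≈⟨ ·-cong (jacobi-triple-product 𝟙 𝟙² 1 0) (jacobi-triple-product -𝟙 -𝟙² 4 0) ⟩
  pr -𝟙 3 3 · pr 𝟙 2 3 · pr 𝟙 1 3 · (pr -𝟙 6 6 · pr -𝟙 5 6 · pr -𝟙 1 6)
    ≈⟨ ≈-sym (·-identityʳ _) ⟩
  pr -𝟙 3 3 · pr 𝟙 2 3 · pr 𝟙 1 3 · (pr -𝟙 6 6 · pr -𝟙 5 6 · pr -𝟙 1 6) · 𝟙
    ≈⟨ ·-congˡ (≈-trans (≈-sym (dil-𝟙 3)) (≈-trans (dil-cong 3 (≈-sym EO≈𝟙)) (≈-trans (dil-· 3 E odds)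
         (·-cong (pr-dil 3 𝟙 1 0 (dil-𝟙 3)) (pr-dil 3 -𝟙 1 1 (dil--𝟙 3)))))) ⟩
  pr -𝟙 3 3 · pr 𝟙 2 3 · pr 𝟙 1 3 · (pr -𝟙 6 6 · pr -𝟙 5 6 · pr -𝟙 1 6) · (pr 𝟙 3 3 · pr -𝟙 3 6)
    ≈⟨ solve 8 (λ a b c d e f g h → a :* b :* c :* (d :* e :* f) :* (g :* h) := a :* d :* (c :* (b :* g) :* (f :* (h :* e)))) ≈-refl
         (pr -𝟙 3 3) (pr 𝟙 2 3) (pr 𝟙 1 3) (pr -𝟙 6 6) (pr -𝟙 5 6) (pr -𝟙 1 6) (pr 𝟙 3 3) (pr -𝟙 3 6) ⟩
  pr -𝟙 3 3 · pr -𝟙 6 6 · (pr 𝟙 1 3 · (pr 𝟙 2 3 · pr 𝟙 3 3) · (pr -𝟙 1 6 · (pr -𝟙 3 6 · pr -𝟙 5 6)))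
    ≈⟨ ·-congˡ (·-cong (pr-split₃ 𝟙 1 0) (pr-split₃ -𝟙 1 1)) ⟨
  pr -𝟙 3 3 · pr -𝟙 6 6 · (E · odds)
    ≈⟨ ≈-trans (·-congˡ EO≈𝟙) (·-identityʳ _) ⟩
  pr -𝟙 3 3 · pr -𝟙 6 6
    ≈⟨ ·-cong (pr-dil 3 -𝟙 1 0 (dil--𝟙 3)) (pr-dil 3 -𝟙 2 1 (dil--𝟙 3)) ⟨
  dil 3 f₁ · dil 3 f₂
    ≈⟨ dil-· 3 f₁ f₂ ⟨
  dil 3 (f₁ · f₂)
    ≈⟨ dil-cong 3 ψφ≈f₁f₂ ⟨
  dil 3 (ψ · φ) ∎
  where open ≈-Reasoning

-- Components modulo 3 of a product

private
  q : Series
  q = q^ 1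

  0<3 : 0 < 3
  0<3 = s≤s z≤n
  1<3 : 1 < 3
  1<3 = s≤s (s≤s z≤n)
  2<3 : 2 < 3
  2<3 = s≤s (s≤s (s≤s z≤n))

U-dissected : ∀ a b c → let f = dil 3 a ∔ (q^ 1 · dil 3 b ∔ q^ 1 · (q^ 1 · dil 3 c)) in
  ∀ r → r < 3 → U 3 r f ≈ U 3 r (dil 3 a) ∔ (U 3 r (q^ 1 · dil 3 b) ∔ U 3 r (q^ 1 · (q^ 1 · dil 3 c)))
U-dissected a b c r _ = ≈-trans (U-∔ 3 r _ _) (∔-congˡ (U-∔ 3 r _ _))

private
  module Shift (c : Series) where
    q0 : U 3 0 (q · dil 3 c) ≈ 𝟘
    q0 = ≈-trans (U-q·-zero 2 (dil 3 c)) (≈-trans (·-congˡ (U-dil-suc 3 1 c 2<3)) (·-zeroʳ q))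
    q1 : U 3 1 (q · dil 3 c) ≈ c
    q1 = ≈-trans (U-q·-suc 3 0 (dil 3 c)) (U-dil 3 c)
    q2 : U 3 2 (q · dil 3 c) ≈ 𝟘
    q2 = ≈-trans (U-q·-suc 3 1 (dil 3 c)) (U-dil-suc 3 0 c 1<3)
    qq0 : U 3 0 (q · (q · dil 3 c)) ≈ 𝟘
    qq0 = ≈-trans (U-q·-zero 2 _) (≈-trans (·-congˡ q2) (·-zeroʳ q))
    qq1 : U 3 1 (q · (q · dil 3 c)) ≈ 𝟘
    qq1 = ≈-trans (U-q·-suc 3 0 _) q0
    qq2 : U 3 2 (q · (q · dil 3 c)) ≈ c
    qq2 = ≈-trans (U-q·-suc 3 1 _) q1

module _ {f a b c : Series} (e : f ≈ dil 3 a ∔ (q^ 1 · dil 3 b ∔ q^ 1 · (q^ 1 · dil 3 c))) where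
  private
    module b = Shift b
    module c = Shift c
    part : ∀ r {x y z} → r < 3 → U 3 r (dil 3 a) ≈ x → U 3 r (q · dil 3 b) ≈ y → U 3 r (q · (q · dil 3 c)) ≈ z → U 3 r f ≈ x ∔ (y ∔ z)
    part r l x y z = ≈-trans (U-cong 3 r e) (≈-trans (U-dissected a b c r l) (∔-cong x (∔-cong y z)))

  U₀-of : U 3 0 f ≈ a
  U₀-of = ≈-trans (part 0 0<3 (U-dil 3 a) b.q0 c.qq0) (solve 1 (λ a → a :+ (con (+ 0) :+ con (+ 0)) := a) ≈-refl a)
  U₁-of : U 3 1 f ≈ b
  U₁-of = ≈-trans (part 1 1<3 (U-dil-suc 3 0 a 1<3) b.q1 c.qq1) (solve 1 (λ a → con (+ 0) :+ (a :+ con (+ 0)) := a) ≈-refl b)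
  U₂-of : U 3 2 f ≈ c
  U₂-of = ≈-trans (part 2 2<3 (U-dil-suc 3 1 a 2<3) b.q2 c.qq2) (solve 1 (λ a → con (+ 0) :+ (con (+ 0) :+ a) := a) ≈-refl c)

dissection : ∀ f → f ≈ dil 3 (U 3 0 f) ∔ (q^ 1 · dil 3 (U 3 1 f) ∔ q^ 1 · (q^ 1 · dil 3 (U 3 2 f)))
dissection f = U-ext 3 λ
  { 0 _ → ≈-sym (U₀-of ≈-refl)
  ; 1 _ → ≈-sym (U₁-of ≈-refl)
  ; 2 _ → ≈-sym (U₂-of ≈-refl)
  ; (suc (suc (suc r))) (s≤s (s≤s (s≤s ()))) }

private
  -- Multiplication in the basis 1, q, q² over series in q³; the factors q inside `dil 3` are the
  -- carries from q³ and q⁴.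
  product-dissection : ∀ f g → let a = U 3 0 f; b = U 3 1 f; c = U 3 2 f; a′ = U 3 0 g; b′ = U 3 1 g; c′ = U 3 2 g in
    f · g ≈ dil 3 (a · a′ ∔ q · (b · c′ ∔ c · b′)) ∔ (q · dil 3 (a · b′ ∔ b · a′ ∔ q · (c · c′)) ∔ q · (q · dil 3 (a · c′ ∔ b · b′ ∔ c · a′)))
  product-dissection f g = begin
    f · g
      ≈⟨ ·-cong (dissection f) (dissection g) ⟩
    (a ∔ (q · b ∔ q · (q · c))) · (a′ ∔ (q · b′ ∔ q · (q · c′)))
      ≈⟨ solve 7 (λ q a b c a′ b′ c′ → (a :+ (q :* b :+ q :* (q :* c))) :* (a′ :+ (q :* b′ :+ q :* (q :* c′))) :=
            (a :* a′ :+ q :* (q :* q) :* (b :* c′ :+ c :* b′)) :+ (q :* (a :* b′ :+ b :* a′ :+ q :* (q :* q) :* (c :* c′)) :+ q :* (q :* (a :* c′ :+ b :* b′ :+ c :* a′))))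
            ≈-refl q a b c a′ b′ c′ ⟩
    (a · a′ ∔ q · (q · q) · (b · c′ ∔ c · b′)) ∔ (q · (a · b′ ∔ b · a′ ∔ q · (q · q) · (c · c′)) ∔ q · (q · (a · c′ ∔ b · b′ ∔ c · a′)))
      ≈⟨ ∔-cong (∔-cong (m f₀ g₀) (≈-trans (·-cong q³ (∔-cong (m f¹ g₂) (m f² g₁))) (≈-trans (·-congˡ (p _ _)) (m q _))))
           (∔-cong (·-congˡ (∔-cong (∔-cong (m f₀ g₁) (m f¹ g₀)) (≈-trans (·-cong q³ (m f² g₂)) (m q _))))
                   (·-congˡ (·-congˡ (≈-trans (∔-cong (≈-trans (∔-cong (m f₀ g₂) (m f¹ g₁)) (p _ _)) (m f² g₀)) (p _ _))))) ⟩
    _ ≈⟨ ∔-cong (p _ _) (∔-congʳ (·-congˡ (≈-trans (∔-congʳ (p _ _)) (p _ _)))) ⟩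
    _ ∎
    where
    open ≈-Reasoning
    f₀ = U 3 0 f
    f¹ = U 3 1 f
    f² = U 3 2 f
    g₀ = U 3 0 g
    g₁ = U 3 1 g
    g₂ = U 3 2 g
    a = dil 3 f₀
    b = dil 3 f¹
    c = dil 3 f²
    a′ = dil 3 g₀
    b′ = dil 3 g₁
    c′ = dil 3 g₂
    m : ∀ x y → dil 3 x · dil 3 y ≈ dil 3 (x · y)
    m x y = ≈-sym (dil-· 3 x y)
    p : ∀ x y → dil 3 x ∔ dil 3 y ≈ dil 3 (x ∔ y)
    p x y = ≈-sym (dil-∔ 3 x y)
    q³ : q · (q · q) ≈ dil 3 q
    q³ = ≈-trans (·-congˡ (≈-sym (q^-+ 1 1))) (≈-trans (≈-sym (q^-+ 1 2)) (≈-sym (dil-q^ 3 1)))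

-- 𝒩 f is the norm f(q) f(ωq) f(ω²q), ω a cube root of unity, written as a series in q³ → q.

norm₃ : Series → Series → Series → Series
norm₃ a b c = a · a · a ∔ q^ 1 · (b · b · b) ∔ q^ 1 · q^ 1 · (c · c · c) ⊟ κ (+ 3) · (q^ 1 · (a · b · c))

𝒩 : Series → Series
𝒩 f = norm₃ (U 3 0 f) (U 3 1 f) (U 3 2 f)

norm₃-cong : ∀ {a b c a′ b′ c′} → a ≈ a′ → b ≈ b′ → c ≈ c′ → norm₃ a b c ≈ norm₃ a′ b′ c′
norm₃-cong x y z = ∔-cong (∔-cong (∔-cong (·-cong (·-cong x x) x) (·-congˡ (·-cong (·-cong y y) y))) (·-congˡ (·-cong (·-cong z z) z)))
  (⊝-cong (·-congˡ (·-congˡ (·-cong (·-cong x y) z))))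

𝒩-cong : f ≈ g → 𝒩 f ≈ 𝒩 g
𝒩-cong e = norm₃-cong (U-cong 3 0 e) (U-cong 3 1 e) (U-cong 3 2 e)

U₂-· : ∀ f g → U 3 2 (f · g) ≈ U 3 0 f · U 3 2 g ∔ U 3 1 f · U 3 1 g ∔ U 3 2 f · U 3 0 g
U₂-· f g = U₂-of (product-dissection f g)

-- The norm form of adjoining a cube root of q is multiplicative. As a polynomial identity in seven
-- variables it is checked by the solver, in place of a factorisation over ω.
𝒩-· : ∀ f g → 𝒩 (f · g) ≈ 𝒩 f · 𝒩 g
𝒩-· f g = ≈-trans (norm₃-cong (U₀-of e) (U₁-of e) (U₂-of e))
  (solve 7 (λ q a b c d e f → n q (a :* d :+ q :* (b :* f :+ c :* e)) (a :* e :+ b :* d :+ q :* (c :* f)) (a :* f :+ b :* e :+ c :* d) := n q a b c :* n q d e f) ≈-refl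
    q (U 3 0 f) (U 3 1 f) (U 3 2 f) (U 3 0 g) (U 3 1 g) (U 3 2 g))
  where
  e = product-dissection f g
  n : ∀ {k} → (q a b c : Ring.Polynomial k) → Ring.Polynomial k
  n q a b c = a :* a :* a :+ q :* (b :* b :* b) :+ q :* q :* (c :* c :* c) :- con (+ 3) :* (q :* (a :* b :* c))

𝒩-cong[] : f ≈[ K * 3 ] g → 𝒩 f ≈[ K ] 𝒩 g
𝒩-cong[] {f} {K} {g} e = ∔-cong[] (∔-cong[] (∔-cong[] (cube (u 0 0<3)) (·-congˡ[] (cube (u 1 1<3)))) (·-congˡ[] (cube (u 2 2<3))))
  (⊝-cong[] (·-congˡ[] (·-congˡ[] (·-cong[] (·-cong[] (u 0 0<3) (u 1 1<3)) (u 2 2<3)))))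
  where
  cube : ∀ {a b} → a ≈[ K ] b → a · a · a ≈[ K ] b · b · b
  cube e = ·-cong[] (·-cong[] e e) e
  ⊝-cong[] : ∀ {a b} → a ≈[ K ] b → ⊝ a ≈[ K ] ⊝ b
  ⊝-cong[] {a} {b} e = mk[] λ n l → ≡.trans (at-⊝ a n) (≡.trans (≡.cong ℤ.-_ (at< e n l)) (≡.sym (at-⊝ b n)))
  u : ∀ r → r < 3 → U 3 r f ≈[ K ] U 3 r g
  u r r<3 = mk[] λ n l → ≡.trans (at-U 3 r f n) (≡.trans (at< e (r + n * 3)
    (ℕₚ.≤-trans (ℕₚ.+-monoˡ-≤ (n * 3) r<3) (ℕₚ.*-monoˡ-≤ 3 l))) (≡.sym (at-U 3 r g n)))

𝒩-𝟙 : 𝒩 𝟙 ≈ 𝟙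
𝒩-𝟙 = ≈-trans (norm₃-cong (U₀-of e) (U₁-of e) (U₂-of e))
  (solve 1 (λ q → con (+ 1) :* con (+ 1) :* con (+ 1) :+ q :* (con (+ 0) :* con (+ 0) :* con (+ 0)) :+ q :* q :* (con (+ 0) :* con (+ 0) :* con (+ 0)) :- con (+ 3) :* (q :* (con (+ 1) :* con (+ 0) :* con (+ 0))) := con (+ 1)) ≈-refl q)
  where
  e : 𝟙 ≈ dil 3 𝟙 ∔ (q · dil 3 𝟘 ∔ q · (q · dil 3 𝟘))
  e = ≈-sym (≈-trans (∔-cong (dil-𝟙 3) (∔-cong (·-congˡ (dil-κ 3 (+ 0))) (·-congˡ (·-congˡ (dil-κ 3 (+ 0))))))
    (solve 1 (λ q → con (+ 1) :+ (q :* con (+ 0) :+ q :* (q :* con (+ 0))) := con (+ 1)) ≈-refl q))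

𝒩-dil : ∀ h → 𝒩 (dil 3 h) ≈ h · h · h
𝒩-dil h = ≈-trans (norm₃-cong (U-dil 3 h) (U-dil-suc 3 0 h 1<3) (U-dil-suc 3 1 h 2<3))
  (solve 2 (λ q h → h :* h :* h :+ q :* (con (+ 0) :* con (+ 0) :* con (+ 0)) :+ q :* q :* (con (+ 0) :* con (+ 0) :* con (+ 0)) :- con (+ 3) :* (q :* (h :* con (+ 0) :* con (+ 0))) := h :* h :* h) ≈-refl q h)

𝒩-∏ : ∀ n → (∀ k → 𝒩 (t k) ≈ t k) → 𝒩 (∏ n t) ≈ ∏ n t
𝒩-∏ zero    e = 𝒩-𝟙
𝒩-∏ {t} (suc n) e = ≈-trans (𝒩-· (∏ n t) (t n)) (·-cong (𝒩-∏ n e) (e n))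

𝒩-∏∞ : Multipliable t → (∀ k → 𝒩 (t k) ≈ t k) → 𝒩 (∏∞ t) ≈ ∏∞ t
𝒩-∏∞ {t} o e = ≈[]⇒≈ λ M → trans[] (𝒩-cong[] (sym[] (∏∞-⟶ o (M * 3))))
  (trans[] (≈⇒≈[] (𝒩-∏ (M * 3) e)) (weaken (ℕₚ.m≤m*n M 3) (∏∞-⟶ o (M * 3))))

private
  cube-q^ : ∀ i → q^ i · q^ i · q^ i ≈ q^ (i * 3)
  cube-q^ i = ≈-trans (·-congʳ (≈-sym (q^-+ i i))) (≈-trans (≈-sym (q^-+ (i + i) i)) (q^≡ (lemma i)))
    where
    lemma : ∀ i → i + i + i ≡ i * 3
    lemma = solve-∀

-- When 3 does not divide n, the three conjugates 1 - ω^(jn) q^n multiply to 1 - q^(3n), which is 1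
-- - q^n after q³ → q. Classes 1 and 2 are separate because the term sits in a different component.
𝒩-fixed₁ : ∀ i {n} → n ≡ 1 + i * 3 → 𝒩 (𝟙 ∔ -𝟙 · q^ n) ≈ 𝟙 ∔ -𝟙 · q^ n
𝒩-fixed₁ i {n} eq = begin
  𝒩 (𝟙 ∔ -𝟙 · q^ n)          ≈⟨ norm₃-cong (U₀-of e) (U₁-of e) (U₂-of e) ⟩
  norm₃ 𝟙 (⊝ q^ i) 𝟘         ≈⟨ solve 2 (λ q x → con (+ 1) :* con (+ 1) :* con (+ 1) :+ q :* ((:- x) :* (:- x) :* (:- x)) :+ q :* q :* (con (+ 0) :* con (+ 0) :* con (+ 0)) :- con (+ 3) :* (q :* (con (+ 1) :* (:- x) :* con (+ 0)))
                                   := con (+ 1) :+ (:- con (+ 1)) :* (q :* (x :* x :* x))) ≈-refl q (q^ i) ⟩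
  𝟙 ∔ -𝟙 · (q · (q^ i · q^ i · q^ i)) ≈⟨ ∔-congˡ (·-congˡ (≈-trans (·-congˡ (cube-q^ i)) (≈-trans (≈-sym (q^-+ 1 (i * 3))) (q^≡ (≡.sym eq))))) ⟩
  𝟙 ∔ -𝟙 · q^ n              ∎
  where
  open ≈-Reasoning
  e : 𝟙 ∔ -𝟙 · q^ n ≈ dil 3 𝟙 ∔ (q · dil 3 (⊝ q^ i) ∔ q · (q · dil 3 𝟘))
  e = ≈-sym (≈-trans (∔-cong (dil-𝟙 3) (∔-cong (·-congˡ (≈-trans (dil-⊝ 3 (q^ i)) (⊝-cong (dil-q^ 3 i)))) (·-congˡ (·-congˡ (dil-κ 3 (+ 0))))))
    (≈-trans (solve 2 (λ q x → con (+ 1) :+ (q :* (:- x) :+ q :* (q :* con (+ 0))) := con (+ 1) :+ (:- con (+ 1)) :* (q :* x)) ≈-refl q (q^ (i * 3)))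
      (∔-congˡ (·-congˡ (≈-trans (≈-sym (q^-+ 1 (i * 3))) (q^≡ (≡.sym eq)))))))

𝒩-fixed₂ : ∀ i {n} → n ≡ 2 + i * 3 → 𝒩 (𝟙 ∔ -𝟙 · q^ n) ≈ 𝟙 ∔ -𝟙 · q^ n
𝒩-fixed₂ i {n} eq = begin
  𝒩 (𝟙 ∔ -𝟙 · q^ n)          ≈⟨ norm₃-cong (U₀-of e) (U₁-of e) (U₂-of e) ⟩
  norm₃ 𝟙 𝟘 (⊝ q^ i)         ≈⟨ solve 2 (λ q x → con (+ 1) :* con (+ 1) :* con (+ 1) :+ q :* (con (+ 0) :* con (+ 0) :* con (+ 0)) :+ q :* q :* ((:- x) :* (:- x) :* (:- x)) :- con (+ 3) :* (q :* (con (+ 1) :* con (+ 0) :* (:- x)))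
                                   := con (+ 1) :+ (:- con (+ 1)) :* (q :* (q :* (x :* x :* x)))) ≈-refl q (q^ i) ⟩
  𝟙 ∔ -𝟙 · (q · (q · (q^ i · q^ i · q^ i))) ≈⟨ ∔-congˡ (·-congˡ (≈-trans (·-congˡ (·-congˡ (cube-q^ i))) shift)) ⟩
  𝟙 ∔ -𝟙 · q^ n              ∎
  where
  open ≈-Reasoning
  shift : q · (q · q^ (i * 3)) ≈ q^ n
  shift = ≈-trans (·-congˡ (≈-sym (q^-+ 1 (i * 3)))) (≈-trans (≈-sym (q^-+ 1 (1 + i * 3))) (q^≡ (≡.sym eq)))
  e : 𝟙 ∔ -𝟙 · q^ n ≈ dil 3 𝟙 ∔ (q · dil 3 𝟘 ∔ q · (q · dil 3 (⊝ q^ i)))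
  e = ≈-sym (≈-trans (∔-cong (dil-𝟙 3) (∔-cong (·-congˡ (dil-κ 3 (+ 0))) (·-congˡ (·-congˡ (≈-trans (dil-⊝ 3 (q^ i)) (⊝-cong (dil-q^ 3 i)))))))
    (≈-trans (solve 2 (λ q x → con (+ 1) :+ (q :* con (+ 0) :+ q :* (q :* (:- x))) := con (+ 1) :+ (:- con (+ 1)) :* (q :* (q :* x))) ≈-refl q (q^ (i * 3)))
      (∔-congˡ (·-congˡ shift))))

x⁴ : Series → Series
x⁴ x = x · x · x · x

x⁴-cong : f ≈ g → x⁴ f ≈ x⁴ g
x⁴-cong e = ·-cong (·-cong (·-cong e e) e) e

x⁴-𝟙 : f ≈ 𝟙 → x⁴ f ≈ 𝟙
x⁴-𝟙 e = ≈-trans (x⁴-cong e) (solve 0 (con (+ 1) :* con (+ 1) :* con (+ 1) :* con (+ 1) := con (+ 1)) ≈-refl)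

private
  fo : ∀ {k} → Ring.Polynomial k → Ring.Polynomial k
  fo a = a :* a :* a :* a

  -- The factors prime to 3 are fixed by the norm, and f(q³) has norm f³; hence 𝒩 f = a b f³ with a
  -- b = f/f(q³).
  norm-of : ∀ {f a b} → f ≈ a · (b · dil 3 f) → 𝒩 a ≈ a → 𝒩 b ≈ b → 𝒩 f · dil 3 f ≈ x⁴ f
  norm-of {f} {a} {b} e na nb = begin
    𝒩 f · dil 3 f                          ≈⟨ ·-congʳ (≈-trans (𝒩-cong e) (≈-trans (𝒩-· a _) (·-cong na (≈-trans (𝒩-· b _) (·-cong nb (𝒩-dil f)))))) ⟩
    a · (b · (f · f · f)) · dil 3 f        ≈⟨ solve 4 (λ a b f d → a :* (b :* (f :* f :* f)) :* d := a :* (b :* d) :* f :* f :* f) ≈-refl a b f (dil 3 f) ⟩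
    a · (b · dil 3 f) · f · f · f          ≈⟨ ·-congʳ (·-congʳ (·-congʳ (≈-sym e))) ⟩
    f · f · f · f                          ∎
    where open ≈-Reasoning

𝒩f₁ : 𝒩 f₁ · dil 3 f₁ ≈ f₁ · f₁ · f₁ · f₁
𝒩f₁ = norm-of (≈-trans (pr-split₃ -𝟙 1 0) (·-congˡ (·-congˡ (≈-sym (pr-dil 3 -𝟙 1 0 (dil--𝟙 3))))))
  (𝒩-∏∞ (pr-Multipliable -𝟙 1 2) (λ k → 𝒩-fixed₁ k ≡.refl))
  (𝒩-∏∞ (pr-Multipliable -𝟙 2 2) (λ k → 𝒩-fixed₂ k ≡.refl))

𝒩f₂ : 𝒩 f₂ · dil 3 f₂ ≈ f₂ · f₂ · f₂ · f₂
𝒩f₂ = norm-of (≈-trans (pr-split₃ -𝟙 2 1) (·-congˡ (·-congˡ (≈-sym (pr-dil 3 -𝟙 2 1 (dil--𝟙 3))))))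
  (𝒩-∏∞ (pr-Multipliable -𝟙 2 5) (λ k → 𝒩-fixed₂ (k * 2) (lemma₂ k)))
  (𝒩-∏∞ (pr-Multipliable -𝟙 4 5) (λ k → 𝒩-fixed₁ (1 + k * 2) (lemma₁ k)))
  where
  lemma₂ : ∀ k → 2 + k * 6 ≡ 2 + k * 2 * 3
  lemma₂ = solve-∀
  lemma₁ : ∀ k → 4 + k * 6 ≡ 1 + (1 + k * 2) * 3
  lemma₁ = solve-∀

-- φ(-q) = f₁²/f₂, and the relation 𝒩 f · f(q³) = f⁴ is multiplicative in f, so it descends to the
-- quotient. The division is carried out by cancelling `unit`, made of the powers of `f₂` and f₁(q³)
-- that occur.
𝒩φ : 𝒩 φ · dil 3 φ ≈ φ · φ · φ · φ
𝒩φ = unit-cancelˡ unit (≈-trans (solve 4 (λ b x A y → fo b :* (A :* A) :* (fo x :* (y :* y)) := fo (b :* x) :* (A :* y :* (A :* y))) ≈-refl f₂ (pr⁻¹ 2 2) A₁ (pr⁻¹ 3 3))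
    (≈-trans (·-cong (x⁴-𝟙 f₂-unit) (≈-trans (·-cong A-unit A-unit) 𝟙²)) 𝟙²)) (begin
  x⁴ f₂ · (A₁ · A₁) · (𝒩 φ · dil 3 φ)
    ≈⟨ ·-congʳ (·-congʳ 𝒩f₂) ⟨
  𝒩 f₂ · dil 3 f₂ · (A₁ · A₁) · (𝒩 φ · dil 3 φ)
    ≈⟨ solve 5 (λ nb B A nc Cc → nb :* B :* (A :* A) :* (nc :* Cc) := nc :* nb :* (Cc :* B) :* (A :* A)) ≈-refl (𝒩 f₂) (dil 3 f₂) A₁ (𝒩 φ) (dil 3 φ) ⟩
  𝒩 φ · 𝒩 f₂ · (dil 3 φ · dil 3 f₂) · (A₁ · A₁)
    ≈⟨ ·-congʳ (·-cong (≈-trans (≈-sym (𝒩-· φ f₂)) (≈-trans (𝒩-cong φf₂≈f₁²) (𝒩-· f₁ f₁)))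
         (≈-trans (≈-sym (dil-· 3 φ f₂)) (≈-trans (dil-cong 3 φf₂≈f₁²) (dil-· 3 f₁ f₁)))) ⟩
  𝒩 f₁ · 𝒩 f₁ · (A₁ · A₁) · (A₁ · A₁)
    ≈⟨ solve 2 (λ n A → n :* n :* (A :* A) :* (A :* A) := n :* A :* (n :* A) :* (A :* A)) ≈-refl (𝒩 f₁) A₁ ⟩
  𝒩 f₁ · A₁ · (𝒩 f₁ · A₁) · (A₁ · A₁)
    ≈⟨ ·-congʳ (·-cong 𝒩f₁ 𝒩f₁) ⟩
  x⁴ f₁ · x⁴ f₁ · (A₁ · A₁)
    ≈⟨ solve 2 (λ a A → fo a :* fo a :* (A :* A) := fo (a :* a) :* (A :* A)) ≈-refl f₁ A₁ ⟩
  x⁴ (f₁ · f₁) · (A₁ · A₁)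
    ≈⟨ ·-congʳ (x⁴-cong φf₂≈f₁²) ⟨
  x⁴ (φ · f₂) · (A₁ · A₁)
    ≈⟨ solve 3 (λ c b A → fo (c :* b) :* (A :* A) := fo b :* (A :* A) :* fo c) ≈-refl φ f₂ A₁ ⟩
  x⁴ f₂ · (A₁ · A₁) · x⁴ φ ∎)
  where
  open ≈-Reasoning
  A₁ = dil 3 f₁
  unit = x⁴ f₂ · (A₁ · A₁)
  A-unit : A₁ · pr⁻¹ 3 3 ≈ 𝟙
  A-unit = ≈-trans (·-congʳ (pr-dil 3 -𝟙 1 0 (dil--𝟙 3))) (pr-inverse 2 2)

private
  φ-dissected : φ ≈ dil 3 (dil 3 φ) ∔ (q · dil 3 (⊝ (κ (+ 2) · Ω)) ∔ q · (q · dil 3 𝟘))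
  φ-dissected = ≈-trans φ-dissection (≈-trans
    (solve 3 (λ d q w → d :- con (+ 2) :* (q :* w) := d :+ (q :* (:- (con (+ 2) :* w)) :+ q :* (q :* con (+ 0)))) ≈-refl (dil 3 (dil 3 φ)) q (dil 3 Ω))
    (∔-congˡ (∔-cong (·-congˡ (≈-sym (≈-trans (dil-⊝ 3 _) (⊝-cong (≈-trans (dil-· 3 (κ (+ 2)) Ω) (·-congʳ (dil-κ 3 (+ 2)))))))) (·-congˡ (·-congˡ (≈-sym (dil-κ 3 (+ 0))))))))

U₀φ : U 3 0 φ ≈ dil 3 φ
U₀φ = U₀-of φ-dissected

U₁φ : U 3 1 φ ≈ ⊝ (κ (+ 2) · Ω)
U₁φ = U₁-of φ-dissected

U₂φ : U 3 2 φ ≈ 𝟘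
U₂φ = U₂-of φ-dissected

-- The norm of φ evaluated a second time, now on its 3-dissection, where only two components
-- survive; 8 is the cube of the coefficient 2.
φ⁴ : φ · φ · φ · φ ≈ (dil 3 φ · dil 3 φ · dil 3 φ ⊟ κ (+ 8) · (q^ 1 · (Ω · Ω · Ω))) · dil 3 φ
φ⁴ = ≈-trans (≈-sym 𝒩φ) (·-congʳ (≈-trans (norm₃-cong U₀φ U₁φ U₂φ)
  (solve 3 (λ q a w → a :* a :* a :+ q :* ((:- (con (+ 2) :* w)) :* (:- (con (+ 2) :* w)) :* (:- (con (+ 2) :* w))) :+ q :* q :* (con (+ 0) :* con (+ 0) :* con (+ 0)) :- con (+ 3) :* (q :* (a :* (:- (con (+ 2) :* w)) :* con (+ 0)))
     := a :* a :* a :- con (+ 8) :* (q :* (w :* w :* w))) ≈-refl q (dil 3 φ) Ω)))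

geom-double : ∀ d → .{{NonZero d}} → geom d ≈ (𝟙 ∔ q^ d) · geom (d * 2)
geom-double d@(suc _) = inverse-unique (≈-trans (·-comm _ _) (geom-inverse d)) (begin
  (𝟙 ⊟ q^ d) · ((𝟙 ∔ q^ d) · geom (d * 2))   ≈⟨ solve 2 (λ x g → (con (+ 1) :- x) :* ((con (+ 1) :+ x) :* g) := g :* (con (+ 1) :- x :* x)) ≈-refl (q^ d) (geom (d * 2)) ⟩
  geom (d * 2) · (𝟙 ⊟ q^ d · q^ d)           ≈⟨ ·-congˡ (∔-congˡ (⊝-cong (≈-trans (≈-sym (q^-+ d d)) (q^≡ (lemma d))))) ⟩
  geom (d * 2) · (𝟙 ⊟ q^ (d * 2))            ≈⟨ geom-inverse (d * 2) ⟩
  𝟙                                          ∎)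
  where
  open ≈-Reasoning
  lemma : ∀ d → d + d ≡ d * 2
  lemma = solve-∀

dil-geom : ∀ c .{{_ : NonZero c}} d .{{_ : NonZero d}} → dil c (geom d) ≈ geom (d * c)
dil-geom c@(suc _) d@(suc _) = inverse-unique {f = 𝟙 ⊟ q^ (d * c)}
  (begin
    (𝟙 ⊟ q^ (d * c)) · dil c (geom d)   ≈⟨ ·-congʳ (≈-trans (dil-⊟ c 𝟙 (q^ d)) (∔-cong (dil-𝟙 c) (⊝-cong (dil-q^ c d)))) ⟨
    dil c (𝟙 ⊟ q^ d) · dil c (geom d)   ≈⟨ dil-· c _ _ ⟨
    dil c ((𝟙 ⊟ q^ d) · geom d)         ≈⟨ dil-cong c (≈-trans (·-comm _ _) (geom-inverse d)) ⟩
    dil c 𝟙                             ≈⟨ dil-𝟙 c ⟩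
    𝟙                                   ∎)
  (≈-trans (·-comm _ _) (geom-inverse (d * c)))
  where open ≈-Reasoning

-- A partial fraction expansion of 1/(q;q²)²_{N+1}

τ : ℕ → Series
τ k = q^ (1 + k * 2)

lambert : ℕ → Series
lambert k = (𝟙 ∔ τ k) · geom (1 + k * 2)

lerch : ℕ → Series
lerch k = ε -𝟙 k · q^ (T (suc k) * 2) · lambert k

-- This is 1/((q²;q²)_{N-k} (q²;q²)_{N+k+1}), read as 0 for k > N: up to a constant factor, the
-- weight of Bailey pairs with base q² and a = q².
kernel : ℕ → ℕ → Series
kernel N k = iq 2 N k · ip 2 (suc (N + k))

lerch-Summable : Summable lerch
lerch-Summable k = O-·ˡ k (O-·ʳ k (weaken (ℕₚ.≤-trans (ℕₚ.m≤m+n k (T k)) (ℕₚ.m≤m*n (T (suc k)) 2)) (O-q^ (T (suc k) * 2))))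

private
  module PartialFractions (N′ : ℕ) where
    N = suc N′

    -- `d` is the error when (1 - X)² times the sum at level N is compared with level `N′`. `W` is a
    -- telescoping certificate for (1 - q^(2N)) `d`, built with the factors 1 - q^(2k) and
    -- `iq 2 N k` that make it vanish at both ends.
    y d W : ℕ → Series
    y k = q^ ((N ∸ k) * 2)
    d k = ε -𝟙 k · q^ (T (suc k) * 2) · (y k ⊟ y k · (τ k · τ k)) · kernel N k
    W k = ⊝ (ε -𝟙 k · q^ (T k * 2) · q^ (N * 2) · (𝟙 ⊟ q^ (k * 2)) · (iq 2 N k · ip 2 (N + k)))

    X : Series
    X = q^ (1 + N * 2)

    module _ (k : ℕ) (k≤N : k ≤ N) where
      N-k+k : N ∸ k + k ≡ N
      N-k+k = ℕₚ.m∸n+n≡m k≤N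

      yt : y k · τ k ≈ X
      yt = ≈-trans (≈-sym (q^-+ ((N ∸ k) * 2) (1 + k * 2))) (q^≡ (≡.trans (lemma (N ∸ k) k) (≡.cong (λ z → 1 + z * 2) N-k+k)))
        where
        lemma : ∀ i k → i * 2 + (1 + k * 2) ≡ 1 + (i + k) * 2
        lemma = solve-∀

      ytt : y k · (τ k · τ k) ≈ q^ (suc (N + k) * 2)
      ytt = ≈-trans (≈-trans (≈-sym (·-assoc (y k) (τ k) (τ k))) (·-congʳ yt)) (≈-trans (≈-sym (q^-+ (1 + N * 2) (1 + k * 2))) (q^≡ (lemma N k)))
        where
        lemma : ∀ N k → 1 + N * 2 + (1 + k * 2) ≡ suc (N + k) * 2
        lemma = solve-∀

      yc : y k · q^ (k * 2) ≈ q^ (N * 2)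
      yc = ≈-trans (≈-sym (q^-+ ((N ∸ k) * 2) (k * 2))) (q^≡ (≡.trans (≡.sym (ℕₚ.*-distribʳ-+ 2 (N ∸ k) k)) (≡.cong (_* 2) N-k+k)))

      iq′ : iq 2 N (suc k) ≈ (𝟙 ⊟ y k) · iq 2 N k
      iq′ = iq-step 2 N k

      ip′ : ip 2 (N + k) ≈ (𝟙 ⊟ y k · (τ k · τ k)) · ip 2 (suc (N + k))
      ip′ = ≈-trans (ip-step 2 (N + k)) (·-congʳ (∔-congˡ (⊝-cong (≈-sym ytt))))

      tt : τ k · τ k ≈ q^ 2 · (q^ (k * 2) · q^ (k * 2))
      tt = ≈-trans (≈-sym (q^-+ (1 + k * 2) (1 + k * 2))) (≈-trans (q^≡ (lemma k)) (≈-trans (q^-+ 2 _) (·-congˡ (q^-+ (k * 2) (k * 2)))))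
        where
        lemma : ∀ k → 1 + k * 2 + (1 + k * 2) ≡ 2 + (k * 2 + k * 2)
        lemma = solve-∀

      -- Since X = yτ, (1 - yτ)² = (1 - y)(1 - yτ²) + y(1 - τ)². The first product lowers both
      -- q-factorials of `kernel` by one level; in the second, one factor 1 - τ cancels the
      -- denominator of `lambert`.
      term : (𝟙 ⊟ X) · (𝟙 ⊟ X) · (lerch k · kernel N k) ≈ lerch k · kernel N′ k ∔ d k
      term = begin
        (𝟙 ⊟ X) · (𝟙 ⊟ X) · (lerch k · kernel N k)
          ≈⟨ ·-congʳ (·-cong (∔-congˡ (⊝-cong yt)) (∔-congˡ (⊝-cong yt))) ⟨
        (𝟙 ⊟ y k · τ k) · (𝟙 ⊟ y k · τ k) · (lerch k · kernel N k)
          ≈⟨ solve 7 (λ y t s r g u v →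
               (con (+ 1) :- y :* t) :* (con (+ 1) :- y :* t) :* (s :* r :* ((con (+ 1) :+ t) :* g) :* (u :* v))
               := s :* r :* ((con (+ 1) :+ t) :* g) :* ((con (+ 1) :- y) :* u :* ((con (+ 1) :- y :* (t :* t)) :* v))
                  :+ s :* r :* ((con (+ 1) :+ t) :* (con (+ 1) :- t) :* y :* (g :* (con (+ 1) :- t))) :* (u :* v)) ≈-refl
               (y k) (τ k) (ε -𝟙 k) (q^ (T (suc k) * 2)) (geom (1 + k * 2)) (iq 2 N k) (ip 2 (suc (N + k))) ⟩
        lerch k · ((𝟙 ⊟ y k) · iq 2 N k · ((𝟙 ⊟ y k · (τ k · τ k)) · ip 2 (suc (N + k))))
          ∔ ε -𝟙 k · q^ (T (suc k) * 2) · ((𝟙 ∔ τ k) · (𝟙 ⊟ τ k) · y k · (geom (1 + k * 2) · (𝟙 ⊟ τ k))) · kernel N k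
          ≈⟨ ∔-cong (·-congˡ (·-cong (≈-sym iq′) (≈-sym ip′)))
               (·-congʳ (·-congˡ (≈-trans (·-congˡ (geom-inverse (1 + k * 2)))
                 (solve 2 (λ y t → (con (+ 1) :+ t) :* (con (+ 1) :- t) :* y :* con (+ 1) := y :- y :* (t :* t)) ≈-refl (y k) (τ k))))) ⟩
        lerch k · kernel N′ k ∔ d k ∎
        where open ≈-Reasoning

      W-step : W (suc k) ≈ W k ∔ (𝟙 ⊟ q^ (N * 2)) · d k
      W-step = begin
        W (suc k)
          ≈⟨ ⊝-cong (·-cong (·-cong (·-cong (·-congˡ r≈) (≈-sym yc)) (∔-congˡ (⊝-cong (q^-+ 2 (k * 2))))) (·-cong iq′ (≡⇒≈ (≡.cong (ip 2) (ℕₚ.+-suc N k))))) ⟩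
        ⊝ (-𝟙 · σ · (c · ρ) · (y k · c) · (𝟙 ⊟ q^ 2 · c) · ((𝟙 ⊟ y k) · u · v))
          ≈⟨ solve 7 (λ s r y c Q u v →
               :- ((:- con (+ 1)) :* s :* (c :* r) :* (y :* c) :* (con (+ 1) :- Q :* c) :* ((con (+ 1) :- y) :* u :* v))
               := (:- (s :* r :* (y :* c) :* (con (+ 1) :- c) :* (u :* ((con (+ 1) :- y :* (Q :* (c :* c))) :* v))))
                  :+ (con (+ 1) :- y :* c) :* (s :* (c :* r) :* (y :- y :* (Q :* (c :* c))) :* (u :* v))) ≈-refl
               σ ρ (y k) c (q^ 2) u v ⟩
        ⊝ (σ · ρ · (y k · c) · (𝟙 ⊟ c) · (u · ((𝟙 ⊟ y k · (q^ 2 · (c · c))) · v)))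
          ∔ (𝟙 ⊟ y k · c) · (σ · (c · ρ) · (y k ⊟ y k · (q^ 2 · (c · c))) · (u · v))
          ≈⟨ ∔-cong (⊝-cong (·-cong (·-congʳ (·-congˡ yc)) (·-congˡ (≈-trans (·-congʳ (∔-congˡ (⊝-cong (·-congˡ (≈-sym tt))))) (≈-sym ip′)))))
               (·-cong (∔-congˡ (⊝-cong yc)) (·-congʳ (·-cong (·-congˡ (≈-sym r≈)) (∔-congˡ (⊝-cong (·-congˡ (≈-sym tt))))))) ⟩
        W k ∔ (𝟙 ⊟ q^ (N * 2)) · d k ∎
        where
        open ≈-Reasoning
        σ = ε -𝟙 k
        ρ = q^ (T k * 2)
        c = q^ (k * 2)
        u = iq 2 N k
        v = ip 2 (suc (N + k))
        r≈ : q^ (T (suc k) * 2) ≈ c · ρ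
        r≈ = ≈-trans (q^≡ (ℕₚ.*-distribʳ-+ 2 k (T k))) (q^-+ (k * 2) (T k * 2))

    W-zero : W 0 ≈ 𝟘
    W-zero = ≈-trans (⊝-cong (·-congʳ (·-congˡ (∔-congˡ (⊝-cong q^0)))))
      (solve 2 (λ x z → :- (x :* (con (+ 1) :- con (+ 1)) :* z) := con (+ 0)) ≈-refl _ _)

    W-last : W (suc N) ≈ 𝟘
    W-last = ≈-trans (⊝-cong (·-congˡ (·-congʳ (iq-> 2 N (suc N) ℕₚ.≤-refl))))
      (solve 2 (λ x z → :- (x :* (con (+ 0) :* z)) := con (+ 0)) ≈-refl _ _)

    ∑d≈𝟘 : ∑ (suc N) d ≈ 𝟘
    ∑d≈𝟘 = unit-cancelˡ (𝟙 ⊟ q^ (N * 2)) (≈-trans (·-comm _ _) (geom-inverse (N * 2))) (begin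
      (𝟙 ⊟ q^ (N * 2)) · ∑ (suc N) d                    ≈⟨ ∑-·ˡ (suc N) _ d ⟨
      ∑ (suc N) (λ k → (𝟙 ⊟ q^ (N * 2)) · d k)          ≈⟨ ∔-identityˡ _ ⟨
      𝟘 ∔ ∑ (suc N) (λ k → (𝟙 ⊟ q^ (N * 2)) · d k)      ≈⟨ ∔-congʳ W-zero ⟨
      W 0 ∔ ∑ (suc N) (λ k → (𝟙 ⊟ q^ (N * 2)) · d k)    ≈⟨ telescope (suc N) (λ { k (s≤s k≤N) → W-step k k≤N }) ⟨
      W (suc N)                                         ≈⟨ W-last ⟩
      𝟘                                                 ≈⟨ ·-zeroʳ _ ⟨
      (𝟙 ⊟ q^ (N * 2)) · 𝟘                              ∎)
      where open ≈-Reasoning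

    recurrence : (𝟙 ⊟ X) · (𝟙 ⊟ X) · ∑ (suc N) (λ k → lerch k · kernel N k) ≈ ∑ (suc N′) (λ k → lerch k · kernel N′ k)
    recurrence = begin
      (𝟙 ⊟ X) · (𝟙 ⊟ X) · ∑ (suc N) (λ k → lerch k · kernel N k)        ≈⟨ ∑-·ˡ (suc N) _ _ ⟨
      ∑ (suc N) (λ k → (𝟙 ⊟ X) · (𝟙 ⊟ X) · (lerch k · kernel N k))      ≈⟨ ∑-cong (suc N) (λ { k (s≤s k≤N) → term k k≤N }) ⟩
      ∑ (suc N) (λ k → lerch k · kernel N′ k ∔ d k)                     ≈⟨ ∑-∔ (suc N) _ _ ⟩
      ∑ (suc N) (λ k → lerch k · kernel N′ k) ∔ ∑ (suc N) d             ≈⟨ ∔-cong (∑-extend N 1 vanish) ∑d≈𝟘 ⟩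
      ∑ N (λ k → lerch k · kernel N′ k) ∔ 𝟘                             ≈⟨ ∔-identityʳ _ ⟩
      ∑ N (λ k → lerch k · kernel N′ k)                                 ∎
      where
      open ≈-Reasoning
      vanish : ∀ k → N ≤ k → lerch k · kernel N′ k ≈ 𝟘
      vanish k N≤k = ≈-trans (·-congˡ (≈-trans (·-congʳ (iq-> 2 N′ k N≤k)) (·-zeroˡ _))) (·-zeroʳ _)

geom² : ℕ → Series
geom² k = geom (1 + k * 2) · geom (1 + k * 2)

partial-fractions : ∀ N → ∑ (suc N) (λ k → lerch k · kernel N k) ≈ ∏ (suc N) geom²
partial-fractions zero = begin
  𝟘 ∔ 𝟙 · q^ 0 · ((𝟙 ∔ q^ 1) · geom 1) · (𝟙 · (𝟙 · geom 2))   ≈⟨ ∔-congˡ (·-congʳ (·-congʳ (·-congˡ q^0))) ⟩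
  𝟘 ∔ 𝟙 · 𝟙 · ((𝟙 ∔ q^ 1) · geom 1) · (𝟙 · (𝟙 · geom 2))      ≈⟨ solve 3 (λ q g h → con (+ 0) :+ con (+ 1) :* con (+ 1) :* ((con (+ 1) :+ q) :* g) :* (con (+ 1) :* (con (+ 1) :* h)) := con (+ 1) :* (g :* ((con (+ 1) :+ q) :* h))) ≈-refl (q^ 1) (geom 1) (geom 2) ⟩
  𝟙 · (geom 1 · ((𝟙 ∔ q^ 1) · geom 2))                        ≈⟨ ·-congˡ (·-congˡ (geom-double 1)) ⟨
  𝟙 · (geom 1 · geom 1)                                       ∎
  where open ≈-Reasoning
partial-fractions (suc N′) = unit-cancelˡ ((𝟙 ⊟ X) · (𝟙 ⊟ X)) unit (begin
  (𝟙 ⊟ X) · (𝟙 ⊟ X) · ∑ (suc N) (λ k → lerch k · kernel N k)   ≈⟨ recurrence ⟩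
  ∑ (suc N′) (λ k → lerch k · kernel N′ k)                     ≈⟨ partial-fractions N′ ⟩
  ∏ N geom²                                           ≈⟨ ·-identityʳ _ ⟨
  ∏ N geom² · 𝟙                                       ≈⟨ ·-congˡ unit ⟨
  ∏ N geom² · ((𝟙 ⊟ X) · (𝟙 ⊟ X) · geom² N)           ≈⟨ solve 3 (λ p x g → p :* (x :* g) := x :* (p :* g)) ≈-refl (∏ N geom²) _ (geom² N) ⟩
  (𝟙 ⊟ X) · (𝟙 ⊟ X) · (∏ N geom² · geom² N)           ∎)
  where
  open ≈-Reasoning
  open PartialFractions N′
  unit : (𝟙 ⊟ X) · (𝟙 ⊟ X) · geom² N ≈ 𝟙
  unit = ≈-trans (solve 2 (λ x g → x :* x :* (g :* g) := g :* x :* (g :* x)) ≈-refl (𝟙 ⊟ X) (geom (1 + N * 2)))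
    (≈-trans (·-cong (geom-inverse (1 + N * 2)) (geom-inverse (1 + N * 2))) 𝟙²)

-- The limit N → ∞ of the partial fractions: multiplied by (q²;q²)_∞², each `kernel` tends to 1, and
-- the product side becomes the square of (q²;q²)_∞/(q;q²)_∞ = ψ.
Σlerch≈ψ² : Σ∞ lerch ≈ ψ · ψ
Σlerch≈ψ² = ≈-trans (⟶-unique {s = λ M → f₂ · f₂ · ∑ (suc M) (λ k → lerch k · kernel M k)} {t = λ M → f₂ · f₂ · ∏ (suc M) geom²}
    (λ M → ≈⇒≈[] (·-congˡ (partial-fractions M))) lhs
    (λ M → ·-congˡ[] (weaken (ℕₚ.n≤1+n M) (∏∞-⟶ geom²-Multipliable (suc M)))))
  (begin
    f₂ · f₂ · ∏∞ geom²                  ≈⟨ ·-congˡ (∏∞-· _ _ (pr⁻¹-Multipliable 0 1) (pr⁻¹-Multipliable 0 1)) ⟩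
    f₂ · f₂ · (pr⁻¹ 1 2 · pr⁻¹ 1 2)     ≈⟨ solve 2 (λ f i → f :* f :* (i :* i) := f :* i :* (f :* i)) ≈-refl f₂ (pr⁻¹ 1 2) ⟩
    f₂ · pr⁻¹ 1 2 · (f₂ · pr⁻¹ 1 2)     ≈⟨ ·-cong ψ≈ ψ≈ ⟨
    ψ · ψ                               ∎)
  where
  open ≈-Reasoning
  geom²-Multipliable : Multipliable geom²
  geom²-Multipliable k = ≈[]𝟙-· (pr⁻¹-Multipliable 0 1 k) (pr⁻¹-Multipliable 0 1 k)
  ψ≈ : ψ ≈ f₂ · pr⁻¹ 1 2
  ψ≈ = begin
    ψ                        ≈⟨ ·-identityʳ ψ ⟨
    ψ · 𝟙                    ≈⟨ ·-congˡ (pr-inverse 0 1) ⟨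
    ψ · (odds · pr⁻¹ 1 2)      ≈⟨ ·-assoc ψ odds _ ⟨
    ψ · odds · pr⁻¹ 1 2        ≈⟨ ·-congʳ ψO≈f₂ ⟩
    f₂ · pr⁻¹ 1 2            ∎
  term : ∀ M k → k ≤ M → f₂ · f₂ · (lerch k · kernel M k) ≈[ M ] lerch k
  term M k k≤M = trans[] (≈⇒≈[] (solve 4 (λ p a u v → p :* p :* (a :* (u :* v)) := a :* (p :* v) :* (p :* u)) ≈-refl f₂ (lerch k) (iq 2 M k) (ip 2 (suc (M + k)))))
    (trans[] (weaken (ℕₚ.m≤n+m∸n M k) (absorb k (O-·ˡ k (lerch-Summable k)) (trans[] (·-congˡ[] (≈⇒≈[] (iq-≤ 2 M k k≤M))) (pr-ip 1 (M ∸ k)))))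
             (weaken (ℕₚ.≤-trans (ℕₚ.≤-trans (ℕₚ.m≤m+n M k) (ℕₚ.n≤1+n (M + k))) (ℕₚ.m≤n+m (suc (M + k)) k)) (absorb k (lerch-Summable k) (pr-ip 1 (suc (M + k))))))
  lhs : (λ M → f₂ · f₂ · ∑ (suc M) (λ k → lerch k · kernel M k)) ⟶ Σ∞ lerch
  lhs M = trans[] (≈⇒≈[] (≈-sym (∑-·ˡ (suc M) (f₂ · f₂) _)))
    (trans[] (∑-cong[] (suc M) (λ { k (s≤s k≤M) → term M k k≤M })) (weaken (ℕₚ.n≤1+n M) (Σ∞-⟶ lerch-Summable (suc M))))

-- Summation over n: a limiting q-Gauss sum

negPoch : ℕ → Series
negPoch N = ∏ N (λ k → 𝟙 ∔ 𝟙 · q^ (2 + k * 2))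

gauss : ℕ → Series
gauss N = q^ (T (suc N) * 2) · negPoch N

N≤T*2 : ∀ N → N ≤ T (suc N) * 2
N≤T*2 N = ℕₚ.≤-trans (ℕₚ.m≤m+n N (T N)) (ℕₚ.m≤m*n (T (suc N)) 2)

gauss-O : ∀ N → O (T (suc N) * 2) (gauss N)
gauss-O N = O-·ˡ (T (suc N) * 2) (O-q^ (T (suc N) * 2))

summand : ℕ → ℕ → Series
summand k N = gauss N · kernel N k

summand-Summable : ∀ k → Summable (summand k)
summand-Summable k N = O-·ˡ N (weaken (N≤T*2 N) (gauss-O N))

summand-< : ∀ k N → N < k → summand k N ≈ 𝟘
summand-< k N N<k = ≈-trans (·-congˡ (≈-trans (·-congʳ (iq-> 2 N k N<k)) (·-zeroˡ _))) (·-zeroʳ (gauss N))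

private
  module Recurrence (k : ℕ) where
    z : Series
    z = q^ (suc k * 2)

    -- Telescoping certificate: `summand (suc k) N` minus z `summand k N` equals `R N` minus
    -- `R (suc N)`. As `R` starts at 0 and tends to 0, the full sums differ exactly by the factor z.
    R : ℕ → Series
    R N = (𝟙 ⊟ z) · (gauss N · (iq 2 N (suc k) · ip 2 (suc (N + k))))

    step : ∀ N → summand (suc k) N ∔ R (suc N) ≈ z · summand k N ∔ R N
    step N with k ≤? N
    ... | no k≰N = ≈-trans
      (∔-cong (summand-< (suc k) N (ℕₚ.m<n⇒m<1+n N<k)) (≈-trans (·-congˡ (≈-trans (·-congˡ (≈-trans (·-congʳ (iq-> 2 N k N<k)) (·-zeroˡ _))) (·-zeroʳ _))) (·-zeroʳ _)))
      (≈-sym (∔-cong (≈-trans (·-congˡ (summand-< k N N<k)) (·-zeroʳ z))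
        (≈-trans (·-congˡ (≈-trans (·-congˡ (≈-trans (·-congʳ (iq-> 2 N (suc k) (ℕₚ.m<n⇒m<1+n N<k))) (·-zeroˡ _))) (·-zeroʳ _))) (·-zeroʳ _))))
      where N<k = ℕₚ.≰⇒> k≰N
    ... | yes k≤N = begin
      summand (suc k) N ∔ R (suc N)
        ≈⟨ ∔-cong (·-congˡ (·-congʳ (iq-step 2 N k)))
             (·-congˡ (·-cong gauss-suc (·-congˡ (≡⇒≈ (≡.cong (λ i → ip 2 (suc i)) (≡.sym (ℕₚ.+-suc N k))))))) ⟩
      gauss N · ((𝟙 ⊟ y) · u · v) ∔ (𝟙 ⊟ z) · (y · z · (𝟙 ∔ y · z) · gauss N · (u · v))
        ≈⟨ solve 5 (λ g y z u v → g :* ((con (+ 1) :- y) :* u :* v) :+ (con (+ 1) :- z) :* (y :* z :* (con (+ 1) :+ y :* z) :* g :* (u :* v))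
             := z :* (g :* (u :* ((con (+ 1) :- y :* (z :* z)) :* v))) :+ (con (+ 1) :- z) :* (g :* ((con (+ 1) :- y) :* u :* ((con (+ 1) :- y :* (z :* z)) :* v)))) ≈-refl
             (gauss N) y z u v ⟩
      z · (gauss N · (u · ((𝟙 ⊟ y · (z · z)) · v))) ∔ (𝟙 ⊟ z) · (gauss N · ((𝟙 ⊟ y) · u · ((𝟙 ⊟ y · (z · z)) · v)))
        ≈⟨ ∔-cong (·-congˡ (·-congˡ (·-congˡ (≈-sym ip′)))) (·-congˡ (·-congˡ (·-cong (≈-sym (iq-step 2 N k)) (≈-sym ip′)))) ⟩
      z · summand k N ∔ R N ∎
      where
      open ≈-Reasoning
      y = q^ ((N ∸ k) * 2)
      u = iq 2 N k
      v = ip 2 (suc (N + suc k))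
      yz : y · z ≈ q^ (suc N * 2)
      yz = ≈-trans (≈-sym (q^-+ ((N ∸ k) * 2) (suc k * 2))) (q^≡ (≡.trans (lemma (N ∸ k) k) (≡.cong (λ i → suc i * 2) (ℕₚ.m∸n+n≡m k≤N))))
        where
        lemma : ∀ i k → i * 2 + suc k * 2 ≡ suc (i + k) * 2
        lemma = solve-∀
      gauss-suc : gauss (suc N) ≈ y · z · (𝟙 ∔ y · z) · gauss N
      gauss-suc = begin
        q^ ((suc N + T (suc N)) * 2) · (negPoch N · (𝟙 ∔ 𝟙 · q^ (2 + N * 2)))
          ≈⟨ ·-cong (≈-trans (q^≡ (ℕₚ.*-distribʳ-+ 2 (suc N) (T (suc N)))) (≈-trans (q^-+ (suc N * 2) _) (·-congʳ (≈-sym yz)))) (·-congˡ (∔-congˡ (·-congˡ (≈-sym yz)))) ⟩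
        y · z · q^ (T (suc N) * 2) · (negPoch N · (𝟙 ∔ 𝟙 · (y · z)))
          ≈⟨ solve 3 (λ w r n → w :* r :* (n :* (con (+ 1) :+ con (+ 1) :* w)) := w :* (con (+ 1) :+ w) :* (r :* n)) ≈-refl (y · z) (q^ (T (suc N) * 2)) (negPoch N) ⟩
        y · z · (𝟙 ∔ y · z) · gauss N ∎
      ip′ : ip 2 (suc (N + k)) ≈ (𝟙 ⊟ y · (z · z)) · v
      ip′ = ≈-trans (ip-step 2 (suc (N + k))) (·-cong (∔-congˡ (⊝-cong (≈-sym (≈-trans (≈-sym (·-assoc y z z)) (≈-trans (·-congʳ yz) (≈-trans (≈-sym (q^-+ (suc N * 2) (suc k * 2))) (q^≡ (lemma N k))))))))
          (≡⇒≈ (≡.cong (λ i → ip 2 (suc i)) (≡.sym (ℕₚ.+-suc N k)))))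
        where
        lemma : ∀ N k → suc N * 2 + suc k * 2 ≡ suc (suc (N + k)) * 2
        lemma = solve-∀

    sums : ∀ M → ∑ M (summand (suc k)) ∔ R M ≈ z · ∑ M (summand k)
    sums zero = ≈-trans (∔-congˡ (≈-trans (·-congˡ (≈-trans (·-congˡ (·-zeroˡ _)) (·-zeroʳ _))) (·-zeroʳ _)))
      (solve 1 (λ z → con (+ 0) :+ con (+ 0) := z :* con (+ 0)) ≈-refl z)
    sums (suc M) = begin
      ∑ M (summand (suc k)) ∔ summand (suc k) M ∔ R (suc M)     ≈⟨ ∔-assoc _ _ _ ⟩
      ∑ M (summand (suc k)) ∔ (summand (suc k) M ∔ R (suc M))   ≈⟨ ∔-congˡ (step M) ⟩
      ∑ M (summand (suc k)) ∔ (z · summand k M ∔ R M)           ≈⟨ solve 3 (λ a b c → a :+ (b :+ c) := a :+ c :+ b) ≈-refl _ _ _ ⟩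
      ∑ M (summand (suc k)) ∔ R M ∔ z · summand k M             ≈⟨ ∔-congʳ (sums M) ⟩
      z · ∑ M (summand k) ∔ z · summand k M                     ≈⟨ ·-distribˡ z _ _ ⟨
      z · (∑ M (summand k) ∔ summand k M)                       ∎
      where open ≈-Reasoning

    R-O : ∀ M → O M (R M)
    R-O M = O-·ʳ M (O-·ˡ M (weaken (N≤T*2 M) (gauss-O M)))

Σsummand-suc : ∀ k → Σ∞ (summand (suc k)) ≈ q^ (suc k * 2) · Σ∞ (summand k)
Σsummand-suc k = ≈[]⇒≈ λ M → trans[] (sym[] (Σ∞-⟶ (summand-Summable (suc k)) M))
  (trans[] (trans[] (≈⇒≈[] (≈-sym (∔-identityʳ _))) (∔-cong[] refl[] (sym[] (R-O M))))
  (trans[] (≈⇒≈[] (sums M)) (·-congˡ[] (Σ∞-⟶ (summand-Summable k) M))))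
  where open Recurrence k

Σsummand≈Σsummand₀ : ∀ k → Σ∞ (summand k) ≈ q^ (T (suc k) * 2) · Σ∞ (summand 0)
Σsummand≈Σsummand₀ zero    = ≈-sym (≈-trans (·-congʳ q^0) (·-identityˡ _))
Σsummand≈Σsummand₀ (suc k) = begin
  Σ∞ (summand (suc k))                                             ≈⟨ Σsummand-suc k ⟩
  q^ (suc k * 2) · Σ∞ (summand k)                                  ≈⟨ ·-congˡ (Σsummand≈Σsummand₀ k) ⟩
  q^ (suc k * 2) · (q^ (T (suc k) * 2) · Σ∞ (summand 0))           ≈⟨ ·-assoc _ _ _ ⟨
  q^ (suc k * 2) · q^ (T (suc k) * 2) · Σ∞ (summand 0)             ≈⟨ ·-congʳ (≈-trans (q^≡ (ℕₚ.*-distribʳ-+ 2 (suc k) (T (suc k)))) (q^-+ (suc k * 2) _)) ⟨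
  q^ (T (suc (suc k)) * 2) · Σ∞ (summand 0)                        ∎
  where open ≈-Reasoning

C₂ : Series
C₂ = pr 𝟙 2 2 · pr⁻¹ 2 2

-- The first nonzero term of the sum with index K dominates as K grows, which determines Σ summand 0.
Σsummand₀≈C₂ : Σ∞ (summand 0) ≈ C₂
Σsummand₀≈C₂ = ≈[]⇒≈ λ K → q^-cancel (T (suc K) * 2) (trans[] (≈⇒≈[] (≈-sym (Σsummand≈Σsummand₀ K))) (leading K))
  where
  leading : ∀ K → Σ∞ (summand K) ≈[ T (suc K) * 2 + K ] q^ (T (suc K) * 2) · C₂
  leading K = trans[] (weaken (ℕₚ.m≤m+n Lₖ (suc K)) (sym[] (Σ∞-⟶ (summand-Summable K) (Lₖ + suc K))))
    (trans[] (extend Lₖ) (trans[] (≈⇒≈[] (≈-trans (∔-congʳ (init K ℕₚ.≤-refl)) (≈-trans (∔-identityˡ _) first)))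
      (·-order (T (suc K) * 2) (O-q^ _) (·-cong[] (∏∞-⟶ (pr-Multipliable 𝟙 2 1) K) (weaken (ℕₚ.≤-trans (ℕₚ.m≤m+n K K) (ℕₚ.n≤1+n (K + K))) (ip-⟶ 1 (suc (K + K))))))))
    where
    Lₖ = T (suc K) * 2 + K
    T-mono : ∀ d → Lₖ ≤ T (suc (d + suc K)) * 2
    T-mono zero    = ≡.subst (Lₖ ≤_) (≡.sym (≡.trans (ℕₚ.*-distribʳ-+ 2 (suc K) (T (suc K))) (ℕₚ.+-comm (suc K * 2) _)))
      (ℕₚ.+-monoʳ-≤ (T (suc K) * 2) (ℕₚ.≤-trans (ℕₚ.n≤1+n K) (ℕₚ.m≤m*n (suc K) 2)))
    T-mono (suc d) = ℕₚ.≤-trans (T-mono d) (ℕₚ.*-monoˡ-≤ 2 (ℕₚ.m≤n+m (T (suc (d + suc K))) (suc (d + suc K))))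
    extend : ∀ d → ∑ (d + suc K) (summand K) ≈[ Lₖ ] ∑ (suc K) (summand K)
    extend zero    = refl[]
    extend (suc d) = trans[] (∔-cong[] (extend d) (O-·ˡ Lₖ (weaken (T-mono d) (gauss-O (d + suc K))))) (≈⇒≈[] (∔-identityʳ _))
    init : ∀ n → n ≤ K → ∑ n (summand K) ≈ 𝟘
    init zero    _   = ≈-refl
    init (suc n) n<K = ≈-trans (∔-cong (init n (ℕₚ.≤-trans (ℕₚ.n≤1+n n) n<K)) (summand-< K n n<K)) (∔-identityˡ 𝟘)
    first : summand K K ≈ q^ (T (suc K) * 2) · (negPoch K · ip 2 (suc (K + K)))
    first = ≈-trans (·-congˡ (·-congʳ (≈-trans (iq-≤ 2 K K ℕₚ.≤-refl) (≡⇒≈ (≡.cong (ip 2) (ℕₚ.n∸n≡0 K))))))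
      (solve 3 (λ a b c → a :* b :* (con (+ 1) :* c) := a :* (b :* c)) ≈-refl _ (negPoch K) _)

-- β in terms of the Appell–Lerch type sum

βterm≈ : ∀ n → βterm n ≈ gauss n · ∏ (suc n) geom²
βterm≈ n = ≈-trans (⊛≈· (≈-trans (mono≈q^ _) (q^≡ (expo n))) (⊛≈· (neg n) (inv (suc n)))) (≈-sym (·-assoc _ _ _))
  where
  expo : ∀ n → n * suc n ≡ T (suc n) * 2
  expo zero    = ≡.refl
  expo (suc n) = ≡.trans (lemma n) (≡.trans (≡.cong (λ z → z + (suc n * 2)) (expo n)) (≡.trans (ℕₚ.+-comm _ (suc n * 2)) (≡.sym (ℕₚ.*-distribʳ-+ 2 (suc n) (T (suc n))))))
    where
    lemma : ∀ n → suc n * suc (suc n) ≡ n * suc n + suc n * 2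
    lemma = solve-∀
  neg : ∀ n → negQ2Poch n ≈ negPoch n
  neg zero    = oneS≈𝟙
  neg (suc n) = ⊛≈· (neg n) (⊕≈∔ oneS≈𝟙 (≈-trans (mono≈q^ _) (≈-trans (q^≡ (lemma n)) (≈-sym (·-identityˡ _)))))
    where
    lemma : ∀ n → 2 * n + 2 ≡ 2 + n * 2
    lemma = solve-∀
  inv : ∀ n → prodS n (λ k → geom (2 * k + 1) ⊛ geom (2 * k + 1)) ≈ ∏ n geom²
  inv zero    = oneS≈𝟙
  inv (suc n) = ⊛≈· (inv n) (⊛≈· reindex reindex)
    where
    lemma : ∀ n → 2 * n + 1 ≡ 1 + n * 2
    lemma = solve-∀
    reindex : geom (2 * n + 1) ≈ geom (1 + n * 2)
    reindex = ≡⇒≈ (≡.cong geom (lemma n))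

-- The truncation in the definition of `𝔟` is exactly the approximant that `lim` reads for the same
-- coefficient.
𝔟≈Σ : 𝔟 ≈ Σ∞ (λ n → gauss n · ∏ (suc n) geom²)
𝔟≈Σ = ≈-trans (mk λ n → ≡.trans (sums n n) (≡.sym (at-lim _ n))) (Σ∞-cong βterm≈)
  where
  sums : ∀ n m → sumTo n (λ k → βterm k m) ≡ ∑ (suc n) βterm m
  sums zero    m = ≡.sym (≡.trans (at-∔ 𝟘 (βterm 0) m) (≡.trans (≡.cong (ℤ._+ βterm 0 m) (at-𝟘 m)) (ℤₚ.+-identityˡ _)))
  sums (suc n) m = ≡.trans (≡.cong (ℤ._+ βterm (suc n) m) (sums n m)) (≡.sym (at-∔ (∑ (suc n) βterm) (βterm (suc n)) m))

lerch′ : ℕ → Series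
lerch′ k = lerch k · q^ (T (suc k) * 2)

lerch′-Summable : Summable lerch′
lerch′-Summable k = O-·ˡ k (lerch-Summable k)

-- The summations are interchanged on the finite square k, n < M, where `summand k n` vanishing for
-- n < k completes the triangle k ≤ n. Only then does each inner sum pass to its limit, at precision
-- M.
𝔟≈C₂Σlerch′ : 𝔟 ≈ C₂ · Σ∞ lerch′
𝔟≈C₂Σlerch′ = ≈-trans 𝔟≈Σ (≈[]⇒≈ λ M → trans[] (sym[] (Σ∞-⟶ (λ n → O-·ˡ n (weaken (N≤T*2 n) (gauss-O n))) M))
  (trans[] (≈⇒≈[] (double M))
  (trans[] (∑-cong[] M (λ k _ → ·-congˡ[] (trans[] (Σ∞-⟶ (summand-Summable k) M) (≈⇒≈[] (≈-trans (Σsummand≈Σsummand₀ k) (·-congˡ Σsummand₀≈C₂))))))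
  (trans[] (≈⇒≈[] (≈-trans (∑-cong M (λ k _ → solve 3 (λ a q c → a :* (q :* c) := c :* (a :* q)) ≈-refl (lerch k) (q^ (T (suc k) * 2)) C₂)) (∑-·ˡ M C₂ lerch′)))
    (·-congˡ[] (Σ∞-⟶ lerch′-Summable M))))))
  where
  open ≈-Reasoning
  row : ∀ M n → n < M → gauss n · ∏ (suc n) geom² ≈ ∑ M (λ k → lerch k · summand k n)
  row M n n<M = begin
    gauss n · ∏ (suc n) geom²                      ≈⟨ ·-congˡ (partial-fractions n) ⟨
    gauss n · ∑ (suc n) (λ k → lerch k · kernel n k)        ≈⟨ ∑-·ˡ (suc n) (gauss n) _ ⟨
    ∑ (suc n) (λ k → gauss n · (lerch k · kernel n k))      ≈⟨ ∑-cong (suc n) (λ k _ → solve 3 (λ g a b → g :* (a :* b) := a :* (g :* b)) ≈-refl (gauss n) (lerch k) (kernel n k)) ⟩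
    ∑ (suc n) (λ k → lerch k · summand k n)             ≈⟨ ∑-extend (suc n) (M ∸ suc n) (λ k n<k → ≈-trans (·-congˡ (summand-< k n n<k)) (·-zeroʳ _)) ⟨
    ∑ (M ∸ suc n + suc n) (λ k → lerch k · summand k n) ≈⟨ ≡⇒≈ (≡.cong (λ m → ∑ m (λ k → lerch k · summand k n)) (ℕₚ.m∸n+n≡m n<M)) ⟩
    ∑ M (λ k → lerch k · summand k n)                   ∎
  double : ∀ M → ∑ M (λ n → gauss n · ∏ (suc n) geom²) ≈ ∑ M (λ k → lerch k · ∑ M (summand k))
  double M = begin
    ∑ M (λ n → gauss n · ∏ (suc n) geom²)          ≈⟨ ∑-cong M (row M) ⟩
    ∑ M (λ n → ∑ M (λ k → lerch k · summand k n))       ≈⟨ ∑-swap M M (λ n k → lerch k · summand k n) ⟩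
    ∑ M (λ k → ∑ M (λ n → lerch k · summand k n))       ≈⟨ ∑-cong M (λ k _ → ∑-·ˡ M (lerch k) (summand k)) ⟩
    ∑ M (λ k → lerch k · ∑ M (summand k))               ∎

-- (1+x)/(1-x) and its even part (1+x²)/(1-x²), x = q^{2k+1}, have the same shape: this makes
-- the even part of the Lambert series self-similar.
U-lerch′ : ∀ k → U 2 0 (lerch′ k) ≈ lerch k
U-lerch′ k = begin
  U 2 0 (lerch′ k)
    ≈⟨ U-cong 2 0 split ⟩
  U 2 0 (dil 2 sₖ · (dil 2 w ∔ q^ 1 · dil 2 (κ (+ 2) · q^ k · gₖ)))
    ≈⟨ U-dil-· 2 0 sₖ _ (s≤s z≤n) ⟩
  sₖ · U 2 0 (dil 2 w ∔ q^ 1 · dil 2 (κ (+ 2) · q^ k · gₖ))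
    ≈⟨ ·-congˡ (≈-trans (U-∔ 2 0 _ _) (∔-cong (U-dil 2 w) (≈-trans (U-q·-zero 1 _) (≈-trans (·-congˡ (U-dil-suc 2 0 _ (s≤s (s≤s z≤n)))) (·-zeroʳ _))))) ⟩
  sₖ · (w ∔ 𝟘)
    ≈⟨ ·-congˡ (∔-identityʳ w) ⟩
  lerch k ∎
  where
  open ≈-Reasoning
  e = T (suc k) * 2
  gₖ = geom (1 + k * 2)
  w = lambert k
  sₖ = ε -𝟙 k · q^ e
  g₂ = geom ((1 + k * 2) * 2)
  split : lerch′ k ≈ dil 2 sₖ · (dil 2 w ∔ q^ 1 · dil 2 (κ (+ 2) · q^ k · gₖ))
  split = begin
    ε -𝟙 k · q^ e · ((𝟙 ∔ τ k) · gₖ) · q^ e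
      ≈⟨ ·-congʳ (·-congˡ (·-congˡ (geom-double (1 + k * 2)))) ⟩
    ε -𝟙 k · q^ e · ((𝟙 ∔ τ k) · ((𝟙 ∔ τ k) · g₂)) · q^ e
      ≈⟨ solve 4 (λ s e x g → s :* e :* ((con (+ 1) :+ x) :* ((con (+ 1) :+ x) :* g)) :* e := s :* (e :* e) :* ((con (+ 1) :+ x :* x) :* g :+ con (+ 2) :* x :* g)) ≈-refl (ε -𝟙 k) (q^ e) (τ k) g₂ ⟩
    ε -𝟙 k · (q^ e · q^ e) · ((𝟙 ∔ τ k · τ k) · g₂ ∔ κ (+ 2) · τ k · g₂)
      ≈⟨ ·-cong (·-cong (≈-sym (dil-ε 2 k)) (dbl e)) (∔-cong (·-cong (∔-cong (≈-sym (dil-𝟙 2)) (dbl (1 + k * 2))) (≈-sym (dil-geom 2 (1 + k * 2)))) (·-cong (·-cong (≈-sym (dil-κ 2 (+ 2))) (≈-trans (q^-+ 1 (k * 2)) (·-congˡ (≈-sym (dil-q^ 2 k))))) (≈-sym (dil-geom 2 (1 + k * 2))))) ⟩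
    dil 2 (ε -𝟙 k) · dil 2 (q^ e) · ((dil 2 𝟙 ∔ dil 2 (τ k)) · dil 2 gₖ ∔ dil 2 (κ (+ 2)) · (q^ 1 · dil 2 (q^ k)) · dil 2 gₖ)
      ≈⟨ ·-cong (≈-sym (dil-· 2 _ _)) (∔-cong (≈-sym (≈-trans (dil-· 2 _ _) (·-congʳ (dil-∔ 2 _ _))))
           (≈-trans (solve 4 (λ c q x g → c :* (q :* x) :* g := q :* (c :* x :* g)) ≈-refl _ (q^ 1) _ _) (·-congˡ (≈-sym (≈-trans (dil-· 2 _ _) (·-congʳ (dil-· 2 _ _))))))) ⟩
    dil 2 sₖ · (dil 2 w ∔ q^ 1 · dil 2 (κ (+ 2) · q^ k · gₖ)) ∎
    where
    dbl : ∀ n → q^ n · q^ n ≈ dil 2 (q^ n)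
    dbl n = ≈-trans (≈-sym (q^-+ n n)) (≈-trans (q^≡ (lemma n)) (≈-sym (dil-q^ 2 n)))
      where
      lemma : ∀ n → n + n ≡ n * 2
      lemma = solve-∀

F : Series
F = C · (ψ · ψ)

U-𝔟 : U 2 0 𝔟 ≈ F
U-𝔟 = begin
  U 2 0 𝔟                     ≈⟨ U-cong 2 0 (≈-trans 𝔟≈C₂Σlerch′ (·-congʳ C₂≈)) ⟩
  U 2 0 (dil 2 C · Σ∞ lerch′)     ≈⟨ U-dil-· 2 0 C (Σ∞ lerch′) (s≤s z≤n) ⟩
  C · U 2 0 (Σ∞ lerch′)           ≈⟨ ·-congˡ even ⟩
  C · Σ∞ lerch                    ≈⟨ ·-congˡ Σlerch≈ψ² ⟩
  F                           ∎
  where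
  open ≈-Reasoning
  C₂≈ : C₂ ≈ dil 2 C
  C₂≈ = ≈-sym (≈-trans (dil-· 2 E (pr⁻¹ 1 1)) (·-cong (pr-dil 2 𝟙 1 0 (dil-𝟙 2))
    (≈-trans (dil-∏∞ 2 _ (pr⁻¹-Multipliable 0 0)) (∏∞-cong λ k → ≈-trans (dil-geom 2 (1 + k * 1)) (≡⇒≈ (≡.cong geom (lemma k)))))))
    where
    lemma : ∀ k → (1 + k * 1) * 2 ≡ 2 + k * 2
    lemma = solve-∀
  U-cong[] : ∀ {f g K} → f ≈[ K * 2 ] g → U 2 0 f ≈[ K ] U 2 0 g
  U-cong[] {f} {g} e = mk[] λ n l → ≡.trans (at-U 2 0 f n) (≡.trans (at< e (n * 2) (ℕₚ.*-monoˡ-< 2 l)) (≡.sym (at-U 2 0 g n)))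
  even : U 2 0 (Σ∞ lerch′) ≈ Σ∞ lerch
  even = ≈[]⇒≈ λ M → trans[] (U-cong[] (sym[] (Σ∞-⟶ lerch′-Summable (M * 2))))
    (trans[] (≈⇒≈[] (≈-trans (U-∑ 2 0 (M * 2) lerch′) (∑-cong (M * 2) (λ k _ → U-lerch′ k)))) (weaken (ℕₚ.m≤m*n M 2) (Σ∞-⟶ lerch-Summable (M * 2))))

-- Relations between p and σ

φ₃ φ₉ C₃ C₉ ψ₃ : Series
φ₃ = dil 3 φ
φ₉ = dil 3 φ₃
C₃ = dil 3 C
C₉ = dil 3 C₃
ψ₃ = dil 3 ψ

φ₃C₃≈𝟙 : φ₃ · C₃ ≈ 𝟙
φ₃C₃≈𝟙 = ≈-trans (≈-sym (dil-· 3 φ C)) (≈-trans (dil-cong 3 φC≈𝟙) (dil-𝟙 3))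

φ₉C₉≈𝟙 : φ₉ · C₉ ≈ 𝟙
φ₉C₉≈𝟙 = ≈-trans (≈-sym (dil-· 3 φ₃ C₃)) (≈-trans (dil-cong 3 φ₃C₃≈𝟙) (dil-𝟙 3))

-- `X` measures the class-1 part of φ against its class-0 part: φ(-q) = φ(-q⁹)(1 - X). Since X³ is a
-- series in q³, the powers 1, X, X² serve as a basis over such series.
p σ σ₃ ξ X : Series
p  = φ₉ · C
σ  = x⁴ φ₃ · x⁴ C
σ₃ = dil 3 σ
ξ  = κ (+ 2) · (Ω · C₃)
X  = q^ 1 · dil 3 ξ

private
  one two three : ∀ {k} → Ring.Polynomial k
  one = con (+ 1)
  two = con (+ 2)
  three = con (+ 3)

p[1-X] : p · (𝟙 ⊟ X) ≈ 𝟙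
p[1-X] = begin
  φ₉ · C · (𝟙 ⊟ X)                                          ≈⟨ ·-congˡ (∔-congˡ (⊝-cong (·-congˡ dilξ))) ⟩
  φ₉ · C · (𝟙 ⊟ q^ 1 · (κ (+ 2) · (dil 3 Ω · C₉)))          ≈⟨ solve 5 (λ f c q w d → f :* c :* (one :- q :* (two :* (w :* d))) := c :* (f :- two :* (q :* w) :* (f :* d))) ≈-refl φ₉ C (q^ 1) (dil 3 Ω) C₉ ⟩
  C · (φ₉ ⊟ κ (+ 2) · (q^ 1 · dil 3 Ω) · (φ₉ · C₉))         ≈⟨ ·-congˡ (∔-congˡ (⊝-cong (≈-trans (·-congˡ φ₉C₉≈𝟙) (·-identityʳ _)))) ⟩
  C · (φ₉ ⊟ κ (+ 2) · (q^ 1 · dil 3 Ω))                     ≈⟨ ·-congˡ φ-dissection ⟨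
  C · φ                                                     ≈⟨ ·-comm C φ ⟩
  φ · C                                                     ≈⟨ φC≈𝟙 ⟩
  𝟙                                                         ∎
  where
  open ≈-Reasoning
  dilξ : dil 3 ξ ≈ κ (+ 2) · (dil 3 Ω · C₉)
  dilξ = ≈-trans (dil-· 3 _ _) (·-cong (dil-κ 3 (+ 2)) (dil-· 3 Ω C₃))

-- The norm identity `φ⁴` divided by φ(-q³)⁴; the 8 is absorbed into ξ³.
σ[1-Y] : σ · (𝟙 ⊟ q^ 1 · (ξ · ξ · ξ)) ≈ 𝟙
σ[1-Y] = begin
  x⁴ φ₃ · x⁴ C · (𝟙 ⊟ q^ 1 · (ξ · ξ · ξ))
    ≈⟨ solve 5 (λ f c q w d → fo f :* fo c :* (one :- q :* (two :* (w :* d) :* (two :* (w :* d)) :* (two :* (w :* d))))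
         := fo c :* ((f :* f :* f :- con (+ 8) :* (q :* (w :* w :* w)) :* ((f :* d) :* (f :* d) :* (f :* d))) :* f)) ≈-refl φ₃ C (q^ 1) Ω C₃ ⟩
  x⁴ C · ((φ₃ · φ₃ · φ₃ ⊟ κ (+ 8) · (q^ 1 · (Ω · Ω · Ω)) · ((φ₃ · C₃) · (φ₃ · C₃) · (φ₃ · C₃))) · φ₃)
    ≈⟨ ·-congˡ (·-congʳ (∔-congˡ (⊝-cong (≈-trans (·-congˡ (≈-trans (·-cong (·-cong φ₃C₃≈𝟙 φ₃C₃≈𝟙) φ₃C₃≈𝟙) (≈-trans (·-congʳ 𝟙²) 𝟙²))) (·-identityʳ _))))) ⟩
  x⁴ C · ((φ₃ · φ₃ · φ₃ ⊟ κ (+ 8) · (q^ 1 · (Ω · Ω · Ω))) · φ₃)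
    ≈⟨ ·-congˡ φ⁴ ⟨
  x⁴ C · x⁴ φ
    ≈⟨ solve 2 (λ c f → fo c :* fo f := fo (f :* c)) ≈-refl C φ ⟩
  x⁴ (φ · C)
    ≈⟨ x⁴-𝟙 φC≈𝟙 ⟩
  𝟙 ∎
  where open ≈-Reasoning

σ₃[1-X³] : σ₃ · (𝟙 ⊟ X · X · X) ≈ 𝟙
σ₃[1-X³] = begin
  σ₃ · (𝟙 ⊟ X · X · X)                            ≈⟨ ·-congˡ (∔-congˡ (⊝-cong X³)) ⟩
  σ₃ · (𝟙 ⊟ dil 3 (q^ 1 · (ξ · ξ · ξ)))           ≈⟨ ·-congˡ (≈-trans (dil-⊟ 3 _ _) (∔-congʳ (dil-𝟙 3))) ⟨
  σ₃ · dil 3 (𝟙 ⊟ q^ 1 · (ξ · ξ · ξ))             ≈⟨ dil-· 3 _ _ ⟨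
  dil 3 (σ · (𝟙 ⊟ q^ 1 · (ξ · ξ · ξ)))            ≈⟨ dil-cong 3 σ[1-Y] ⟩
  dil 3 𝟙                                         ≈⟨ dil-𝟙 3 ⟩
  𝟙                                               ∎
  where
  open ≈-Reasoning
  X³ : X · X · X ≈ dil 3 (q^ 1 · (ξ · ξ · ξ))
  X³ = begin
    X · X · X                                     ≈⟨ solve 2 (λ q z → q :* z :* (q :* z) :* (q :* z) := q :* q :* q :* (z :* z :* z)) ≈-refl (q^ 1) (dil 3 ξ) ⟩
    q^ 1 · q^ 1 · q^ 1 · (dil 3 ξ · dil 3 ξ · dil 3 ξ) ≈⟨ ·-cong (≈-trans (·-congʳ (≈-sym (q^-+ 1 1))) (≈-trans (≈-sym (q^-+ 2 1)) (≈-sym (dil-q^ 3 1))))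
                                                        (≈-sym (≈-trans (dil-· 3 _ _) (·-congʳ (dil-· 3 _ _)))) ⟩
    dil 3 (q^ 1) · dil 3 (ξ · ξ · ξ)              ≈⟨ dil-· 3 _ _ ⟨
    dil 3 (q^ 1 · (ξ · ξ · ξ))                    ∎

pX : p · X ≈ p ⊟ 𝟙
pX = begin
  p · X                     ≈⟨ solve 2 (λ p x → p :* x := p :- p :* (one :- x)) ≈-refl p X ⟩
  p ⊟ p · (𝟙 ⊟ X)           ≈⟨ ∔-congˡ (⊝-cong p[1-X]) ⟩
  p ⊟ 𝟙                     ∎
  where open ≈-Reasoning

-- 1/(1 - X) = (1 + X + X²)/(1 - X³), whose denominator is a series in q³.
p≈ : p ≈ σ₃ ∔ σ₃ · X ∔ σ₃ · (X · X)
p≈ = inverse-unique {f = 𝟙 ⊟ X} (≈-trans (·-comm _ _) p[1-X])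
  (≈-trans (solve 2 (λ s x → (one :- x) :* (s :+ s :* x :+ s :* (x :* x)) := s :* (one :- x :* x :* x)) ≈-refl σ₃ X) σ₃[1-X³])

private
  -- p X = p - 1, so the left side is p³ - (p - 1)³.
  p³[1-X³] : p · p · p · (𝟙 ⊟ X · X · X) ≈ κ (+ 3) · (p · p) ⊟ κ (+ 3) · p ∔ 𝟙
  p³[1-X³] = begin
    p · p · p · (𝟙 ⊟ X · X · X)                      ≈⟨ solve 2 (λ p x → p :* p :* p :* (one :- x :* x :* x) := p :* p :* p :- p :* x :* (p :* x) :* (p :* x)) ≈-refl p X ⟩
    p · p · p ⊟ p · X · (p · X) · (p · X)            ≈⟨ ∔-congˡ (⊝-cong (·-cong (·-cong pX pX) pX)) ⟩
    p · p · p ⊟ (p ⊟ 𝟙) · (p ⊟ 𝟙) · (p ⊟ 𝟙)          ≈⟨ solve 1 (λ p → p :* p :* p :- (p :- one) :* (p :- one) :* (p :- one) := three :* (p :* p) :- three :* p :+ one) ≈-refl p ⟩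
    κ (+ 3) · (p · p) ⊟ κ (+ 3) · p ∔ 𝟙              ∎
    where open ≈-Reasoning

p-cubic : p · p · p ≈ σ₃ · (κ (+ 3) · (p · p) ⊟ κ (+ 3) · p ∔ 𝟙)
p-cubic = begin
  p · p · p                                          ≈⟨ ·-identityʳ _ ⟨
  p · p · p · 𝟙                                      ≈⟨ ·-congˡ σ₃[1-X³] ⟨
  p · p · p · (σ₃ · (𝟙 ⊟ X · X · X))                 ≈⟨ solve 3 (λ a s y → a :* (s :* y) := s :* (a :* y)) ≈-refl _ σ₃ _ ⟩
  σ₃ · (p · p · p · (𝟙 ⊟ X · X · X))                 ≈⟨ ·-congˡ p³[1-X³] ⟩
  σ₃ · (κ (+ 3) · (p · p) ⊟ κ (+ 3) · p ∔ 𝟙)         ∎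
  where open ≈-Reasoning

-- The modular equation of degree 3.
σ≈p : σ ≈ p ⊟ κ (+ 3) · (p · p) ∔ κ (+ 3) · (p · p · p)
σ≈p = begin
  x⁴ φ₃ · x⁴ C                                            ≈⟨ ≈-sym (·-identityʳ _) ⟩
  x⁴ φ₃ · x⁴ C · 𝟙                                        ≈⟨ ·-congˡ (x⁴-𝟙 φ₉C₉≈𝟙) ⟨
  x⁴ φ₃ · x⁴ C · x⁴ (φ₉ · C₉)                             ≈⟨ solve 4 (λ f c g d → fo f :* fo c :* fo (g :* d) := fo (g :* c) :* (fo f :* fo d)) ≈-refl φ₃ C φ₉ C₉ ⟩
  -- φ(-q³)⁴/φ(-q⁹)⁴ is the inverse of σ(q³), that is 1 - X³; so σ = p⁴(1 - X³) and the previous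
  -- cubic identity applies.
  x⁴ p · (x⁴ φ₃ · x⁴ C₉)                                  ≈⟨ ·-congˡ 1-X³≈ ⟨
  x⁴ p · (𝟙 ⊟ X · X · X)                                  ≈⟨ solve 2 (λ p y → fo p :* y := p :* (p :* p :* p :* y)) ≈-refl p _ ⟩
  p · (p · p · p · (𝟙 ⊟ X · X · X))                       ≈⟨ ·-congˡ p³[1-X³] ⟩
  p · (κ (+ 3) · (p · p) ⊟ κ (+ 3) · p ∔ 𝟙)               ≈⟨ solve 1 (λ p → p :* (three :* (p :* p) :- three :* p :+ one) := p :- three :* (p :* p) :+ three :* (p :* p :* p)) ≈-refl p ⟩
  p ⊟ κ (+ 3) · (p · p) ∔ κ (+ 3) · (p · p · p)           ∎
  where
  open ≈-Reasoning
  dil-x⁴ : ∀ f → dil 3 (x⁴ f) ≈ x⁴ (dil 3 f)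
  dil-x⁴ f = ≈-trans (dil-· 3 _ _) (·-congʳ (≈-trans (dil-· 3 _ _) (·-congʳ (dil-· 3 _ _))))
  1-X³≈ : 𝟙 ⊟ X · X · X ≈ x⁴ φ₃ · x⁴ C₉
  1-X³≈ = inverse-unique {f = σ₃} σ₃[1-X³] (begin
    σ₃ · (x⁴ φ₃ · x⁴ C₉)                  ≈⟨ ·-congʳ (≈-trans (dil-· 3 _ _) (·-cong (dil-x⁴ φ₃) (dil-x⁴ C))) ⟩
    x⁴ φ₉ · x⁴ C₃ · (x⁴ φ₃ · x⁴ C₉)       ≈⟨ solve 4 (λ f c g d → fo f :* fo c :* (fo g :* fo d) := fo (f :* d) :* fo (g :* c)) ≈-refl φ₉ C₃ φ₃ C₉ ⟩
    x⁴ (φ₉ · C₉) · x⁴ (φ₃ · C₃)           ≈⟨ ·-cong (x⁴-𝟙 φ₉C₉≈𝟙) (x⁴-𝟙 φ₃C₃≈𝟙) ⟩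
    𝟙 · 𝟙                                 ≈⟨ 𝟙² ⟩
    𝟙                                     ∎)

-- Squaring `p≈` produces X³ and X⁴, which are reduced by σ₃²(1 - X³) = σ₃.
p²≈ : p · p ≈ (κ (+ 3) · (σ₃ · σ₃) ⊟ κ (+ 2) · σ₃) ∔ (κ (+ 3) · (σ₃ · σ₃) ⊟ σ₃) · X ∔ κ (+ 3) · (σ₃ · σ₃) · (X · X)
p²≈ = begin
  p · p
    ≈⟨ ·-cong p≈ p≈ ⟩
  (σ₃ ∔ σ₃ · X ∔ σ₃ · (X · X)) · (σ₃ ∔ σ₃ · X ∔ σ₃ · (X · X))
    ≈⟨ solve 2 (λ s x → (s :+ s :* x :+ s :* (x :* x)) :* (s :+ s :* x :+ s :* (x :* x)) :=
         (three :* (s :* s) :- two :* (s :* (s :* (one :- x :* x :* x)))) :+ (three :* (s :* s) :- s :* (s :* (one :- x :* x :* x))) :* x :+ three :* (s :* s) :* (x :* x)) ≈-refl σ₃ X ⟩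
  (κ (+ 3) · (σ₃ · σ₃) ⊟ κ (+ 2) · (σ₃ · (σ₃ · (𝟙 ⊟ X · X · X)))) ∔ (κ (+ 3) · (σ₃ · σ₃) ⊟ σ₃ · (σ₃ · (𝟙 ⊟ X · X · X))) · X ∔ κ (+ 3) · (σ₃ · σ₃) · (X · X)
    ≈⟨ ∔-congʳ (∔-cong (∔-congˡ (⊝-cong (·-congˡ cancel))) (·-congʳ (∔-congˡ (⊝-cong cancel)))) ⟩
  _ ∎
  where
  open ≈-Reasoning
  cancel : σ₃ · (σ₃ · (𝟙 ⊟ X · X · X)) ≈ σ₃
  cancel = ≈-trans (·-congˡ σ₃[1-X³]) (·-identityʳ σ₃)

U-basis : ∀ u v w → dil 3 u ∔ dil 3 v · X ∔ dil 3 w · (X · X) ≈ dil 3 u ∔ (q^ 1 · dil 3 (v · ξ) ∔ q^ 1 · (q^ 1 · dil 3 (w · (ξ · ξ))))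
U-basis u v w = ≈-trans
  (solve 5 (λ u v w q z → u :+ v :* (q :* z) :+ w :* (q :* z :* (q :* z)) := u :+ (q :* (v :* z) :+ q :* (q :* (w :* (z :* z))))) ≈-refl (dil 3 u) (dil 3 v) (dil 3 w) (q^ 1) (dil 3 ξ))
  (∔-congˡ (∔-cong (·-congˡ (≈-sym (dil-· 3 v ξ))) (·-congˡ (·-congˡ (≈-sym (≈-trans (dil-· 3 _ _) (·-congˡ (dil-· 3 ξ ξ))))))))

U₀-basis : ∀ u v w → U 3 0 (dil 3 u ∔ dil 3 v · X ∔ dil 3 w · (X · X)) ≈ u
U₀-basis u v w = U₀-of (U-basis u v w)

-- Neither `A` nor `ξ` is expressible by the chosen functions, but their product is: `AΩ` gives
-- ψ(q³)φ(-q³), and the denominator of `ξ` removes φ(-q³).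
Aξ : A · ξ ≈ κ (+ 2) · ψ₃
Aξ = begin
  A · (κ (+ 2) · (Ω · C₃))      ≈⟨ solve 3 (λ a w c → a :* (two :* (w :* c)) := two :* (a :* w :* c)) ≈-refl A Ω C₃ ⟩
  κ (+ 2) · (A · Ω · C₃)        ≈⟨ ·-congˡ (·-congʳ (≈-trans AΩ (dil-· 3 ψ φ))) ⟩
  κ (+ 2) · (ψ₃ · φ₃ · C₃)      ≈⟨ ·-congˡ (≈-trans (·-assoc ψ₃ φ₃ C₃) (≈-trans (·-congˡ φ₃C₃≈𝟙) (·-identityʳ ψ₃))) ⟩
  κ (+ 2) · ψ₃                  ∎
  where open ≈-Reasoning

-- ψ² has the components A², 2Aψ₃, ψ₃², so in class 2 every `ξ` meets exactly one `A`, and A ξ =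
-- 2ψ₃. The multiplicities 4 and 4 are 2 times 2 and 2 squared.
U₂-basis : ∀ u v w → U 3 2 (ψ · ψ · (dil 3 u ∔ dil 3 v · X ∔ dil 3 w · (X · X))) ≈ ψ₃ · ψ₃ · (u ∔ κ (+ 4) · v ∔ κ (+ 4) · w)
U₂-basis u v w = begin
  U 3 2 (ψ · ψ · (dil 3 u ∔ dil 3 v · X ∔ dil 3 w · (X · X)))
    ≈⟨ U₂-· (ψ · ψ) _ ⟩
  _ ≈⟨ ∔-cong (∔-cong (·-cong (U₀-of ψ²) (U₂-of b)) (·-cong (U₁-of ψ²) (U₁-of b))) (·-cong (U₂-of ψ²) (U₀-of b)) ⟩
  A · A · (w · (ξ · ξ)) ∔ κ (+ 2) · (A · ψ₃) · (v · ξ) ∔ ψ₃ · ψ₃ · u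
    ≈⟨ solve 6 (λ a w x y v u → a :* a :* (w :* (x :* x)) :+ two :* (a :* y) :* (v :* x) :+ y :* y :* u := w :* (a :* x :* (a :* x)) :+ two :* y :* v :* (a :* x) :+ y :* y :* u) ≈-refl A w ξ ψ₃ v u ⟩
  w · (A · ξ · (A · ξ)) ∔ κ (+ 2) · ψ₃ · v · (A · ξ) ∔ ψ₃ · ψ₃ · u
    ≈⟨ ∔-congʳ (∔-cong (·-congˡ (·-cong Aξ Aξ)) (·-congˡ Aξ)) ⟩
  w · (κ (+ 2) · ψ₃ · (κ (+ 2) · ψ₃)) ∔ κ (+ 2) · ψ₃ · v · (κ (+ 2) · ψ₃) ∔ ψ₃ · ψ₃ · u
    ≈⟨ solve 4 (λ w y v u → w :* (two :* y :* (two :* y)) :+ two :* y :* v :* (two :* y) :+ y :* y :* u := y :* y :* (u :+ con (+ 4) :* v :+ con (+ 4) :* w)) ≈-refl w ψ₃ v u ⟩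
  ψ₃ · ψ₃ · (u ∔ κ (+ 4) · v ∔ κ (+ 4) · w) ∎
  where
  open ≈-Reasoning
  b = U-basis u v w
  ψ² : ψ · ψ ≈ dil 3 (A · A) ∔ (q^ 1 · dil 3 (κ (+ 2) · (A · ψ₃)) ∔ q^ 1 · (q^ 1 · dil 3 (ψ₃ · ψ₃)))
  ψ² = ≈-trans (·-cong ψ-dissection ψ-dissection) (≈-trans
    (solve 3 (λ a q y → (a :+ q :* y) :* (a :+ q :* y) := a :* a :+ (q :* (two :* (a :* y)) :+ q :* (q :* (y :* y)))) ≈-refl (dil 3 A) (q^ 1) (dil 3 ψ₃))
    (≈-sym (∔-cong (dil-· 3 A A) (∔-cong (·-congˡ (≈-trans (dil-· 3 _ _) (·-cong (dil-κ 3 (+ 2)) (dil-· 3 A ψ₃)))) (·-congˡ (·-congˡ (dil-· 3 ψ₃ ψ₃)))))))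

-- Powers and the lattices spanned by 3^a x^j

infixr 9 _**_
_**_ : Series → ℕ → Series
x ** zero  = 𝟙
x ** suc n = x · (x ** n)

3^ : ℕ → Series
3^ a = κ (+ (3 ^ a))

3^-+ : ∀ a b → 3^ (a + b) ≈ 3^ a · 3^ b
3^-+ a b = ≈-trans (≡⇒≈ (≡.cong κ (≡.trans (≡.cong +_ (ℕₚ.^-distribˡ-+-* 3 a b)) (ℤₚ.pos-* (3 ^ a) (3 ^ b))))) (κ-*-homo (+ (3 ^ a)) (+ (3 ^ b)))

-- An integral span given by its generators, so that operators are followed on generators and
-- extended by linearity. Requiring `1 ≤ j` excludes constants; the final inequalities use it as 2i
-- + 1 ≤ 3i.
data Lattice (x : Series) (R : ℕ → ℕ → Set) : Series → Set where
  gen   : ∀ a j → 1 ≤ j → R a j → Lattice x R (3^ a · x ** j)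
  add   : ∀ {f g} → Lattice x R f → Lattice x R g → Lattice x R (f ∔ g)
  scale : ∀ c {f} → Lattice x R f → Lattice x R (κ c · f)
  resp  : ∀ {f g} → f ≈ g → Lattice x R f → Lattice x R g

Lattice-3^ : ∀ {x R R′} b → (∀ a j → 1 ≤ j → R a j → R′ (b + a) j) → ∀ {f} → Lattice x R f → Lattice x R′ (3^ b · f)
Lattice-3^ {x} b r (gen a j 1≤j Raj) = resp (≈-trans (·-congʳ (3^-+ b a)) (·-assoc _ _ _)) (gen (b + a) j 1≤j (r a j 1≤j Raj))
Lattice-3^ b r (add l l′) = resp (≈-sym (·-distribˡ _ _ _)) (add (Lattice-3^ b r l) (Lattice-3^ b r l′))
Lattice-3^ b r (scale c {f} l) = resp (solve 3 (λ c b f → c :* (b :* f) := b :* (c :* f)) ≈-refl (κ c) (3^ b) f) (scale c (Lattice-3^ b r l))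
Lattice-3^ b r (resp e l) = resp (·-congˡ e) (Lattice-3^ b r l)

Lattice-mono : ∀ {x R R′} → (∀ a j → 1 ≤ j → R a j → R′ a j) → ∀ {f} → Lattice x R f → Lattice x R′ f
Lattice-mono r {f} l = resp (·-identityˡ f) (Lattice-3^ 0 r l)

-- 3^a x^j has weight rj - 2a, so c bounds the weight from above.
record Weight (r c a j : ℕ) : Set where
  constructor weight
  field bound : r * j ≤ c + 2 * a

Weight-3^ : ∀ {x} r b c {f} → Lattice x (Weight r (2 * b + c)) f → Lattice x (Weight r c) (3^ b · f)
Weight-3^ r b c = Lattice-3^ b λ { a j _ (weight l) → weight (ℕₚ.≤-trans l (ℕₚ.≤-reflexive (lemma b c a))) }
  where
  lemma : ∀ b c a → 2 * b + c + 2 * a ≡ c + 2 * (b + a)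
  lemma = solve-∀

Weight-mono : ∀ {x r c c′ f} → c ≤ c′ → Lattice x (Weight r c) f → Lattice x (Weight r c′) f
Weight-mono c≤c′ = Lattice-mono λ { a j _ (weight l) → weight (ℕₚ.≤-trans l (ℕₚ.+-monoˡ-≤ (2 * a) c≤c′)) }

Weight-x : ∀ {x} r c {f} → Lattice x (Weight r c) f → Lattice x (Weight r (r + c)) (x · f)
Weight-x {x} r c (gen a j 1≤j (weight l)) = resp (solve 3 (λ b x y → b :* (x :* y) := x :* (b :* y)) ≈-refl (3^ a) x (x ** j)) (gen a (suc j) (s≤s z≤n)
  (weight (≡.subst₂ _≤_ (≡.sym (ℕₚ.*-suc r j)) (≡.sym (ℕₚ.+-assoc r c (2 * a))) (ℕₚ.+-monoʳ-≤ r l))))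
Weight-x r c (add l l′) = resp (≈-sym (·-distribˡ _ _ _)) (add (Weight-x r c l) (Weight-x r c l′))
Weight-x {x} r c (scale k {f} l) = resp (solve 3 (λ c b f → c :* (b :* f) := b :* (c :* f)) ≈-refl (κ k) x f) (scale k (Weight-x r c l))
Weight-x r c (resp e l) = resp (·-congˡ e) (Weight-x r c l)

Lattice-⊟ : ∀ {x R f g} → Lattice x R f → Lattice x R g → Lattice x R (f ⊟ g)
Lattice-⊟ {g = g} l l′ = add l (resp (solve 1 (λ g → con (ℤ.- + 1) :* g := :- g) ≈-refl g) (scale (ℤ.- + 1) l′))

-- The monomials p, 3p², 3p³ of σ have weights 1, 0, 1, so multiplication by σ costs only 1 although
-- its degree in p is 3.
σ·-Weight : ∀ c {f} → Lattice p (Weight 1 c) f → Lattice p (Weight 1 (1 + c)) (σ · f)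
σ·-Weight c {f} l = resp (≈-trans (solve 2 (λ p f → p :* f :- three :* (p :* (p :* f)) :+ three :* (p :* (p :* (p :* f))) := (p :- three :* (p :* p) :+ three :* (p :* p :* p)) :* f) ≈-refl p f) (·-congʳ (≈-sym σ≈p)))
  (add (Lattice-⊟ (Weight-x 1 c l) (Weight-3^ 1 1 (1 + c) (Weight-mono (ℕₚ.n≤1+n _) (Weight-x 1 _ (Weight-x 1 c l)))))
    (Weight-3^ 1 1 (1 + c) (Weight-x 1 _ (Weight-x 1 _ (Weight-x 1 c l)))))

σ**·-Weight : ∀ k c {f} → Lattice p (Weight 1 c) f → Lattice p (Weight 1 (k + c)) (σ ** k · f)
σ**·-Weight zero    c {f} l = resp (≈-sym (·-identityˡ f)) l
σ**·-Weight (suc k) c l = resp (≈-sym (·-assoc _ _ _)) (σ·-Weight (k + c) (σ**·-Weight k c l))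

p-Weight : Lattice p (Weight 1 1) p
p-Weight = resp (solve 1 (λ p → one :* (p :* one) := p) ≈-refl p) (gen 0 1 (s≤s z≤n) (weight (s≤s z≤n)))

σ**suc-Weight : ∀ k → Lattice p (Weight 1 (suc k)) (σ ** suc k)
σ**suc-Weight k = resp (·-comm _ _) (≡.subst (λ c → Lattice p (Weight 1 c) (σ ** k · σ)) (ℕₚ.+-comm k 1) (σ**·-Weight k 1 σ-Weight))
  where
  σ-Weight : Lattice p (Weight 1 1) σ
  σ-Weight = resp (≈-trans (solve 1 (λ p → one :* (p :* one) :- three :* (p :* (p :* one)) :+ three :* (p :* (p :* (p :* one))) := p :- three :* (p :* p) :+ three :* (p :* p :* p)) ≈-refl p) (≈-sym σ≈p))
    (add (Lattice-⊟ (gen 0 1 (s≤s z≤n) (weight (s≤s z≤n))) (gen 1 2 (s≤s z≤n) (weight (s≤s (s≤s z≤n))))) (gen 1 3 (s≤s z≤n) (weight (s≤s (s≤s (s≤s z≤n))))))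

-- The functionals Λ(f) = U₃(g f) are linear over series in q³, so the cubic equation of p
-- turns their values at 1, p, p² into all values at powers of p.
module Evaluation
  (Λ : Series → Series) (D : Series)
  (Λ-cong : ∀ {f g} → f ≈ g → Λ f ≈ Λ g)
  (Λ-∔ : ∀ f g → Λ (f ∔ g) ≈ Λ f ∔ Λ g)
  (Λ-dil : ∀ h f → Λ (dil 3 h · f) ≈ h · Λ f)
  where

  infix 4 _↦_
  _↦_ : Series → Series → Set
  f ↦ w = Λ f ≈ D · w

  ↦-resp : ∀ {f g v w} → f ≈ g → v ≈ w → f ↦ v → g ↦ w
  ↦-resp e e′ l = ≈-trans (Λ-cong (≈-sym e)) (≈-trans l (·-congˡ e′))

  ↦-∔ : ∀ {f g v w} → f ↦ v → g ↦ w → f ∔ g ↦ v ∔ w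
  ↦-∔ l l′ = ≈-trans (Λ-∔ _ _) (≈-trans (∔-cong l l′) (≈-sym (·-distribˡ D _ _)))

  ↦-dil : ∀ h {f v} → f ↦ v → dil 3 h · f ↦ h · v
  ↦-dil h {f} {v} l = ≈-trans (Λ-dil h f) (≈-trans (·-congˡ l) (solve 3 (λ h d v → h :* (d :* v) := d :* (h :* v)) ≈-refl h D v))

  ↦-κ : ∀ c {f v} → f ↦ v → κ c · f ↦ κ c · v
  ↦-κ c l = ↦-resp (·-congʳ (dil-κ 3 c)) ≈-refl (↦-dil (κ c) l)

  ↦-cubic : ∀ {f v₀ v₁ v₂} → f ↦ v₀ → p · f ↦ v₁ → p · (p · f) ↦ v₂ → p · (p · (p · f)) ↦ σ · (κ (+ 3) · v₂ ∔ (κ (ℤ.- + 3) · v₁ ∔ v₀))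
  ↦-cubic {f} l₀ l₁ l₂ = ↦-resp (begin
      σ₃ · (κ (+ 3) · (p · (p · f)) ∔ (κ (ℤ.- + 3) · (p · f) ∔ f))   ≈⟨ solve 3 (λ s p f → s :* (three :* (p :* (p :* f)) :+ (con (ℤ.- + 3) :* (p :* f) :+ f)) := s :* (three :* (p :* p) :- three :* p :+ one) :* f) ≈-refl σ₃ p f ⟩
      σ₃ · (κ (+ 3) · (p · p) ⊟ κ (+ 3) · p ∔ 𝟙) · f                 ≈⟨ ·-congʳ p-cubic ⟨
      p · p · p · f                                                  ≈⟨ solve 2 (λ p f → p :* p :* p :* f := p :* (p :* (p :* f))) ≈-refl p f ⟩
      p · (p · (p · f))                                              ∎) ≈-refl
    (↦-dil σ (↦-∔ (↦-κ (+ 3) l₂) (↦-∔ (↦-κ (ℤ.- + 3) l₁) l₀)))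
    where open ≈-Reasoning

  Value : ℕ → Series → Set
  Value c f = Σ Series λ w → (f ↦ w) × Lattice σ (Weight 3 c) w

  -- γ is the weight that the functional adds. It is read off from the first three powers of p and
  -- then persists; it is 2 for `Λ₀` and 0 for `Λ₂`.
  module _ (γ : ℕ) (v₁ : Value (1 + γ) (p ** 1)) (v₂ : Value (2 + γ) (p ** 2)) (v₃ : Value (3 + γ) (p ** 3)) where

    private
      -- In the cubic recursion σ adds 3 and each coefficient 3 subtracts 2: the bounds c+3, c+2,
      -- c+1 for p²f, pf, f turn into c+4, c+3, c+4. The weight thus grows by 1 per power of p.
      next : ∀ c {f} → Value (1 + c) f → Value (2 + c) (p · f) → Value (3 + c) (p · (p · f)) → Value (4 + c) (p · (p · (p · f)))
      next c (w₀ , e₀ , l₀) (w₁ , e₁ , l₁) (w₂ , e₂ , l₂) = _ , ↦-cubic e₀ e₁ e₂ ,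
        Weight-x 3 (1 + c) (add (Weight-3^ 3 1 (1 + c) l₂) (add (resp (solve 1 (λ w → con (ℤ.- + 1) :* (three :* w) := con (ℤ.- + 3) :* w) ≈-refl w₁) (scale (ℤ.- + 1) (Weight-mono (ℕₚ.n≤1+n c) (Weight-3^ 3 1 c l₁)))) l₀))

      values : ∀ m → Value (1 + m + γ) (p ** (1 + m)) × Value (2 + m + γ) (p ** (2 + m)) × Value (3 + m + γ) (p ** (3 + m))
      values zero    = v₁ , v₂ , v₃
      values (suc m) with values m
      ... | a , b , c = b , c , next (m + γ) a b c

    Value-Weight : ∀ c {f} → Lattice p (Weight 1 c) f → Value (c + γ) f
    Value-Weight c (gen a (suc m) _ (weight l)) with values m
    ... | (w , e , lw) , _ = _ , ↦-κ _ e , Weight-3^ 3 a (c + γ) (Weight-mono bound lw)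
      where
      bound : 1 + m + γ ≤ 2 * a + (c + γ)
      bound = ≡.subst (1 + m + γ ≤_) (lemma a c γ) (ℕₚ.+-monoˡ-≤ γ (≡.subst (_≤ c + 2 * a) (ℕₚ.+-identityʳ (suc m)) l))
        where
        lemma : ∀ a c γ → c + 2 * a + γ ≡ 2 * a + (c + γ)
        lemma = solve-∀
    Value-Weight c (add l l′) with Value-Weight c l | Value-Weight c l′
    ... | w , e , lw | w′ , e′ , lw′ = _ , ↦-∔ e e′ , add lw lw′
    Value-Weight c (scale k l) with Value-Weight c l
    ... | w , e , lw = _ , ↦-κ k e , scale k lw
    Value-Weight c (resp e l) with Value-Weight c l
    ... | w , e′ , lw = w , ↦-resp e ≈-refl e′ , lw

-- Action of the two operators on the lattices

private
  dil-σ² : κ (+ 3) · (σ₃ · σ₃) ≈ dil 3 (κ (+ 3) · (σ · σ))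
  dil-σ² = ≈-sym (≈-trans (dil-· 3 _ _) (·-cong (dil-κ 3 (+ 3)) (dil-· 3 σ σ)))

  dil-κσ : ∀ c → κ c · σ₃ ≈ dil 3 (κ c · σ)
  dil-κσ c = ≈-sym (≈-trans (dil-· 3 _ _) (·-congʳ (dil-κ 3 c)))

  𝟙-basis : 𝟙 ≈ dil 3 𝟙 ∔ dil 3 𝟘 · X ∔ dil 3 𝟘 · (X · X)
  𝟙-basis = ≈-sym (≈-trans (∔-cong (∔-cong (dil-𝟙 3) (·-congʳ (dil-κ 3 (+ 0)))) (·-congʳ (dil-κ 3 (+ 0))))
    (solve 1 (λ x → one :+ con (+ 0) :* x :+ con (+ 0) :* (x :* x) := one) ≈-refl X))

  p²-basis : p · p ≈ dil 3 (κ (+ 3) · (σ · σ) ⊟ κ (+ 2) · σ) ∔ dil 3 (κ (+ 3) · (σ · σ) ⊟ σ) · X ∔ dil 3 (κ (+ 3) · (σ · σ)) · (X · X)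
  p²-basis = ≈-trans p²≈ (∔-cong (∔-cong (≈-trans (∔-cong dil-σ² (⊝-cong (dil-κσ (+ 2)))) (≈-sym (dil-⊟ 3 _ _)))
    (·-congʳ (≈-trans (∔-congʳ dil-σ²) (≈-sym (dil-⊟ 3 _ _))))) (·-congʳ dil-σ²))

module Λ₀ = Evaluation (U 3 0) 𝟙 (U-cong 3 0) (U-∔ 3 0) (λ h f → U-dil-· 3 0 h f (s≤s z≤n))

module Λ₂ = Evaluation (λ f → U 3 2 (ψ · ψ · f)) (ψ₃ · ψ₃)
  (λ e → U-cong 3 2 (·-congˡ e))
  (λ f g → ≈-trans (U-cong 3 2 (·-distribˡ (ψ · ψ) f g)) (U-∔ 3 2 _ _))
  (λ h f → ≈-trans (U-cong 3 2 (solve 3 (λ y d f → y :* (d :* f) := d :* (y :* f)) ≈-refl (ψ · ψ) (dil 3 h) f)) (U-dil-· 3 2 h _ (s≤s (s≤s (s≤s z≤n)))))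

-- Spanned by 3^r σ, 3^r σ² and 3^(r+j-1) σ^j for j ≥ 3; reached after an odd number of U₃. The
-- exception at j = 2 is forced by the coefficient 28·9 of σ² in `pσ`.
record Odd (r a j : ℕ) : Set where
  constructor odd
  field
    lower : r ≤ a
    side  : j ≤ 2 ⊎ j + r ≤ suc a

-- Spanned by 3^r σ and 3^(r+j) σ^j for j ≥ 2; reached after an even number of U₃. The surplus at j
-- ≥ 2 later pays for the gain of 9.
record Even (r a j : ℕ) : Set where
  constructor even
  field
    lower : r ≤ a
    side  : j ≤ 1 ⊎ j + r ≤ a

private
  ≤! : ∀ {m n} {_ : IsTrue (m ≤ᵇ n)} → m ≤ n
  ≤! {m} {n} {t} = ℕₚ.≤ᵇ⇒≤ m n t

  module _ where
    open Λ₀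

    e₀ : 𝟙 ↦ 𝟙
    e₀ = ≈-trans (U-cong 3 0 𝟙-basis) (≈-trans (U₀-basis 𝟙 𝟘 𝟘) (≈-sym 𝟙²))

    e₁ : p ** 1 ↦ σ
    e₁ = ≈-trans (U-cong 3 0 (≈-trans (·-identityʳ p) p≈)) (≈-trans (U₀-basis σ σ σ) (≈-sym (·-identityˡ σ)))

    e₂ : p ** 2 ↦ κ (+ 3) · (σ · σ) ⊟ κ (+ 2) · σ
    e₂ = ≈-trans (U-cong 3 0 (≈-trans (·-congˡ (·-identityʳ p)) p²-basis)) (≈-trans (U₀-basis _ _ _) (≈-sym (·-identityˡ _)))

    e₃ = ↦-cubic e₀ e₁ e₂
    e₄ = ↦-cubic e₁ e₂ e₃
    e₅ = ↦-cubic e₂ e₃ e₄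
    e₆ = ↦-cubic e₃ e₄ e₅

    v₁ : Value 3 (p ** 1)
    v₁ = _ , e₁ , resp (solve 1 (λ s → one :* (s :* one) := s) ≈-refl σ) (gen 0 1 ≤! (weight ≤!))

    v₂ : Value 4 (p ** 2)
    v₂ = _ , e₂ , resp (solve 1 (λ s → three :* (s :* (s :* one)) :+ con (ℤ.- + 2) :* (one :* (s :* one)) := three :* (s :* s) :- two :* s) ≈-refl σ)
      (add (gen 1 2 ≤! (weight ≤!)) (scale (ℤ.- + 2) (gen 0 1 ≤! (weight ≤!))))

    v₃ : Value 5 (p ** 3)
    v₃ = _ , e₃ , resp (solve 1 (λ s → con (+ 9) :* (s :* (s :* (s :* one))) :+ con (ℤ.- + 1) :* (con (+ 9) :* (s :* (s :* one))) :+ one :* (s :* one)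
           := s :* (three :* (three :* (s :* s) :- two :* s) :+ (con (ℤ.- + 3) :* s :+ one))) ≈-refl σ)
      (add (add (gen 2 3 ≤! (weight ≤!)) (scale (ℤ.- + 1) (gen 2 2 ≤! (weight ≤!)))) (gen 0 1 ≤! (weight ≤!)))

    Uσ : Lattice σ (Even 0) (U 3 0 (σ ** 1))
    Uσ = resp (≈-trans (solve 1 (λ s → con (+ 10) :* (one :* (s :* one)) :+ con (ℤ.- + 4) :* (con (+ 9) :* (s :* (s :* one))) :+ con (+ 27) :* (s :* (s :* (s :* one)))
           := one :* (s :+ (con (ℤ.- + 3) :* (t₂ s) :+ three :* (t₃ s)))) ≈-refl σ)
         (≈-sym (↦-resp (≈-trans (solve 1 (λ p → p :* one :+ (con (ℤ.- + 3) :* (p :* (p :* one)) :+ three :* (p :* (p :* (p :* one)))) := (p :- three :* (p :* p) :+ three :* (p :* p :* p)) :* one) ≈-refl p) (·-congʳ (≈-sym σ≈p)))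
            ≈-refl (↦-∔ e₁ (↦-∔ (↦-κ (ℤ.- + 3) e₂) (↦-κ (+ 3) e₃))))))
      (add (add (scale (+ 10) (gen 0 1 ≤! (even z≤n (inj₁ ≤!)))) (scale (ℤ.- + 4) (gen 2 2 ≤! (even z≤n (inj₂ ≤!))))) (gen 3 3 ≤! (even z≤n (inj₂ ≤!))))
      where
      t₂ t₃ : ∀ {k} → Ring.Polynomial k → Ring.Polynomial k
      t₂ s = three :* (s :* s) :- two :* s
      t₃ s = s :* (three :* t₂ s :+ (con (ℤ.- + 3) :* s :+ one))

    -- The weight bound would guarantee only one factor 3 in the coefficient of σ², while `Even 0`
    -- asks for 9. The expansion σ² = p² - 6p³ + 15p⁴ - 18p⁵ + 9p⁶ shows that this coefficient is
    -- 34·9.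
    Uσ² : Lattice σ (Even 0) (U 3 0 (σ ** 2))
    Uσ² = resp (≈-trans (solve 1 (λ s → con (ℤ.- + 8) :* (one :* (s :* one)) :+ con (+ 34) :* (con (+ 9) :* (s :* (s :* one))) :+ con (ℤ.- + 80) :* (con (+ 27) :* (s :* (s :* (s :* one))))
             :+ con (+ 68) :* (con (+ 81) :* (s :* (s :* (s :* (s :* one))))) :+ con (ℤ.- + 24) :* (con (+ 243) :* (s :* (s :* (s :* (s :* (s :* one))))))
             :+ con (+ 3) :* (con (+ 729) :* (s :* (s :* (s :* (s :* (s :* (s :* one)))))))
           := one :* (t₂ s :+ (con (ℤ.- + 6) :* t₃ s :+ (con (+ 15) :* t₄ s :+ (con (ℤ.- + 18) :* t₅ s :+ con (+ 9) :* t₆ s))))) ≈-refl σ)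
         (≈-sym (↦-resp (≈-trans (solve 1 (λ p → (p :* (p :* one)) :+ (con (ℤ.- + 6) :* (p :* (p :* (p :* one))) :+ (con (+ 15) :* (p :* (p :* (p :* (p :* one)))) :+ (con (ℤ.- + 18) :* (p :* (p :* (p :* (p :* (p :* one))))) :+ con (+ 9) :* (p :* (p :* (p :* (p :* (p :* (p :* one)))))))))
                := (p :- three :* (p :* p) :+ three :* (p :* p :* p)) :* ((p :- three :* (p :* p) :+ three :* (p :* p :* p)) :* one)) ≈-refl p) (·-cong (≈-sym σ≈p) (·-congʳ (≈-sym σ≈p))))
            ≈-refl (↦-∔ e₂ (↦-∔ (↦-κ (ℤ.- + 6) e₃) (↦-∔ (↦-κ (+ 15) e₄) (↦-∔ (↦-κ (ℤ.- + 18) e₅) (↦-κ (+ 9) e₆))))))))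
      (add (add (add (add (add (scale (ℤ.- + 8) (gen 0 1 ≤! (even z≤n (inj₁ ≤!)))) (scale (+ 34) (gen 2 2 ≤! (even z≤n (inj₂ ≤!)))))
        (scale (ℤ.- + 80) (gen 3 3 ≤! (even z≤n (inj₂ ≤!))))) (scale (+ 68) (gen 4 4 ≤! (even z≤n (inj₂ ≤!)))))
        (scale (ℤ.- + 24) (gen 5 5 ≤! (even z≤n (inj₂ ≤!))))) (scale (+ 3) (gen 6 6 ≤! (even z≤n (inj₂ ≤!)))))
      where
      t₂ t₃ t₄ t₅ t₆ : ∀ {k} → Ring.Polynomial k → Ring.Polynomial k
      t₂ s = three :* (s :* s) :- two :* s
      t₃ s = s :* (three :* t₂ s :+ (con (ℤ.- + 3) :* s :+ one))
      t₄ s = s :* (three :* t₃ s :+ (con (ℤ.- + 3) :* t₂ s :+ s))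
      t₅ s = s :* (three :* t₄ s :+ (con (ℤ.- + 3) :* t₃ s :+ t₂ s))
      t₆ s = s :* (three :* t₅ s :+ (con (ℤ.- + 3) :* t₄ s :+ t₃ s))

U-κ : ∀ d .{{_ : NonZero d}} c f → U d 0 (κ c · f) ≈ κ c · U d 0 f
U-κ d@(suc _) c f = ≈-trans (U-cong d 0 (·-congʳ (≈-sym (dil-κ d c)))) (U-dil-· d 0 (κ c) f (s≤s z≤n))

private
  halve : ∀ {m n} → suc (2 * m) ≤ suc (2 * n) → m ≤ n
  halve (s≤s l) = ℕₚ.*-cancelˡ-≤ 2 l

  -- For the exponent J = 3 + j, the weight bound and i ≥ 1 give 2i ≤ J + 1 + 2b ≤ 2(J - 1) + 2b;
  -- the last inequality is where J ≥ 3 enters.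
  bound-odd : ∀ r a b i j → 1 ≤ i → 3 + j + r ≤ suc a → 3 * i ≤ 3 + j + 2 + 2 * b → i + r ≤ a + b
  bound-odd r a b i j 1≤i lj li = ℕₚ.≤-trans (ℕₚ.+-monoˡ-≤ r (halve {i} {2 + j + b} (begin
      suc (2 * i)               ≤⟨ ℕₚ.+-monoˡ-≤ (2 * i) 1≤i ⟩
      i + 2 * i                 ≤⟨ li ⟩
      3 + j + 2 + 2 * b         ≡⟨ lemma₁ j b ⟩
      suc (4 + j + 2 * b)       ≤⟨ s≤s (ℕₚ.+-monoʳ-≤ 4 (ℕₚ.+-monoˡ-≤ (2 * b) (ℕₚ.m≤n*m j 2))) ⟩
      suc (4 + 2 * j + 2 * b)   ≡⟨ lemma₂ j b ⟩
      suc (2 * (2 + j + b))     ∎))) (≡.subst (_≤ a + b) (lemma₃ j r b) (ℕₚ.+-monoˡ-≤ b (s≤s⁻¹ lj)))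
    where
    open ℕₚ.≤-Reasoning
    lemma₁ : ∀ j b → 3 + j + 2 + 2 * b ≡ suc (4 + j + 2 * b)
    lemma₁ = solve-∀
    lemma₂ : ∀ j b → suc (4 + 2 * j + 2 * b) ≡ suc (2 * (2 + j + b))
    lemma₂ = solve-∀
    lemma₃ : ∀ j r b → 2 + j + r + b ≡ 2 + j + b + r
    lemma₃ = solve-∀

  -- For the exponent J = 2 + j, the weight bound and i ≥ 1 give 2(i + 1) ≤ J + 2 + 2b ≤ 2J + 2b,
  -- the last step by J ≥ 2.
  bound-even : ∀ r a b i j → 1 ≤ i → 2 + j + r ≤ a → 3 * i ≤ 2 + j + 1 + 0 + 2 * b → i + (2 + r) ≤ suc (a + b)
  bound-even r a b i j 1≤i lj li = ℕₚ.≤-trans (ℕₚ.≤-trans (ℕₚ.≤-reflexive (lemma₀ i r)) (s≤s (ℕₚ.+-monoˡ-≤ r (halve {suc i} {2 + j + b} (begin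
      suc (2 * suc i)           ≡⟨ lemma₄ i ⟩
      2 + suc (2 * i)           ≤⟨ ℕₚ.+-monoʳ-≤ 2 (ℕₚ.+-monoˡ-≤ (2 * i) 1≤i) ⟩
      2 + (i + 2 * i)           ≤⟨ ℕₚ.+-monoʳ-≤ 2 li ⟩
      2 + (2 + j + 1 + 0 + 2 * b) ≡⟨ lemma₁ j b ⟩
      suc (4 + j + 2 * b)       ≤⟨ s≤s (ℕₚ.+-monoʳ-≤ 4 (ℕₚ.+-monoˡ-≤ (2 * b) (ℕₚ.m≤n*m j 2))) ⟩
      suc (4 + 2 * j + 2 * b)   ≡⟨ lemma₂ j b ⟩
      suc (2 * (2 + j + b))     ∎))))) (s≤s (≡.subst (_≤ a + b) (lemma₃ j r b) (ℕₚ.+-monoˡ-≤ b lj)))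
    where
    open ℕₚ.≤-Reasoning
    lemma₀ : ∀ i r → i + (2 + r) ≡ suc (suc i + r)
    lemma₀ = solve-∀
    lemma₁ : ∀ j b → 2 + (2 + j + 1 + 0 + 2 * b) ≡ suc (4 + j + 2 * b)
    lemma₁ = solve-∀
    lemma₂ : ∀ j b → suc (4 + 2 * j + 2 * b) ≡ suc (2 * (2 + j + b))
    lemma₂ = solve-∀
    lemma₃ : ∀ j r b → 2 + j + r + b ≡ 2 + j + b + r
    lemma₃ = solve-∀
    lemma₄ : ∀ i → suc (2 * suc i) ≡ 2 + suc (2 * i)
    lemma₄ = solve-∀

  Even-shift : ∀ {r a} → r ≤ a → ∀ b i → 1 ≤ i → Even 0 b i → Even r (a + b) i
  Even-shift {r} {a} r≤a b i _ (even _ s) = even (ℕₚ.≤-trans r≤a (ℕₚ.m≤m+n a b)) (side s)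
    where
    side : i ≤ 1 ⊎ i + 0 ≤ b → i ≤ 1 ⊎ i + r ≤ a + b
    side (inj₁ l) = inj₁ l
    side (inj₂ l) = inj₂ (≡.subst (i + r ≤_) (ℕₚ.+-comm b a) (ℕₚ.+-mono-≤ (≡.subst (_≤ b) (ℕₚ.+-identityʳ i) l) r≤a))

  Odd-shift : ∀ {r a} → r ≤ a → ∀ b i → 1 ≤ i → Odd 2 b i → Odd (2 + r) (a + b) i
  Odd-shift {r} {a} r≤a b i _ (odd lo s) = odd (≡.subst (2 + r ≤_) (ℕₚ.+-comm b a) (ℕₚ.+-mono-≤ lo r≤a)) (side s)
    where
    side : i ≤ 2 ⊎ i + 2 ≤ suc b → i ≤ 2 ⊎ i + (2 + r) ≤ suc (a + b)
    side (inj₁ l) = inj₁ l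
    side (inj₂ l) = inj₂ (≡.subst₂ _≤_ (ℕₚ.+-assoc i 2 r) (≡.cong suc (ℕₚ.+-comm b a)) (ℕₚ.+-mono-≤ l r≤a))

U₀-σ** : ∀ j → Lattice σ (Weight 3 (3 + j + 2)) (U 3 0 (σ ** (3 + j)))
U₀-σ** j = value (Λ₀.Value-Weight 2 v₁ v₂ v₃ (3 + j) (σ**suc-Weight (2 + j)))
  where
  value : ∀ {c f} → Λ₀.Value c f → Lattice σ (Weight 3 c) (U 3 0 f)
  value (w , e , lw) = resp (≈-sym (≈-trans e (·-identityˡ w))) lw

U₀-Odd : ∀ {r f} → Lattice σ (Odd r) f → Lattice σ (Even r) (U 3 0 f)
U₀-Odd (gen a 1 _ (odd lo _)) = resp (≈-sym (U-κ 3 _ _)) (Lattice-3^ a (Even-shift lo) Uσ)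
U₀-Odd (gen a 2 _ (odd lo _)) = resp (≈-sym (U-κ 3 _ _)) (Lattice-3^ a (Even-shift lo) Uσ²)
U₀-Odd (gen a (suc (suc (suc j))) _ (odd _ (inj₁ (s≤s (s≤s ())))))
U₀-Odd {r} (gen a (suc (suc (suc j))) _ (odd lo (inj₂ l))) = resp (≈-sym (U-κ 3 _ _))
  -- The power of σ grows from 3 + j to i, but the b factors of 3 guaranteed by the weight
  -- compensate for it.
  (Lattice-3^ a (λ { b i 1≤i (weight li) → even (ℕₚ.≤-trans lo (ℕₚ.m≤m+n a b)) (inj₂ (bound-odd r a b i j 1≤i l li)) }) (U₀-σ** j))
U₀-Odd (add l l′)   = resp (≈-sym (U-∔ 3 0 _ _)) (add (U₀-Odd l) (U₀-Odd l′))
U₀-Odd (scale c l)  = resp (≈-sym (U-κ 3 c _)) (scale c (U₀-Odd l))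
U₀-Odd (resp e l)   = resp (U-cong 3 0 e) (U₀-Odd l)

private
  module _ where
    open Λ₂

    d₀ : 𝟙 ↦ 𝟙
    d₀ = ≈-trans (U-cong 3 2 (·-congˡ 𝟙-basis)) (≈-trans (U₂-basis 𝟙 𝟘 𝟘) (·-congˡ (solve 0 (one :+ con (+ 4) :* con (+ 0) :+ con (+ 4) :* con (+ 0) := one) ≈-refl)))

    d₁ : p ** 1 ↦ κ (+ 9) · σ
    d₁ = ≈-trans (U-cong 3 2 (·-congˡ (≈-trans (·-identityʳ p) p≈))) (≈-trans (U₂-basis σ σ σ) (·-congˡ (solve 1 (λ s → s :+ con (+ 4) :* s :+ con (+ 4) :* s := con (+ 9) :* s) ≈-refl σ)))

    d₂ : p ** 2 ↦ κ (+ 27) · (σ · σ) ⊟ κ (+ 6) · σ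
    d₂ = ≈-trans (U-cong 3 2 (·-congˡ (≈-trans (·-congˡ (·-identityʳ p)) p²-basis))) (≈-trans (U₂-basis _ _ _)
      (·-congˡ (solve 1 (λ s → three :* (s :* s) :- two :* s :+ con (+ 4) :* (three :* (s :* s) :- s) :+ con (+ 4) :* (three :* (s :* s)) := con (+ 27) :* (s :* s) :- con (+ 6) :* s) ≈-refl σ)))

    d₃ = ↦-cubic d₀ d₁ d₂
    d₄ = ↦-cubic d₁ d₂ d₃

    u₁ : Value 1 (p ** 1)
    u₁ = _ , d₁ , resp (solve 1 (λ s → con (+ 9) :* (s :* one) := con (+ 9) :* s) ≈-refl σ) (gen 2 1 ≤! (weight ≤!))

    u₂ : Value 2 (p ** 2)
    u₂ = _ , d₂ , resp (solve 1 (λ s → con (+ 27) :* (s :* (s :* one)) :+ con (ℤ.- + 2) :* (three :* (s :* one)) := con (+ 27) :* (s :* s) :- con (+ 6) :* s) ≈-refl σ)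
      (add (gen 3 2 ≤! (weight ≤!)) (scale (ℤ.- + 2) (gen 1 1 ≤! (weight ≤!))))

    u₃ : Value 3 (p ** 3)
    u₃ = _ , d₃ , resp (solve 1 (λ s → con (+ 81) :* (s :* (s :* (s :* one))) :+ con (ℤ.- + 5) :* (con (+ 9) :* (s :* (s :* one))) :+ one :* (s :* one)
           := s :* (three :* (con (+ 27) :* (s :* s) :- con (+ 6) :* s) :+ (con (ℤ.- + 3) :* (con (+ 9) :* s) :+ one))) ≈-refl σ)
      (add (add (gen 4 3 ≤! (weight ≤!)) (scale (ℤ.- + 5) (gen 2 2 ≤! (weight ≤!)))) (gen 0 1 ≤! (weight ≤!)))

    -- The weight bound yields only one factor 3 in the coefficient of σ. Explicitly, -6 from p² and
    -- -3 from -3p³ combine to -9, which provides the missing one.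
    pσ : Σ Series λ w → (p · σ ** 1 ↦ w) × Lattice σ (Odd 2) w
    pσ = _ , ↦-resp (≈-trans (solve 1 (λ p → p :* (p :* one) :+ (con (ℤ.- + 3) :* (p :* (p :* (p :* one))) :+ three :* (p :* (p :* (p :* (p :* one))))) := p :* ((p :- three :* (p :* p) :+ three :* (p :* p :* p)) :* one)) ≈-refl p) (·-congˡ (·-congʳ (≈-sym σ≈p))))
        ≈-refl (↦-∔ d₂ (↦-∔ (↦-κ (ℤ.- + 3) d₃) (↦-κ (+ 3) d₄))) ,
      resp (solve 1 (λ s → con (ℤ.- + 1) :* (con (+ 9) :* (s :* one)) :+ con (+ 28) :* (con (+ 9) :* (s :* (s :* one))) :+ con (ℤ.- + 11) :* (con (+ 81) :* (s :* (s :* (s :* one)))) :+ con (+ 729) :* (s :* (s :* (s :* (s :* one))))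
          := s₂ s :+ (con (ℤ.- + 3) :* s₃ s :+ three :* s₄ s)) ≈-refl σ)
      (add (add (add (scale (ℤ.- + 1) (gen 2 1 ≤! (odd ≤! (inj₁ ≤!)))) (scale (+ 28) (gen 2 2 ≤! (odd ≤! (inj₁ ≤!))))) (scale (ℤ.- + 11) (gen 4 3 ≤! (odd ≤! (inj₂ ≤!))))) (gen 6 4 ≤! (odd ≤! (inj₂ ≤!))))
      where
      s₂ s₃ s₄ : ∀ {k} → Ring.Polynomial k → Ring.Polynomial k
      s₂ s = con (+ 27) :* (s :* s) :- con (+ 6) :* s
      s₃ s = s :* (three :* s₂ s :+ (con (ℤ.- + 3) :* (con (+ 9) :* s) :+ one))
      s₄ s = s :* (three :* s₃ s :+ (con (ℤ.- + 3) :* s₂ s :+ con (+ 9) :* s))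

    Image : ℕ → Series → Set
    Image r f = Σ Series λ w → (p · f ↦ w) × Lattice σ (Odd (2 + r)) w

    Image-σ : ∀ {r} a → r ≤ a → (Σ Series λ w → (p · σ ** 1 ↦ w) × Lattice σ (Odd 2) w) → Image r (3^ a · σ ** 1)
    Image-σ a lo (w , e , lw) = _ , ↦-resp (solve 3 (λ a p s → a :* (p :* s) := p :* (a :* s)) ≈-refl (3^ a) p (σ ** 1)) ≈-refl (↦-κ (+ (3 ^ a)) e) ,
      Lattice-3^ a (Odd-shift lo) lw

    -- The gain of 9 is already present in the argument: for an exponent at least 2, membership in
    -- `Even r` forces a ≥ r + 2. It remains to control the growth of the degree, which is
    -- `bound-even`.
    Image-σ** : ∀ {r} a j → r ≤ a → 2 + j + r ≤ a → Value (2 + j + 1 + 0) (σ ** (2 + j) · p) → Image r (3^ a · σ ** (2 + j))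
    Image-σ** {r} a j lo l (w , e , lw) = _ , ↦-resp (solve 3 (λ a p s → a :* (s :* p) := p :* (a :* s)) ≈-refl (3^ a) p (σ ** (2 + j))) ≈-refl (↦-κ (+ (3 ^ a)) e) ,
      Lattice-3^ a (λ { b i 1≤i (weight li) → odd (ℕₚ.≤-trans (ℕₚ.≤-trans (ℕₚ.+-monoˡ-≤ r (ℕₚ.m≤m+n 2 j)) l) (ℕₚ.m≤m+n a b)) (inj₂ (bound-even r a b i j 1≤i l li)) }) lw

    Image-add : ∀ {r f g} → Image r f → Image r g → Image r (f ∔ g)
    Image-add (w , e , lw) (w′ , e′ , lw′) = _ , ↦-resp (≈-sym (·-distribˡ p _ _)) ≈-refl (↦-∔ e e′) , add lw lw′

    Image-scale : ∀ {r f} c → Image r f → Image r (κ c · f)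
    Image-scale {f = f} c (w , e , lw) = _ , ↦-resp (solve 3 (λ c p f → c :* (p :* f) := p :* (c :* f)) ≈-refl (κ c) p f) ≈-refl (↦-κ c e) , scale c lw

    Image-resp : ∀ {r f g} → f ≈ g → Image r f → Image r g
    Image-resp e (w , e′ , lw) = w , ↦-resp (·-congˡ e) ≈-refl e′ , lw

    Λ₂-Even : ∀ {r f} → Lattice σ (Even r) f → Image r f
    Λ₂-Even (gen a 1 _ (even lo _)) = Image-σ a lo pσ
    Λ₂-Even (gen a (suc (suc j)) _ (even _ (inj₁ (s≤s ()))))
    Λ₂-Even (gen a (suc (suc j)) _ (even lo (inj₂ l))) = Image-σ** a j lo l (Value-Weight 0 u₁ u₂ u₃ (2 + j + 1) (σ**·-Weight (2 + j) 1 p-Weight))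
    Λ₂-Even (add l l′)  = Image-add (Λ₂-Even l) (Λ₂-Even l′)
    Λ₂-Even (scale c l) = Image-scale c (Λ₂-Even l)
    Λ₂-Even (resp e l)  = Image-resp e (Λ₂-Even l)

-- Iteration along the arithmetic progression

dil-F : dil 3 F ≈ C₃ · (ψ₃ · ψ₃)
dil-F = ≈-trans (dil-· 3 C (ψ · ψ)) (·-congˡ (dil-· 3 ψ ψ))

-- Inserting φ₉ C₉ = 1 rewrites `C` as `C₉ · p`. The factor `C₉` is a series in q³ and leaves U₃ as
-- `C₃`, completing ψ₃² to F(q³); the factor `p` is why `Λ₂` is evaluated on p times a lattice
-- element.
U₂-F : ∀ {h w} → U 3 2 (ψ · ψ · (p · h)) ≈ ψ₃ · ψ₃ · w → U 3 2 (F · h) ≈ dil 3 F · w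
U₂-F {h} {w} e = begin
  U 3 2 (F · h)                            ≈⟨ U-cong 3 2 F-split ⟩
  U 3 2 (C₉ · (ψ · ψ · (p · h)))           ≈⟨ U-dil-· 3 2 C₃ _ (s≤s (s≤s (s≤s z≤n))) ⟩
  C₃ · U 3 2 (ψ · ψ · (p · h))             ≈⟨ ·-congˡ e ⟩
  C₃ · (ψ₃ · ψ₃ · w)                       ≈⟨ ·-assoc _ _ _ ⟨
  C₃ · (ψ₃ · ψ₃) · w                       ≈⟨ ·-congʳ dil-F ⟨
  dil 3 F · w                              ∎
  where
  open ≈-Reasoning
  F-split : F · h ≈ C₉ · (ψ · ψ · (p · h))
  F-split = begin
    C · (ψ · ψ) · h                        ≈⟨ ·-identityˡ _ ⟨
    𝟙 · (C · (ψ · ψ) · h)                  ≈⟨ ·-congʳ φ₉C₉≈𝟙 ⟨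
    φ₉ · C₉ · (C · (ψ · ψ) · h)            ≈⟨ solve 5 (λ f d c y h → f :* d :* (c :* y :* h) := d :* (y :* (f :* c :* h))) ≈-refl φ₉ C₉ C (ψ · ψ) h ⟩
    C₉ · (ψ · ψ · (φ₉ · C · h))            ∎

-- The residues 2, 0, 2, 0, ... are the 3-adic digits of -1/4, so the stages follow the indices x
-- with 4x + 1 divisible by growing powers of 3.
iterate : ℕ → Series
iterate zero    = U 3 2 F
iterate (suc i) = U 3 2 (U 3 0 (iterate i))

iterate-Odd : ∀ i → Σ Series λ w → (iterate i ≈ dil 3 F · w) × Lattice σ (Odd (2 + i * 2)) w
iterate-Odd zero = _ , ≈-trans (U-cong 3 2 (≈-sym (·-identityʳ F))) (U₂-F d₁) ,
  resp (solve 1 (λ s → con (+ 9) :* (s :* one) := con (+ 9) :* s) ≈-refl σ) (gen 2 1 ≤! (odd ≤! (inj₁ ≤!)))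
iterate-Odd (suc i) = step (iterate-Odd i)
  where
  step : (Σ Series λ w → (iterate i ≈ dil 3 F · w) × Lattice σ (Odd (2 + i * 2)) w) →
         Σ Series λ w → (iterate (suc i) ≈ dil 3 F · w) × Lattice σ (Odd (4 + i * 2)) w
  step (w , e , lw) = apply (Λ₂-Even (U₀-Odd lw))
    where
    apply : Image (2 + i * 2) (U 3 0 w) → Σ Series λ w′ → (iterate (suc i) ≈ dil 3 F · w′) × Lattice σ (Odd (4 + i * 2)) w′
    -- F(q³) comes out of `U 3 0` as F, exactly the form in which `U₂-F` takes it and returns F(q³).
    apply (w′ , e′ , lw′) = w′ , ≈-trans (U-cong 3 2 (≈-trans (U-cong 3 0 e) (U-dil-· 3 0 F w (s≤s z≤n)))) (U₂-F e′) , lw′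

Odd-divisible : ∀ {r f} → Lattice σ (Odd r) f → Σ Series λ g → f ≈ 3^ r · g
Odd-divisible {r} (gen a j _ (odd lo _)) = _ , ≈-trans (·-congʳ (≈-trans (≡⇒≈ (≡.cong 3^ (≡.sym (ℕₚ.m+[n∸m]≡n lo)))) (3^-+ r (a ∸ r)))) (·-assoc _ _ _)
Odd-divisible (add l l′) with Odd-divisible l | Odd-divisible l′
... | g , e | g′ , e′ = _ , ≈-trans (∔-cong e e′) (≈-sym (·-distribˡ _ _ _))
Odd-divisible {r} (scale c l) with Odd-divisible l
... | g , e = _ , ≈-trans (·-congˡ e) (solve 3 (λ c b g → c :* (b :* g) := b :* (c :* g)) ≈-refl (κ c) (3^ r) g)
Odd-divisible (resp e l) with Odd-divisible l
... | g , e′ = g , ≈-trans (≈-sym e) e′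

3^-divides : ∀ r f n → + (3 ^ r) ∣ (3^ r · f) n
3^-divides r f n = ≡.subst (λ z → + (3 ^ r) ∣ z) (≡.sym (κ-* (+ (3 ^ r)) f n))
  (≡.subst (λ z → 3 ^ r ∣ₙ z) (≡.sym (ℤₚ.abs-* (+ (3 ^ r)) (f n))) (m∣m*n _))

iterate-divisible : ∀ i n → + (3 ^ (2 + i * 2)) ∣ iterate i n
iterate-divisible i n = divide (iterate-Odd i)
  where
  r : ℕ
  r = 2 + i * 2
  factor : ∀ {w} → iterate i ≈ dil 3 F · w → (Σ Series λ g → w ≈ 3^ r · g) → + (3 ^ r) ∣ iterate i n
  factor e (g , e′) = ≡.subst (λ z → + (3 ^ r) ∣ z)
    (≡.sym (at (≈-trans e (≈-trans (·-congˡ e′) (solve 3 (λ f b g → f :* (b :* g) := b :* (f :* g)) ≈-refl (dil 3 F) (3^ r) g))) n))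
    (3^-divides r (dil 3 F · g) n)
  divide : (Σ Series λ w → (iterate i ≈ dil 3 F · w) × Lattice σ (Odd r) w) → + (3 ^ r) ∣ iterate i n
  divide (w , e , lw) = factor e (Odd-divisible lw)

index : ℕ → ℕ → ℕ
index zero    n = 2 + n * 3
index (suc i) n = index i ((2 + n * 3) * 3)

iterate-at : ∀ i n → iterate i n ≡ F (index i n)
iterate-at zero    n = at-U 3 2 F n
iterate-at (suc i) n = ≡.trans (at-U 3 2 _ n) (≡.trans (at-U 3 0 _ (2 + n * 3)) (iterate-at i ((2 + n * 3) * 3)))

-- Four times the index plus one turns the affine recursion into a purely multiplicative one and
-- keeps subtraction and halving out of the induction.
index-formula : ∀ i n → index i n * 4 + 1 ≡ 3 ^ (1 + i * 2) * (n * 4 + 3)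
index-formula zero    n = lemma n
  where
  lemma : ∀ n → (2 + n * 3) * 4 + 1 ≡ 3 * (n * 4 + 3)
  lemma = solve-∀
index-formula (suc i) n = ≡.trans (index-formula i ((2 + n * 3) * 3)) (lemma n (3 ^ (i * 2)))
  where
  lemma : ∀ n k → 3 * k * ((2 + n * 3) * 3 * 4 + 3) ≡ 3 * (3 * (3 * k)) * (n * 4 + 3)
  lemma = solve-∀

index-closed : ∀ i n → index i n * 2 ≡ 2 * 3 ^ (1 + i * 2) * n + (3 ^ (2 + i * 2) ∸ 1) / 2
index-closed i n = ≡.trans (ℕₚ.*-cancelʳ-≡ _ _ 2 (ℕₚ.+-cancelʳ-≡ 1 _ _ (≡.trans (quad (index i n)) (≡.trans (index-formula i n) (≡.trans (lemma (3 ^ (1 + i * 2)) n)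
    (≡.trans (≡.cong (λ z → 2 * 3 ^ (1 + i * 2) * n * 2 + z) (≡.sym (index-formula i 0))) (lemma′ (2 * 3 ^ (1 + i * 2) * n) (index i 0))))))))
  (≡.cong (λ z → 2 * 3 ^ (1 + i * 2) * n + z) (≡.sym half))
  where
  quad : ∀ x → x * 2 * 2 + 1 ≡ x * 4 + 1
  quad = solve-∀
  lemma : ∀ k n → k * (n * 4 + 3) ≡ 2 * k * n * 2 + k * 3
  lemma = solve-∀
  lemma′ : ∀ y x → y * 2 + (x * 4 + 1) ≡ (y + x * 2) * 2 + 1
  lemma′ = solve-∀
  triple : 3 ^ (2 + i * 2) ≡ suc (index i 0 * 2 * 2)
  triple = ≡.trans (≡.trans (ℕₚ.*-comm 3 (3 ^ (1 + i * 2))) (≡.sym (index-formula i 0))) (≡.trans (≡.sym (quad (index i 0))) (ℕₚ.+-comm (index i 0 * 2 * 2) 1))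
  half : (3 ^ (2 + i * 2) ∸ 1) / 2 ≡ index i 0 * 2
  half = ≡.trans (≡.cong (λ z → (z ∸ 1) / 2) triple) (DM.m*n/n≡m (index i 0 * 2) 2)

-- The exponent is a variable m with an equation, so that a single match replaces it at all its
-- occurrences, whether it is written 2α or 2 + 2i.
𝔟-divisible : ∀ i n {m} → m ≡ 2 + i * 2 → + (3 ^ m) ∣ 𝔟 (2 * 3 ^ (m ∸ 1) * n + (3 ^ m ∸ 1) / 2)
𝔟-divisible i n ≡.refl = ≡.subst (λ z → + (3 ^ (2 + i * 2)) ∣ z)
  (≡.trans (iterate-at i n) (≡.trans (≡.sym (at U-𝔟 (index i n))) (≡.trans (at-U 2 0 𝔟 (index i n)) (≡.cong 𝔟 (index-closed i n)))))
  (iterate-divisible i n)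

theorem1p1 : (α n : ℕ) → 1 ≤ α →
    (+ (3 ^ (2 * α))) ∣ 𝔟 (2 * 3 ^ (2 * α ∸ 1) * n + (3 ^ (2 * α) ∸ 1) / 2)
theorem1p1 (suc i) n _ = 𝔟-divisible i n (ℕₚ.*-comm 2 (suc i))
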